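{- There is an algorithm which, given an instance of the capacitated facility location problem (defined in the context) with facilities $F=\{1,\dots,m\}$ and clients $D=\{1,\dots,n\}$ whose transportation costs satisfy the Monge property $c_{hj}+c_{ik}\le c_{hk}+c_{ij}$ for all $1\le h<i\le m$, $1\le j<k\le n$ (with $a+\infty=\infty$), and given $\epsilon>0$, runs in time polynomial in the input size and $1/\epsilon$ and returns a feasible solution of cost $z_A\le(1+\epsilon)z^*$, where $z^*$ is the cost of an optimal solution.
   Context: Capacitated facility location: clients $D$, facilities $F$, opening cost $f_i\ge0$ and integer capacity $U_i$ for $i\in F$, integer demand $d_j>0$ for $j\in D$, per-unit transportation cost $c_{ij}\in\mathbb{Z}_{\ge0}\cup\{\infty\}$ ($c_{ij}=\infty$ means client $j$ cannot be served by $i$); all finite input numbers are integers. A feasible solution is a set $F'\subseteq F$ of opened facilities and fractions $x_{ij}\in[0,1]$ with $x_{ij}>0$ only if $i\in F'$, $\sum_{j}x_{ij}d_j\le U_i$ for $i\in F'$, and $\sum_{i\in F'}x_{ij}=1$ for every $j$; its cost is $\sum_{i\in F'}f_i+\sum_{i\in F',j\in D}c_{ij}d_jx_{ij}$. Demands are not assumed polynomially bounded.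
   Formalization: The accuracy ε and the fractions x_ij, both of the returned solution and of the optimal solution it is compared with, are taken to be rational numbers. -}

module Defs where

open import Data.Bool using (Bool; true; false; if_then_else_)
open import Data.Fin using (Fin; _<_)
open import Data.Fin.Subset using (Subset; _∈_)
open import Data.Integer as ℤ using (ℤ; +_; -[1+_])
open import Data.Nat as ℕ using (ℕ; zero; suc)
open import Data.Nat.Logarithm using (⌈log₂_⌉)
open import Data.Nat.Solver using (module +-*-Solver)
open import Data.Product using (_×_)
open import Data.Rational.Unnormalised as ℚ using (ℚᵘ; 0ℚᵘ; 1ℚᵘ; _≃_; ↥_; ↧ₙ_)
open import Data.Rational.Unnormalised.Properties using (+-0-commutativeMonoid; pos⇒nonZero)
open import Data.Vec using (Vec; _∷_; lookup)
open import Data.Vec.Functional using (Vector; foldr)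
open import Relation.Binary.Construct.Add.Supremum.NonStrict ℕ._≤_ using (_≤⁺_)
open import Relation.Binary.PropositionalEquality using (_≡_; _≢_)
open import Relation.Nullary.Construct.Add.Supremum using (_⁺; [_]; ⊤⁺)

open import Algebra.Properties.CommutativeMonoid.Sum +-0-commutativeMonoid using (sum)

------------------------------------------------------------------------
-- Capacitated facility location

ℕ∞ : Set
ℕ∞ = ℕ ⁺

infixl 6 _+∞_

_+∞_ : ℕ∞ → ℕ∞ → ℕ∞
[ a ] +∞ [ b ] = [ a ℕ.+ b ]
[ a ] +∞ ⊤⁺    = ⊤⁺
⊤⁺    +∞ b     = ⊤⁺

-- m facilities and n clients.
record Instance (m n : ℕ) : Set where
  field
    openingCost : Fin m → ℕ
    capacity    : Fin m → ℤ
    demand      : Fin n → ℕ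
    demand>0    : ∀ j → 0 ℕ.< demand j
    unitCost    : Fin m → Fin n → ℕ∞

Monge : ∀ {m n} → Instance m n → Set
Monge {m} {n} I =
  ∀ {h i : Fin m} {j k : Fin n} → h < i → j < k →
  (c h j +∞ c i k) ≤⁺ (c h k +∞ c i j)
  where open Instance I renaming (unitCost to c)

record Solution (m n : ℕ) : Set where
  field
    opened   : Subset m
    fraction : Fin m → Fin n → ℚᵘ

fromℤ : ℤ → ℚᵘ
fromℤ z = z ℚ./ 1

fromℕ : ℕ → ℚᵘ
fromℕ k = fromℤ (+ k)

sumOver : ∀ {m} → Subset m → (Fin m → ℚᵘ) → ℚᵘ
sumOver F a = sum λ i → if lookup F i then a i else 0ℚᵘ

record Feasible {m n} (I : Instance m n) (S : Solution m n) : Set where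
  open Instance I
  open Solution S
  field
    fraction≥0 : ∀ i j → 0ℚᵘ ℚ.≤ fraction i j
    fraction≤1 : ∀ i j → fraction i j ℚ.≤ 1ℚᵘ
    onlyOpened : ∀ i j → 0ℚᵘ ℚ.< fraction i j → i ∈ opened
    -- An infinite cost means that the facility cannot serve the client.
    onlyFinite : ∀ i j → 0ℚᵘ ℚ.< fraction i j → unitCost i j ≢ ⊤⁺
    capacities : ∀ i → i ∈ opened →
                 sum (λ j → fraction i j ℚ.* fromℕ (demand j)) ℚ.≤ fromℤ (capacity i)
    served     : ∀ j → sumOver opened (λ i → fraction i j) ≃ 1ℚᵘ

-- ∞ · d · x is 0 for x = 0; feasibility excludes ∞ · d · x with x > 0.
transport : ℕ∞ → ℕ → ℚᵘ → ℚᵘ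
transport [ c ] d x = fromℕ c ℚ.* fromℕ d ℚ.* x
transport ⊤⁺    d x = 0ℚᵘ

cost : ∀ {m n} → Instance m n → Solution m n → ℚᵘ
cost I S = sumOver opened (λ i → fromℕ (openingCost i))
     ℚ.+ sumOver opened (λ i → sum λ j → transport (unitCost i j) (demand j) (fraction i j))
  where
  open Instance I
  open Solution S

Optimal : ∀ {m n} → Instance m n → Solution m n → Set
Optimal I S = Feasible I S × (∀ S′ → Feasible I S′ → cost I S ℚ.≤ cost I S′)

------------------------------------------------------------------------
-- Model of computation: a first-order while language on binary trees with
-- natural numbers at the leaves, under a logarithmic cost measure.

data Val : Set where
  nat  : ℕ → Val
  pair : Val → Val → Val

-- ⌈log₂ (k + 1)⌉ is the length of k in binary.
size : Val → ℕ
size (nat k)    = suc ⌈log₂ suc k ⌉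
size (pair v w) = suc (size v ℕ.+ size w)

data Op₁ : Set where
  fst snd isPair : Op₁

data Op₂ : Set where
  cons add sub mul div mod leq : Op₂

-- Expressions with n free variables (de Bruijn).  `while e c b` starts from
-- the value of e and replaces the current value by that of b as long as c
-- holds; c and b refer to the current value as variable 0.
data Exp (n : ℕ) : Set where
  var   : Fin n → Exp n
  lit   : ℕ → Exp n
  op₁   : Op₁ → Exp n → Exp n
  op₂   : Op₂ → Exp n → Exp n → Exp n
  bind  : Exp n → Exp (suc n) → Exp n
  cond  : Exp n → Exp n → Exp n → Exp n
  while : Exp n → Exp (suc n) → Exp (suc n) → Exp n

Program : Set
Program = Exp 1

isTrue : Val → Bool
isTrue (nat zero) = false
isTrue _          = true

fromBool : Bool → Val
fromBool true  = nat 1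
fromBool false = nat 0

-- Operations are total: outside their intended domain, and on division by
-- zero, they return 0.
apply₁ : Op₁ → Val → Val
apply₁ fst    (pair v w) = v
apply₁ fst    (nat _)    = nat 0
apply₁ snd    (pair v w) = w
apply₁ snd    (nat _)    = nat 0
apply₁ isPair (pair v w) = nat 1
apply₁ isPair (nat _)    = nat 0

arith : Op₂ → ℕ → ℕ → Val
arith add  a b       = nat (a ℕ.+ b)
arith sub  a b       = nat (a ℕ.∸ b)
arith mul  a b       = nat (a ℕ.* b)
arith div  a zero    = nat 0
arith div  a (suc b) = nat (a ℕ./ suc b)
arith mod  a zero    = nat 0
arith mod  a (suc b) = nat (a ℕ.% suc b)
arith leq  a b       = fromBool (a ℕ.≤ᵇ b)
arith cons a b       = pair (nat a) (nat b)

apply₂ : Op₂ → Val → Val → Val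
apply₂ cons v       w       = pair v w
apply₂ o    (nat a) (nat b) = arith o a b
apply₂ _    _       _       = nat 0

infix 4 _⊢_⇓_at_

-- ρ ⊢ e ⇓ v at t : in the environment ρ, e evaluates to v at cost t.  Every
-- step is charged the size of the values it reads and writes (also when a
-- variable is merely copied), so a Turing machine can carry out an evaluation
-- of cost t in time polynomial in t and the size of ρ.
mutual

  data _⊢_⇓_at_ {n} (ρ : Vec Val n) : Exp n → Val → ℕ → Set where

    ⇓var   : ∀ {x} → ρ ⊢ var x ⇓ lookup ρ x at suc (size (lookup ρ x))

    ⇓lit   : ∀ {k} → ρ ⊢ lit k ⇓ nat k at suc (size (nat k))

    ⇓op₁   : ∀ {o e v t} →
             ρ ⊢ e ⇓ v at t →
             ρ ⊢ op₁ o e ⇓ apply₁ o v at suc (t ℕ.+ (size v ℕ.+ size (apply₁ o v)))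

    ⇓op₂   : ∀ {o e₁ e₂ v w s t} →
             ρ ⊢ e₁ ⇓ v at s → ρ ⊢ e₂ ⇓ w at t →
             ρ ⊢ op₂ o e₁ e₂ ⇓ apply₂ o v w
               at suc (s ℕ.+ t ℕ.+ (size v ℕ.+ size w ℕ.+ size (apply₂ o v w)))

    ⇓bind  : ∀ {e b v w s t} →
             ρ ⊢ e ⇓ v at s → (v ∷ ρ) ⊢ b ⇓ w at t →
             ρ ⊢ bind e b ⇓ w at suc (s ℕ.+ t)

    ⇓cond  : ∀ {c e₁ e₂ u v s t} →
             ρ ⊢ c ⇓ u at s → ρ ⊢ (if isTrue u then e₁ else e₂) ⇓ v at t →
             ρ ⊢ cond c e₁ e₂ ⇓ v at suc (s ℕ.+ t)

    ⇓while : ∀ {e c b v w s t} →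
             ρ ⊢ e ⇓ v at s → Loop ρ c b v w t →
             ρ ⊢ while e c b ⇓ w at suc (s ℕ.+ t)

  data Loop {n} (ρ : Vec Val n) (c b : Exp (suc n)) : Val → Val → ℕ → Set where

    stop : ∀ {u v s} →
           (v ∷ ρ) ⊢ c ⇓ u at s → isTrue u ≡ false →
           Loop ρ c b v v (suc s)

    step : ∀ {u v v′ w r s t} →
           (v ∷ ρ) ⊢ c ⇓ u at r → isTrue u ≡ true →
           (v ∷ ρ) ⊢ b ⇓ v′ at s → Loop ρ c b v′ w t →
           Loop ρ c b v w (suc (r ℕ.+ s ℕ.+ t))

------------------------------------------------------------------------
-- Encodings (all numbers are in binary)

encodeVector : ∀ {n} → Vector Val n → Val
encodeVector = foldr pair (nat 0)

encodeℕ∞ : ℕ∞ → Val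
encodeℕ∞ [ c ] = nat (suc c)
encodeℕ∞ ⊤⁺    = nat 0

encodeℤ : ℤ → Val
encodeℤ (+ k)    = pair (nat 0) (nat k)
encodeℤ -[1+ k ] = pair (nat 1) (nat (suc k))

-- Numerator and denominator, not necessarily in lowest terms.
encodeℚ : ℚᵘ → Val
encodeℚ q = pair (encodeℤ (↥ q)) (nat (↧ₙ q))

encodeInstance : ∀ {m n} → Instance m n → Val
encodeInstance I =
  pair (encodeVector λ i → pair (nat (openingCost i)) (encodeℤ (capacity i)))
  (pair (encodeVector λ j → nat (demand j))
        (encodeVector λ i → encodeVector λ j → encodeℕ∞ (unitCost i j)))
  where open Instance I

encodeInput : ∀ {m n} → Instance m n → ℚᵘ → Val
encodeInput I ε = pair (encodeInstance I) (encodeℚ ε)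

encodeSolution : ∀ {m n} → Solution m n → Val
encodeSolution S =
  pair (encodeVector λ i → fromBool (lookup opened i))
       (encodeVector λ i → encodeVector λ j → encodeℚ (fraction i j))
  where open Solution S

⌈1/_⌉ : (ε : ℚᵘ) .{{_ : ℚ.Positive ε}} → ℕ
⌈1/ ε ⌉ = ℤ.∣ ℚ.ceiling ((ℚ.1/ ε) {{pos⇒nonZero ε}}) ∣

-- Polynomials over ℕ.  The solver's formal negation is interpreted as the
-- identity on ℕ, so every value of this type is a polynomial with natural
-- coefficients.
open +-*-Solver public using (Polynomial; ⟦_⟧)

{-# OPTIONS --safe #-}
module Submission where

-- By the Monge property, an optimal solution serves consecutive blocks of
-- units of demand (ordered by client) by the facilities in their order, and
-- rounding the ends of the blocks shows that whole units suffice.  A dynamic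
-- program over the facilities therefore computes, for each budget, the longest
-- run of units that can be served, extending runs greedily.  Budgets are
-- multiples of V / R with R = 2 (m + 1) E and E = ⌊1/ε⌋ + 1, where V is a guess
-- of the optimal cost, which is doubled until the whole demand is met: V is
-- then at most twice the optimal cost z, and the rounding of the m + 1 budgets
-- costs at most V / 2E ≤ z / E ≤ ε z.
--
-- The program is written in a typed language in the style of safe recursion,
-- in which polynomial running time holds by construction.  Units and
-- facilities are processed from the last to the first, so that the functions
-- computed are right folds, that is, structurally recursive.

open import Defs
open import Data.Bool using (Bool; true; false; if_then_else_)
open import Data.Empty using (⊥-elim; ⊥-elim-irr)
open import Data.Fin as Fin using (Fin; zero; suc)
open import Data.Fin.Subset using (Subset) renaming (_∈_ to _∈ˢ_)
open import Data.List using (List; []; _∷_; length; foldl; foldr; reverse; tabulate; map; _ʳ++_)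
open import Data.List.Membership.Propositional using (_∈_)
open import Data.List.Membership.Propositional.Properties using (∈-map⁺; ∈-map⁻)
open import Data.List.Properties using (∷-injectiveˡ; reverse-foldl; length-tabulate; tabulate-cong; length-map; length-reverse)
open import Data.List.Relation.Unary.All as All using (All; []; _∷_)
open import Data.List.Relation.Unary.Any using (here; there)
open import Data.List.Relation.Unary.Any.Properties using (reverse⁺; reverse⁻)
open import Data.Nat as ℕ using (ℕ; zero; suc; _+_; _*_; _∸_; _^_; _≤_; _<_; _<?_; _≤?_; _⊔_; _⊓_; z≤n; s≤s)
open import Data.Nat.DivMod using (m/n≤m; m<n*o⇒m/o<n; m/n*n≤m; m*n/n≡m; /-monoˡ-≤; m≡m%n+[m/n]*n; m%n<n; +-distrib-/-∣ˡ; +-distrib-/-∣ʳ; m<n⇒m/n≡0; n/n≡1)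
open import Data.Nat.Divisibility using (∣-refl; m∣m*n)
open import Data.Nat.Induction using (<-rec)
open import Data.Nat.Logarithm using (⌈log₂_⌉; ⌈log₂⌉-mono-≤; ⌈log₂2^n⌉≡n; ⌈log₂⌈n/2⌉⌉≡⌈log₂n⌉∸1)
open import Data.Nat.Properties
open import Data.Nat.Solver using (module +-*-Solver)
open import Data.Nat.Tactic.RingSolver using (solve-∀)
open import Data.Product using (Σ; ∃; ∃-syntax; _×_; _,_; proj₁; proj₂)
open import Data.Rational.Unnormalised as ℚ using (ℚᵘ; mkℚᵘ; 0ℚᵘ; 1ℚᵘ; Positive; _≃_; *≡*; *≤*; ↧ₙ_)
import Data.Rational.Unnormalised.Properties as ℚ
open import Data.Sum using (_⊎_; inj₁; inj₂)
open import Data.Unit using (⊤; tt)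
open import Data.Vec as Vec using (Vec; lookup; _∷_; []; _++_)
open import Data.Vec.Properties using ([]=⇒lookup; lookup⇒[]=; lookup∘tabulate)
open import Function using (_∘_; id; flip)
open import Relation.Binary.Construct.Add.Supremum.NonStrict ℕ._≤_ using (_≤⁺_; [_]; _≤⊤⁺; ≤⁺-trans)
open import Relation.Binary.PropositionalEquality using (_≡_; _≢_; refl; sym; trans; cong; cong₂; subst; module ≡-Reasoning)
open import Relation.Nullary using (yes; no; does; ¬_)
open import Relation.Nullary.Construct.Add.Supremum using ([_]; ⊤⁺)
open import Relation.Nullary.Decidable using (dec-true; dec-false)

open import Algebra.Properties.CommutativeMonoid.Sum ℚ.+-0-commutativeMonoid using (sum)
open import Algebra.Properties.Semiring.Sum +-*-semiring using (∑-distrib-+; ∑-comm; sum-cong-≗; *-distribˡ-sum; *-distribʳ-sum) renaming (sum to ∑)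
open +-*-Solver using (con; var; _:+_; _:*_)

-- Demands are binary numbers, so no table can be indexed by units; it is indexed by budgets and
-- stores positions. Nothing is lost, because a longer run dominates a shorter one: a facility that
-- could serve a block gets at least as far when it starts inside the block or beyond it
-- (`extend-complete`). The number `B = R + m + 1` of keys does not depend on the size of the
-- numbers: `R` budget units make up one `V`, each of the `m` facilities may round its cost up by
-- one unit, and keys start at 1 instead of 0. A guess that fails proves that every plan costs more
-- than it. This is the lower bound on the optimum behind the doubling; success at the first guess
-- is settled by integrality. The keys form a list whose length is the value of `B`, which is
-- polynomial only with the help of `1/ε`. Safe recursion cannot build such a list from a number,
-- hence keys and guesses come from two separate loops between the typed terms.

-- A typed language with safe recursion and its compilation

infixr 5 _⊗_

data Ty : Set where
  num  : Ty
  _⊗_  : Ty → Ty → Ty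
  list : Ty → Ty

El : Ty → Set
El num      = ℕ
El (σ ⊗ τ)  = El σ × El τ
El (list τ) = List (El τ)

-- The number 0 and the empty list share a code; only the types keep them apart.
enc : ∀ τ → El τ → Val
enc num      k        = nat k
enc (σ ⊗ τ)  (v , w)  = pair (enc σ v) (enc τ w)
enc (list τ) []       = nat 0
enc (list τ) (x ∷ xs) = pair (enc τ x) (enc (list τ) xs)

Ctx : Set
Ctx = List Ty

data Arith : Set where
  plus minus quotient atMost : Arith

infixl 6 _+ₜ_ _∸ₜ_
infixl 7 _*ₜ_ _/ₜ_
infix  4 _≤ₜ_

-- Terms in the style of safe recursion: the values of the variables in Γ
-- (normal) are bounded by the input, those in Δ (safe) are accumulators.
-- Loops run over normal lists only and a product has at most one safe factor,
-- hence an iteration enlarges an accumulator by a bounded amount.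
data Tm (Γ Δ : Ctx) : Ty → Set where
  nv    : ∀ {τ} → τ ∈ Γ → Tm Γ Δ τ
  sv    : ∀ {τ} → τ ∈ Δ → Tm Γ Δ τ
  lit   : ℕ → Tm Γ Δ num
  calc : Arith → Tm Γ Δ num → Tm Γ Δ num → Tm Γ Δ num
  _*ₜ_  : Tm Γ [] num → Tm Γ Δ num → Tm Γ Δ num
  pair  : ∀ {σ τ} → Tm Γ Δ σ → Tm Γ Δ τ → Tm Γ Δ (σ ⊗ τ)
  fst   : ∀ {σ τ} → Tm Γ Δ (σ ⊗ τ) → Tm Γ Δ σ
  snd   : ∀ {σ τ} → Tm Γ Δ (σ ⊗ τ) → Tm Γ Δ τ
  nil   : ∀ {τ} → Tm Γ Δ (list τ)
  cons  : ∀ {τ} → Tm Γ Δ τ → Tm Γ Δ (list τ) → Tm Γ Δ (list τ)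
  cond  : ∀ {τ} → Tm Γ Δ num → Tm Γ Δ τ → Tm Γ Δ τ → Tm Γ Δ τ
  caseL : ∀ {σ τ} → Tm Γ Δ (list σ) → Tm Γ Δ τ → Tm Γ (list σ ∷ σ ∷ Δ) τ → Tm Γ Δ τ
  letN  : ∀ {σ τ} → Tm Γ [] σ → Tm (σ ∷ Γ) Δ τ → Tm Γ Δ τ
  fold  : ∀ {σ τ} → Tm Γ [] (list σ) → Tm Γ Δ τ → Tm (σ ∷ Γ) (τ ∷ Δ) τ → Tm Γ Δ τ

pattern _+ₜ_ a b = calc plus a b
pattern _∸ₜ_ a b = calc minus a b
pattern _/ₜ_ a b = calc quotient a b
pattern _≤ₜ_ a b = calc atMost a b

quot : ℕ → ℕ → ℕ
quot a zero    = 0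
quot a (suc b) = a ℕ./ suc b

evalArith : Arith → ℕ → ℕ → ℕ
evalArith plus     a b = a + b
evalArith minus    a b = a ∸ b
evalArith quotient a b = quot a b
evalArith atMost   a b = if a ℕ.≤ᵇ b then 1 else 0

branch : ∀ {A : Set} → ℕ → A → A → A
branch zero    a b = b
branch (suc _) a b = a

uncons : ∀ {A B : Set} → List A → B → (A → List A → B) → B
uncons []       b f = b
uncons (x ∷ xs) b f = f x xs

eval : ∀ {Γ Δ τ} → Tm Γ Δ τ → All El Γ → All El Δ → El τ
eval (nv x)        γ δ = All.lookup γ x
eval (sv x)        γ δ = All.lookup δ x
eval (lit k)       γ δ = k
eval (calc o a b) γ δ = evalArith o (eval a γ δ) (eval b γ δ)
eval (a *ₜ b)      γ δ = eval a γ [] * eval b γ δ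
eval (pair a b)    γ δ = eval a γ δ , eval b γ δ
eval (fst a)       γ δ = proj₁ (eval a γ δ)
eval (snd a)       γ δ = proj₂ (eval a γ δ)
eval nil           γ δ = []
eval (cons a b)    γ δ = eval a γ δ ∷ eval b γ δ
eval (cond c a b)  γ δ = branch (eval c γ δ) (eval a γ δ) (eval b γ δ)
eval (caseL l n c) γ δ = uncons (eval l γ δ) (eval n γ δ) λ x xs → eval c γ (xs ∷ x ∷ δ)
eval (letN a b)    γ δ = eval b (eval a γ [] ∷ γ) δ
eval (fold l z b)  γ δ = foldl (λ a x → eval b (x ∷ γ) (a ∷ δ)) (eval z γ δ) (eval l γ [])

-- Compiled code binds auxiliary values between the typed variables, so each variable carries its
-- place in the run-time environment.
Positions : Ctx → ℕ → Set
Positions Γ n = ∀ {τ} → τ ∈ Γ → Fin n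

none : ∀ {n} → Positions [] n
none ()

shift : ∀ {Γ n} k → Positions Γ n → Positions Γ (k + n)
shift k r x = k Fin.↑ʳ r x

extend : ∀ {Γ σ n} → Fin n → Positions Γ n → Positions (σ ∷ Γ) n
extend i r (here refl) = i
extend i r (there x)   = r x

opOf : Arith → Op₂
opOf plus     = add
opOf minus    = sub
opOf quotient = div
opOf atMost   = leq

compile : ∀ {Γ Δ τ n} → Positions Γ n → Positions Δ n → Tm Γ Δ τ → Exp n
compile r s (nv x)        = var (r x)
compile r s (sv x)        = var (s x)
compile r s (lit k)       = lit k
compile r s (calc o a b) = op₂ (opOf o) (compile r s a) (compile r s b)
compile r s (a *ₜ b)      = op₂ mul (compile r none a) (compile r s b)
compile r s (pair a b)    = op₂ cons (compile r s a) (compile r s b)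
compile r s (fst a)       = op₁ fst (compile r s a)
compile r s (snd a)       = op₁ snd (compile r s a)
compile r s nil           = lit 0
compile r s (cons a b)    = op₂ cons (compile r s a) (compile r s b)
compile r s (cond c a b)  = cond (compile r s c) (compile r s a) (compile r s b)
compile r s (caseL l n c) =
  bind (compile r s l)
    (cond (op₁ isPair (var zero))
      (bind (op₁ fst (var zero)) (bind (op₁ snd (var (suc zero)))
        -- The environment now starts with the tail, the head and the list itself.
        (compile (shift 3 r) (extend zero (extend (suc zero) (shift 3 s))) c)))
      (compile (shift 1 r) (shift 1 s) n))
compile r s (letN a b)    =
  bind (compile r none a) (compile (extend zero (shift 1 r)) (shift 1 s) b)
compile r s (fold l z b)  =
  -- The loop state pairs the remaining list with the accumulator. The body runs below three new
  -- bindings: accumulator, current element, state.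
  op₁ snd (while (op₂ cons (compile r none l) (compile r s z))
    (op₁ isPair (op₁ fst (var zero)))
    (bind (op₁ fst (op₁ fst (var zero))) (bind (op₁ snd (var (suc zero)))
      (op₂ cons (op₁ snd (op₁ fst (var (suc (suc zero)))))
        (compile (extend (suc zero) (shift 3 r)) (extend zero (shift 3 s)) b)))))

-- Growth of values

-- One number bounds the bit length of numbers and the length of lists alike. Bounds of components
-- are not added up, which lets the bound of an accumulator grow by mere addition.
Small : ℕ → ∀ τ → El τ → Set
Small N num      k       = k < 2 ^ N
Small N (σ ⊗ τ)  (v , w) = Small N σ v × Small N τ w
Small N (list τ) xs      = length xs ≤ N × All (Small N τ) xs

SmallEnv : ∀ {Γ} → ℕ → All El Γ → Set
SmallEnv {Γ} N γ = ∀ {τ} (x : τ ∈ Γ) → Small N τ (All.lookup γ x)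

[]ˢ : ∀ {N} → SmallEnv N []
[]ˢ ()

infixr 5 _∷ˢ_
_∷ˢ_ : ∀ {N Γ σ v} {γ : All El Γ} → Small N σ v → SmallEnv N γ → SmallEnv {σ ∷ Γ} N (v ∷ γ)
(p ∷ˢ q) (here refl) = p
(p ∷ˢ q) (there x)   = q x

small-mono : ∀ {M N} τ {v} → M ≤ N → Small M τ v → Small N τ v
small-mono num      M≤N p       = <-≤-trans p (^-monoʳ-≤ 2 M≤N)
small-mono (σ ⊗ τ)  M≤N (p , q) = small-mono σ M≤N p , small-mono τ M≤N q
small-mono (list τ) M≤N (p , q) = ≤-trans p M≤N , All.map (small-mono τ M≤N) q

smallEnv-mono : ∀ {Γ M N} {γ : All El Γ} → M ≤ N → SmallEnv M γ → SmallEnv N γ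
smallEnv-mono M≤N p {τ} x = small-mono τ M≤N (p x)

n<2^n : ∀ n → n < 2 ^ n
n<2^n zero    = s≤s z≤n
n<2^n (suc n) = begin-strict
  suc n           <⟨ s≤s (n<2^n n) ⟩
  suc (2 ^ n)     ≤⟨ +-monoˡ-≤ (2 ^ n) (m^n>0 2 n) ⟩
  2 ^ n + 2 ^ n   ≡⟨ cong (2 ^ n +_) (sym (+-identityʳ (2 ^ n))) ⟩
  2 ^ suc n       ∎
  where open ≤-Reasoning

quot≤ : ∀ a b → quot a b ≤ a
quot≤ a zero    = z≤n
quot≤ a (suc b) = m/n≤m a (suc b)

-- The exponent is a maximum plus 1 and not a sum; therefore a sum of two safe values still contains
-- the safe bound only once.
+-small : ∀ {a b} M N → a < 2 ^ M → b < 2 ^ N → a + b < 2 ^ (suc (M ℕ.⊔ N))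
+-small {a} {b} M N p q = begin-strict
  a + b                          <⟨ +-mono-< (<-≤-trans p (^-monoʳ-≤ 2 (m≤m⊔n M N))) (<-≤-trans q (^-monoʳ-≤ 2 (m≤n⊔m M N))) ⟩
  2 ^ (M ℕ.⊔ N) + 2 ^ (M ℕ.⊔ N)  ≡⟨ cong (2 ^ (M ℕ.⊔ N) +_) (sym (+-identityʳ _)) ⟩
  2 ^ suc (M ℕ.⊔ N)              ∎
  where open ≤-Reasoning

*-small : ∀ {a b} M N → a < 2 ^ M → b < 2 ^ N → a * b < 2 ^ (M + N)
*-small {a} {b} M N p q = begin-strict
  a * b           <⟨ *-mono-< p q ⟩
  2 ^ M * 2 ^ N   ≡⟨ sym (^-distribˡ-+-* 2 M N) ⟩
  2 ^ (M + N)     ∎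
  where open ≤-Reasoning

-- The increment over the safe bound: if normal values are small for `P` and safe ones for `s`, the
-- result is small for `s + growth e P`. Since `s` occurs in it once and the increment depends on
-- `P` alone, every round of a fold adds the same amount, and the bound stays polynomial.
growth : ∀ {Γ Δ τ} → Tm Γ Δ τ → Polynomial 2 → Polynomial 2
growth (nv x)        P = P
growth (sv x)        P = con 0
growth (lit k)       P = con k
growth (calc o a b) P = con 1 :+ (growth a P :+ growth b P)
growth (a *ₜ b)      P = growth a P :+ growth b P
growth (pair a b)    P = growth a P :+ growth b P
growth (fst a)       P = growth a P
growth (snd a)       P = growth a P
growth nil           P = con 0
growth (cons a b)    P = con 1 :+ (growth a P :+ growth b P)
growth (cond c a b)  P = growth a P :+ growth b P
growth (caseL l n c) P = growth l P :+ (growth n P :+ growth c P)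
growth (letN a b)    P = growth b (P :+ growth a P)
growth (fold l z b)  P = growth z P :+ growth l P :* growth b (P :+ growth l P)

module Growth (ρ : Vec ℕ 2) where

  ⟪_⟫ : Polynomial 2 → ℕ
  ⟪ P ⟫ = ⟦ P ⟧ ρ

  inˡ : ∀ s a b → s + a ≤ s + (a + b)
  inˡ s a b = +-monoʳ-≤ s (m≤m+n a b)

  inʳ : ∀ s a b → s + b ≤ s + (a + b)
  inʳ s a b = +-monoʳ-≤ s (m≤n+m b a)

  suc-⊔≤ : ∀ s a b → suc ((s + a) ℕ.⊔ (s + b)) ≤ s + (1 + (a + b))
  suc-⊔≤ s a b = ≤-trans (s≤s (⊔-lub (inˡ s a b) (inʳ s a b))) (≤-reflexive (sym (+-suc s (a + b))))

  evalArith-small : ∀ o {a b} s g h → a < 2 ^ (s + g) → b < 2 ^ (s + h) →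
                    evalArith o a b < 2 ^ (s + (1 + (g + h)))
  evalArith-small plus s g h p q =
    small-mono num (suc-⊔≤ s g h) (+-small (s + g) (s + h) p q)
  evalArith-small minus {a} {b} s g h p q =
    small-mono num (≤-trans (inˡ s g h) (+-monoʳ-≤ s (n≤1+n _))) (≤-<-trans (m∸n≤m a b) p)
  evalArith-small quotient {a} {b} s g h p q =
    small-mono num (≤-trans (inˡ s g h) (+-monoʳ-≤ s (n≤1+n _))) (≤-<-trans (quot≤ a b) p)
  evalArith-small atMost {a} {b} s g h p q =
    small-mono num (≤-trans (s≤s z≤n) (≤-reflexive (sym (+-suc s (g + h))))) (bit<2 (a ℕ.≤ᵇ b))
    where
    bit<2 : ∀ c → (if c then 1 else 0) < 2 ^ 1
    bit<2 true  = s≤s (s≤s z≤n)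
    bit<2 false = s≤s z≤n

  uncons-elim : ∀ {A B : Set} (Q : B → Set) (l : List A) {b : B} {f : A → List A → B} →
                (l ≡ [] → Q b) → (∀ x xs → l ≡ x ∷ xs → Q (f x xs)) → Q (uncons l b f)
  uncons-elim Q []      p q = p refl
  uncons-elim Q (x ∷ l) p q = q x l refl

  branch-elim : ∀ {A : Set} (Q : A → Set) k {a b : A} → Q a → Q b → Q (branch k a b)
  branch-elim Q zero    p q = q
  branch-elim Q (suc k) p q = p

  foldl-small : ∀ {σ} τ {f : El τ → El σ → El τ} {N} q s →
                (∀ {w a x} → s ≤ w → Small w τ a → Small N σ x → Small (w + q) τ (f a x)) →
                ∀ {w a} xs → s ≤ w → Small w τ a → All (Small N σ) xs →
                Small (w + length xs * q) τ (foldl f a xs)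
  foldl-small τ q s hyp {w} []       s≤w p []       = small-mono τ (m≤m+n w 0) p
  foldl-small τ q s hyp {w} (x ∷ xs) s≤w p (r ∷ rs) =
    small-mono τ (≤-reflexive (+-assoc w q _))
      (foldl-small τ q s hyp xs (≤-trans s≤w (m≤m+n w q)) (hyp s≤w p r) rs)

  growth-sound : ∀ {Γ Δ τ} (e : Tm Γ Δ τ) P s {γ : All El Γ} {δ : All El Δ} →
                 SmallEnv ⟪ P ⟫ γ → SmallEnv s δ → Small (s + ⟪ growth e P ⟫) τ (eval e γ δ)
  growth-sound (nv {τ} x) P s p q = small-mono τ (m≤n+m ⟪ P ⟫ s) (p x)
  growth-sound (sv {τ} x) P s p q = small-mono τ (m≤m+n s 0) (q x)
  growth-sound (lit k) P s p q = small-mono num (m≤n+m k s) (n<2^n k)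
  growth-sound (calc o a b) P s p q =
    evalArith-small o s _ _ (growth-sound a P s p q) (growth-sound b P s p q)
  -- Exponents add up in a product. The left factor is evaluated without safe variables, so its
  -- bound does not contain `s`; with two safe factors `s` would double.
  growth-sound (a *ₜ b) P s p q =
    small-mono num
      (≤-reflexive (trans (sym (+-assoc A s C)) (trans (cong (_+ C) (+-comm A s)) (+-assoc s A C))))
      (*-small A (s + C) (growth-sound a P 0 p []ˢ) (growth-sound b P s p q))
    where
    A = ⟪ growth a P ⟫
    C = ⟪ growth b P ⟫
  growth-sound (pair {σ} {τ} a b) P s p q =
    small-mono σ (inˡ s _ _) (growth-sound a P s p q) , small-mono τ (inʳ s _ _) (growth-sound b P s p q)
  growth-sound (fst a) P s p q = proj₁ (growth-sound a P s p q)
  growth-sound (snd a) P s p q = proj₂ (growth-sound a P s p q)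
  growth-sound nil P s p q = z≤n , []
  growth-sound (cons {τ} a b) P s p q with growth-sound b P s p q
  ... | len , all =
    ≤-trans (s≤s len) (≤-trans (s≤s (inʳ s ⟪ growth a P ⟫ _)) (≤-reflexive (sym (+-suc s _)))) ,
    small-mono τ (≤-trans (inˡ s _ _) (+-monoʳ-≤ s (n≤1+n _))) (growth-sound a P s p q) ∷
    All.map (small-mono τ (≤-trans (inʳ s ⟪ growth a P ⟫ _) (+-monoʳ-≤ s (n≤1+n _)))) all
  growth-sound (cond {τ} c a b) P s {γ} {δ} p q =
    branch-elim (Small _ τ) (eval c γ δ) (small-mono τ (inˡ s _ _) (growth-sound a P s p q))
      (small-mono τ (inʳ s _ _) (growth-sound b P s p q))
  growth-sound (caseL {σ} {τ} l n c) P s {γ} {δ} p q =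
    uncons-elim (Small _ τ) (eval l γ δ)
      (λ _ → small-mono τ (+-monoʳ-≤ s (≤-trans (m≤m+n N C) (m≤n+m (N + C) L))) (growth-sound n P s p q))
      λ x xs eq → consCase x xs (subst (Small (s + L) (list σ)) eq (growth-sound l P s p q))
    where
    L = ⟪ growth l P ⟫
    N = ⟪ growth n P ⟫
    C = ⟪ growth c P ⟫
    consCase : ∀ x xs → Small (s + L) (list σ) (x ∷ xs) →
               Small (s + (L + (N + C))) τ (eval c γ (xs ∷ x ∷ δ))
    consCase x xs (len , px ∷ pxs) =
      small-mono τ (≤-trans (≤-reflexive (+-assoc s L C)) (+-monoʳ-≤ s (+-monoʳ-≤ L (m≤n+m C N))))
        (growth-sound c P (s + L) p
          ((≤-trans (n≤1+n _) len , pxs) ∷ˢ px ∷ˢ smallEnv-mono {γ = δ} (m≤m+n s L) q))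
  growth-sound (letN {σ} a b) P s {γ} p q =
    growth-sound b (P :+ growth a P) s
      (small-mono σ (m≤n+m _ ⟪ P ⟫) (growth-sound a P 0 p []ˢ) ∷ˢ smallEnv-mono {γ = γ} (m≤m+n ⟪ P ⟫ _) p) q
  growth-sound (fold {σ} {τ} l z b) P s {γ} {δ} p q =
    small-mono τ
      (≤-trans (+-monoʳ-≤ (s + Z) (*-monoˡ-≤ Q (proj₁ list-small))) (≤-reflexive (+-assoc s Z (L * Q))))
      (foldl-small τ Q s
        (λ {w} s≤w pa px → growth-sound b P′ w (px ∷ˢ smallEnv-mono {γ = γ} (m≤m+n ⟪ P ⟫ L) p)
                             (pa ∷ˢ smallEnv-mono {γ = δ} s≤w q))
        (eval l γ []) (m≤m+n s Z) (growth-sound z P s p q)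
        (All.map (small-mono σ (m≤n+m L ⟪ P ⟫)) (proj₂ list-small)))
    where
    L = ⟪ growth l P ⟫
    Z = ⟪ growth z P ⟫
    P′ = P :+ growth l P
    Q = ⟪ growth b P′ ⟫
    list-small : Small L (list σ) (eval l γ [])
    list-small = growth-sound l P 0 p []ˢ

-- Running time of compiled terms

record Agree {Γ n} (r : Positions Γ n) (γ : All El Γ) (ρ : Vec Val n) : Set where
  constructor agree
  field at : ∀ {τ} (x : τ ∈ Γ) → lookup ρ (r x) ≡ enc τ (All.lookup γ x)

agree-none : ∀ {n} {ρ : Vec Val n} → Agree none [] ρ
agree-none = agree λ ()

agree-shift : ∀ {Γ n k} {r : Positions Γ n} {γ : All El Γ} {ρ} (ρ′ : Vec Val k) →
              Agree r γ ρ → Agree (shift k r) γ (ρ′ ++ ρ)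
agree-shift []       h          = h
agree-shift (v ∷ ρ′) h = agree (Agree.at (agree-shift ρ′ h))

agree-extend : ∀ {Γ n σ i v} {r : Positions Γ n} {γ : All El Γ} {ρ} →
               lookup ρ i ≡ enc σ v → Agree r γ ρ → Agree (extend {σ = σ} i r) (v ∷ γ) ρ
agree-extend {σ = σ} {i} {v} {r} {γ} {ρ} p (agree h) = agree at
  where
  at : ∀ {τ} (x : τ ∈ _) → lookup ρ (extend i r x) ≡ enc τ (All.lookup (v ∷ γ) x)
  at (here refl) = p
  at (there x)   = h x

Exec : ∀ {n} → Vec Val n → Exp n → Val → ℕ → Set
Exec ρ e v T = ∃ λ t → (ρ ⊢ e ⇓ v at t) × t ≤ T

exec-≤ : ∀ {n} {ρ : Vec Val n} {e v S T} → S ≤ T → Exec ρ e v S → Exec ρ e v T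
exec-≤ S≤T (t , p , t≤S) = t , p , ≤-trans t≤S S≤T

exec-var : ∀ {n} {ρ : Vec Val n} {x v A} → lookup ρ x ≡ v → size v ≤ A → Exec ρ (var x) v (1 + A)
exec-var refl p = _ , ⇓var , s≤s p

exec-op₁ : ∀ {n} {ρ : Vec Val n} {o e v T A B} → Exec ρ e v T → size v ≤ A → size (apply₁ o v) ≤ B →
           Exec ρ (op₁ o e) (apply₁ o v) (1 + (T + (A + B)))
exec-op₁ (t , p , t≤T) a b = _ , ⇓op₁ p , s≤s (+-mono-≤ t≤T (+-mono-≤ a b))

exec-op₂ : ∀ {n} {ρ : Vec Val n} {o e f v w S T A B C} → Exec ρ e v S → Exec ρ f w T →
           size v ≤ A → size w ≤ B → size (apply₂ o v w) ≤ C →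
           Exec ρ (op₂ o e f) (apply₂ o v w) (1 + (S + T + (A + B + C)))
exec-op₂ (s , p , s≤S) (t , q , t≤T) a b c =
  _ , ⇓op₂ p q , s≤s (+-mono-≤ (+-mono-≤ s≤S t≤T) (+-mono-≤ (+-mono-≤ a b) c))

exec-bind : ∀ {n} {ρ : Vec Val n} {e b v w S T} → Exec ρ e v S → Exec (v ∷ ρ) b w T →
            Exec ρ (bind e b) w (1 + (S + T))
exec-bind (s , p , s≤S) (t , q , t≤T) = _ , ⇓bind p q , s≤s (+-mono-≤ s≤S t≤T)

exec-cond : ∀ {n} {ρ : Vec Val n} {c e f u v S T} → Exec ρ c u S →
            Exec ρ (if isTrue u then e else f) v T → Exec ρ (cond c e f) v (1 + (S + T))
exec-cond (s , p , s≤S) (t , q , t≤T) = _ , ⇓cond p q , s≤s (+-mono-≤ s≤S t≤T)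

LoopExec : ∀ {n} → Vec Val n → Exp (suc n) → Exp (suc n) → Val → Val → ℕ → Set
LoopExec ρ c b v w T = ∃ λ t → Loop ρ c b v w t × t ≤ T

exec-while : ∀ {n} {ρ : Vec Val n} {e c b v w S T} → Exec ρ e v S → LoopExec ρ c b v w T →
             Exec ρ (while e c b) w (1 + (S + T))
exec-while (s , p , s≤S) (t , q , t≤T) = _ , ⇓while p q , s≤s (+-mono-≤ s≤S t≤T)

exec-stop : ∀ {n} {ρ : Vec Val n} {c b u v S} → Exec (v ∷ ρ) c u S → isTrue u ≡ false →
            LoopExec ρ c b v v (1 + S)
exec-stop (s , p , s≤S) eq = _ , stop p eq , s≤s s≤S

exec-step : ∀ {n} {ρ : Vec Val n} {c b u v v′ w R S T} → Exec (v ∷ ρ) c u R → isTrue u ≡ true →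
            Exec (v ∷ ρ) b v′ S → LoopExec ρ c b v′ w T → LoopExec ρ c b v w (1 + (R + S + T))
exec-step (r , p , r≤R) eq (s , q , s≤S) (t , l , t≤T) =
  _ , step p eq q l , s≤s (+-mono-≤ (+-mono-≤ r≤R s≤S) t≤T)

exec-≤ˡ : ∀ {n} {ρ : Vec Val n} {c b v w S T} → S ≤ T → LoopExec ρ c b v w S → LoopExec ρ c b v w T
exec-≤ˡ S≤T (t , p , t≤S) = t , p , ≤-trans t≤S S≤T

unary : (T A B : Polynomial 2) → Polynomial 2
unary T A B = con 1 :+ (T :+ (A :+ B))

binary : (S T A B C : Polynomial 2) → Polynomial 2
binary S T A B C = con 1 :+ ((S :+ T) :+ ((A :+ B) :+ C))

seq : (S T : Polynomial 2) → Polynomial 2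
seq S T = con 1 :+ (S :+ T)

sizeBound : Ty → Polynomial 2 → Polynomial 2
sizeBound num      X = con 1 :+ X
sizeBound (σ ⊗ τ)  X = con 1 :+ (sizeBound σ X :+ sizeBound τ X)
sizeBound (list τ) X = con 1 :+ X :* (con 1 :+ sizeBound τ X)

stateSize : Ty → Ty → (L X : Polynomial 2) → Polynomial 2
stateSize σ τ L X = con 1 :+ (sizeBound (list σ) L :+ sizeBound τ X)

testTime : Ty → Ty → (L X : Polynomial 2) → Polynomial 2
testTime σ τ L X = unary (unary (con 1 :+ Q) Q A) A (con 2)
  where
  Q = stateSize σ τ L X
  A = sizeBound (list σ) L

bodyTime : Ty → Ty → (L X T : Polynomial 2) → Polynomial 2
bodyTime σ τ L X T =
  seq (unary (unary (con 1 :+ Q) Q A) A I)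
    (seq (unary (con 1 :+ Q) Q C)
      (binary (unary (unary (con 1 :+ Q) Q A) A A) T A C Q))
  where
  Q = stateSize σ τ L X
  A = sizeBound (list σ) L
  I = sizeBound σ L
  C = sizeBound τ X

valueSize : ∀ {Γ Δ τ} → Tm Γ Δ τ → (P S : Polynomial 2) → Polynomial 2
valueSize {τ = τ} e P S = sizeBound τ (S :+ growth e P)

-- Each clause copies the bound of the corresponding `exec-` lemmas, so that its value is that bound
-- by computation. The safe bound `S` may enter in any polynomial way here, as times never become
-- values.
time : ∀ {Γ Δ τ} → Tm Γ Δ τ → (P S : Polynomial 2) → Polynomial 2
time (nv {τ} x) P S = con 1 :+ sizeBound τ P
time (sv {τ} x) P S = con 1 :+ sizeBound τ S
time (lit k) P S = con (suc (size (nat k)))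
time e@(calc o a b) P S =
  binary (time a P S) (time b P S) (valueSize a P S) (valueSize b P S) (valueSize e P S)
time e@(a *ₜ b) P S =
  binary (time a P (con 0)) (time b P S) (valueSize a P (con 0)) (valueSize b P S) (valueSize e P S)
time e@(pair a b) P S =
  binary (time a P S) (time b P S) (valueSize a P S) (valueSize b P S) (valueSize a P S :+ valueSize b P S :+ con 1)
time e@(fst a) P S = unary (time a P S) (valueSize a P S) (valueSize e P S)
time e@(snd a) P S = unary (time a P S) (valueSize a P S) (valueSize e P S)
time nil P S = con 2
time e@(cons a b) P S =
  binary (time a P S) (time b P S) (valueSize a P S) (valueSize b P S) (valueSize a P S :+ valueSize b P S :+ con 1)
time (cond c a b) P S = seq (time c P S) (time a P S :+ time b P S)
time (caseL {σ} l n c) P S =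
  seq (time l P S)
    (seq (unary (con 1 :+ A) A (con 2))
      (time n P S :+ seq (unary (con 1 :+ A) A I) (seq (unary (con 1 :+ A) A A) (time c P (S :+ growth l P)))))
  where
  A = valueSize l P S
  I = sizeBound σ (S :+ growth l P)
time (letN a b) P S = seq (time a P (con 0)) (time b (P :+ growth a P) S)
time e@(fold {σ} {τ} l z b) P S =
  unary
    (seq (binary (time l P (con 0)) (time z P S) (sizeBound (list σ) L) (sizeBound τ X) Q)
      (L :* (con 1 :+ (testTime σ τ L X :+ bodyTime σ τ L X (time b (P :+ L) X))) :+ (con 1 :+ testTime σ τ L X)))
    Q (sizeBound τ X)
  where
  L = growth l P
  X = S :+ growth e P
  Q = stateSize σ τ L X

opOf-correct : ∀ o a b → apply₂ (opOf o) (nat a) (nat b) ≡ nat (evalArith o a b)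
opOf-correct plus     a b       = refl
opOf-correct minus    a b       = refl
opOf-correct quotient a zero    = refl
opOf-correct quotient a (suc b) = refl
opOf-correct atMost   a b with a ℕ.≤ᵇ b
... | true  = refl
... | false = refl

module FoldTime (A I C T : ℕ) where

  Q test body : ℕ
  Q    = 1 + (A + C)
  test = 1 + (1 + (1 + Q + (Q + A)) + (A + 2))
  body = 1 + (1 + (1 + (1 + Q + (Q + A)) + (A + I)) +
         (1 + (1 + (1 + Q + (Q + C)) +
         (1 + (1 + (1 + (1 + Q + (Q + A)) + (A + A)) + T + (A + C + Q))))))

isPair-size : ∀ v → size (apply₁ isPair v) ≤ 2
isPair-size (nat _)    = s≤s z≤n
isPair-size (pair _ _) = s≤s (s≤s z≤n)

foldTest : ∀ {n} → Exp (suc n)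
foldTest = op₁ isPair (op₁ fst (var zero))

foldBody : ∀ {n} → Exp (3 + n) → Exp (suc n)
foldBody b = bind (op₁ fst (op₁ fst (var zero))) (bind (op₁ snd (var (suc zero)))
               (op₂ cons (op₁ snd (op₁ fst (var (suc (suc zero))))) b))

module _ {σ τ n} (A I C T : ℕ) (ρ : Vec Val n) (f : El τ → El σ → El τ) (b : Exp (3 + n)) where

  open FoldTime A I C T

  private
    state : List (El σ) → El τ → Val
    state l a = pair (enc (list σ) l) (enc τ a)

    exec-fst-state : ∀ {k l a} {ρ′ : Vec Val k} {i} → size (enc (list σ) l) ≤ A → size (enc τ a) ≤ C →
                     lookup ρ′ i ≡ state l a → Exec ρ′ (op₁ fst (var i)) (enc (list σ) l) (1 + (1 + Q + (Q + A)))
    exec-fst-state p q eq = exec-op₁ (exec-var eq (s≤s (+-mono-≤ p q))) (s≤s (+-mono-≤ p q)) p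

  -- The invariant yields size bounds that are the same in all rounds: `A` and `C` for the two
  -- halves of the state, `I` for an element, `T` for the time of the body. Every round thus has the
  -- same price.
  exec-fold-loop : (Inv : List (El σ) → El τ → Set) →
    (∀ {l a} → Inv l a → size (enc (list σ) l) ≤ A × size (enc τ a) ≤ C) →
    (∀ {x l a} → Inv (x ∷ l) a →
       Inv l (f a x) × size (enc σ x) ≤ I × (∀ {v} → Exec (enc τ a ∷ enc σ x ∷ v ∷ ρ) b (enc τ (f a x)) T)) →
    ∀ l a → Inv l a → LoopExec ρ foldTest (foldBody b) (state l a) (state [] (foldl f a l))
                        (length l * (1 + (test + body)) + (1 + test))
  exec-fold-loop Inv sizes next [] a inv =
    exec-stop (exec-op₁ (exec-fst-state {l = []} {a} p q refl) p (isPair-size (nat 0))) refl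
    where
    p = proj₁ (sizes inv)
    q = proj₂ (sizes inv)
  exec-fold-loop Inv sizes next (x ∷ l) a inv =
    exec-≤ˡ (≤-reflexive (cong suc (sym (+-assoc (test + body) (length l * (1 + (test + body))) (1 + test)))))
      (exec-step
        (exec-op₁ (exec-fst-state {l = x ∷ l} {a} p q refl) p (isPair-size (enc (list σ) (x ∷ l)))) refl
        (exec-bind (exec-op₁ (exec-fst-state {l = x ∷ l} {a} p q refl) p px)
          (exec-bind (exec-op₁ (exec-var refl (s≤s (+-mono-≤ p q))) (s≤s (+-mono-≤ p q)) q)
            (exec-op₂ (exec-op₁ (exec-fst-state {l = x ∷ l} {a} p q refl) p p′) run p′ q′
              (s≤s (+-mono-≤ p′ q′)))))
        (exec-fold-loop Inv sizes next l (f a x) inv′))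
    where
    p = proj₁ (sizes inv)
    q = proj₂ (sizes inv)
    inv′ = proj₁ (next inv)
    px = proj₁ (proj₂ (next inv))
    run : ∀ {v} → Exec (enc τ a ∷ enc σ x ∷ v ∷ ρ) b (enc τ (f a x)) T
    run = proj₂ (proj₂ (next inv))
    p′ = proj₁ (sizes inv′)
    q′ = proj₂ (sizes inv′)

pair-size : ∀ {v w A B} → size v ≤ A → size w ≤ B → size (pair v w) ≤ A + B + 1
pair-size {A = A} {B} p q = ≤-trans (s≤s (+-mono-≤ p q)) (≤-reflexive (+-comm 1 (A + B)))

module Running (xs : Vec ℕ 2) where

  open Growth xs

  small-size : ∀ τ X {v} → Small ⟪ X ⟫ τ v → size (enc τ v) ≤ ⟪ sizeBound τ X ⟫
  small-size num X p =
    s≤s (≤-trans (⌈log₂⌉-mono-≤ p) (≤-reflexive (⌈log₂2^n⌉≡n ⟪ X ⟫)))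
  small-size (σ ⊗ τ) X (p , q) = s≤s (+-mono-≤ (small-size σ X p) (small-size τ X q))
  small-size (list τ) X {v} (len , all) =
    ≤-trans (go v all) (s≤s (*-monoˡ-≤ (suc ⟪ sizeBound τ X ⟫) len))
    where
    go : ∀ v → All (Small ⟪ X ⟫ τ) v → size (enc (list τ) v) ≤ suc (length v * suc ⟪ sizeBound τ X ⟫)
    go []      []       = s≤s z≤n
    go (x ∷ v) (p ∷ ps) =
      s≤s (≤-trans (+-mono-≤ (small-size τ X p) (go v ps)) (≤-reflexive (+-suc _ _)))


  compile-correct : ∀ {Γ Δ τ n} (e : Tm Γ Δ τ) P S {γ : All El Γ} {δ : All El Δ} {ρ : Vec Val n}
                    {r : Positions Γ n} {s : Positions Δ n} →
                    SmallEnv ⟪ P ⟫ γ → SmallEnv ⟪ S ⟫ δ → Agree r γ ρ → Agree s δ ρ →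
                    Exec ρ (compile r s e) (enc τ (eval e γ δ)) ⟪ time e P S ⟫
  value-size : ∀ {Γ Δ τ} (e : Tm Γ Δ τ) P S {γ : All El Γ} {δ : All El Δ} →
               SmallEnv ⟪ P ⟫ γ → SmallEnv ⟪ S ⟫ δ → size (enc τ (eval e γ δ)) ≤ ⟪ valueSize e P S ⟫
  value-size {τ = τ} e P S p q = small-size τ (S :+ growth e P) (growth-sound e P ⟪ S ⟫ p q)

  compile-correct (nv {τ} x) P S p q g h = exec-var (Agree.at g x) (small-size τ P (p x))
  compile-correct (sv {τ} x) P S p q g h = exec-var (Agree.at h x) (small-size τ S (q x))
  compile-correct (lit k) P S p q g h = _ , ⇓lit , ≤-refl
  compile-correct (calc o a b) P S {γ} {δ} {ρ} {r} {s} p q g h =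
    subst (λ v → Exec ρ (compile r s (calc o a b)) v ⟪ time (calc o a b) P S ⟫) eq
      (exec-op₂ {o = opOf o} (compile-correct a P S p q g h) (compile-correct b P S p q g h)
        (value-size a P S p q) (value-size b P S p q)
        (≤-trans (≤-reflexive (cong size eq)) (value-size (calc o a b) P S p q)))
    where
    eq = opOf-correct o (eval a γ δ) (eval b γ δ)
  compile-correct (a *ₜ b) P S p q g h =
    exec-op₂ {o = mul} (compile-correct a P (con 0) p []ˢ g agree-none) (compile-correct b P S p q g h)
      (value-size a P (con 0) p []ˢ) (value-size b P S p q) (value-size (a *ₜ b) P S p q)
  compile-correct (pair a b) P S p q g h =
    exec-op₂ {o = cons} (compile-correct a P S p q g h) (compile-correct b P S p q g h)
      (value-size a P S p q) (value-size b P S p q) (pair-size (value-size a P S p q) (value-size b P S p q))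
  compile-correct (fst a) P S p q g h =
    exec-op₁ {o = fst} (compile-correct a P S p q g h) (value-size a P S p q) (value-size (fst a) P S p q)
  compile-correct (snd a) P S p q g h =
    exec-op₁ {o = snd} (compile-correct a P S p q g h) (value-size a P S p q) (value-size (snd a) P S p q)
  compile-correct nil P S p q g h = _ , ⇓lit , ≤-refl
  compile-correct (cons a b) P S p q g h =
    exec-op₂ {o = cons} (compile-correct a P S p q g h) (compile-correct b P S p q g h)
      (value-size a P S p q) (value-size b P S p q) (pair-size (value-size a P S p q) (value-size b P S p q))
  compile-correct (cond {τ} c a b) P S {γ} {δ} {ρ} {r} {s} p q g h =
    exec-cond (compile-correct c P S p q g h)
      (choose (eval c γ δ) (compile-correct a P S p q g h) (compile-correct b P S p q g h))
    where
    choose : ∀ k {e f v w A B} → Exec ρ e (enc τ v) A → Exec ρ f (enc τ w) B →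
             Exec ρ (if isTrue (nat k) then e else f) (enc τ (branch k v w)) (A + B)
    choose zero    {A = A} x y = exec-≤ (m≤n+m _ A) y
    choose (suc k)         x y = exec-≤ (m≤m+n _ _) x
  compile-correct (caseL {σ} {τ} l n c) P S {γ} {δ} {ρ} {r} {s} p q g h =
    exec-bind (compile-correct l P S p q g h)
      (go (eval l γ δ) refl)
    where
    L = S :+ growth l P
    A = ⟪ sizeBound (list σ) L ⟫
    I = ⟪ sizeBound σ L ⟫
    go : ∀ v → eval l γ δ ≡ v →
         Exec (enc (list σ) v ∷ ρ)
           (cond (op₁ isPair (var zero))
             (bind (op₁ fst (var zero)) (bind (op₁ snd (var (suc zero)))
               (compile (shift 3 r) (extend zero (extend (suc zero) (shift 3 s))) c)))
             (compile (shift 1 r) (shift 1 s) n))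
           (enc τ (uncons v (eval n γ δ) λ x xs → eval c γ (xs ∷ x ∷ δ)))
           (1 + (1 + (1 + A + (A + 2)) +
             (⟪ time n P S ⟫ + (1 + (1 + (1 + A + (A + I)) + (1 + (1 + (1 + A + (A + A)) + ⟪ time c P L ⟫)))))))
    go v eq with subst (Small ⟪ L ⟫ (list σ)) eq (growth-sound l P ⟪ S ⟫ p q)
    go [] eq | sm =
      exec-cond (exec-op₁ (exec-var refl (small-size (list σ) L sm)) (small-size (list σ) L sm) (isPair-size (nat 0)))
        (exec-≤ (m≤m+n _ _) (compile-correct n P S p q (agree-shift (_ ∷ []) g) (agree-shift (_ ∷ []) h)))
    go (x ∷ xs) eq | sm@(len , px ∷ pxs) =
      exec-cond (exec-op₁ (exec-var refl A≤) A≤ (isPair-size (enc (list σ) (x ∷ xs))))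
        (exec-≤ (m≤n+m _ ⟪ time n P S ⟫)
          (exec-bind (exec-op₁ (exec-var refl A≤) A≤ (small-size σ L px))
            (exec-bind (exec-op₁ (exec-var refl A≤) A≤ (small-size (list σ) L sm′))
              (compile-correct c P L {γ} {xs ∷ x ∷ δ} p
                (sm′ ∷ˢ px ∷ˢ smallEnv-mono {γ = δ} (m≤m+n ⟪ S ⟫ ⟪ growth l P ⟫) q)
                (agree-shift (_ ∷ _ ∷ _ ∷ []) g)
                (agree-extend refl (agree-extend refl (agree-shift (_ ∷ _ ∷ _ ∷ []) h)))))))
      where
      A≤ = small-size (list σ) L sm
      sm′ : Small ⟪ L ⟫ (list σ) xs
      sm′ = ≤-trans (n≤1+n _) len , pxs
  compile-correct (letN {σ} a b) P S {γ} {r = r} p q g h =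
    exec-bind (compile-correct a P (con 0) p []ˢ g agree-none)
      (compile-correct b (P :+ growth a P) S
        (small-mono σ (m≤n+m _ ⟪ P ⟫) (growth-sound a P 0 p []ˢ) ∷ˢ
         smallEnv-mono {γ = γ} (m≤m+n ⟪ P ⟫ _) p) q
        (agree-extend refl (agree-shift (_ ∷ []) g)) (agree-shift (_ ∷ []) h))
  compile-correct (fold {σ} {τ} l z b) P S {γ} {δ} {ρ} {r} {s} p q g h =
    exec-op₁
      (exec-while
        (exec-op₂ (compile-correct l P (con 0) p []ˢ g agree-none) (compile-correct z P S p q g h)
          l-size z-size (s≤s (+-mono-≤ l-size z-size)))
        (exec-≤ˡ (+-monoˡ-≤ _ (*-monoˡ-≤ _ (proj₁ l-small)))
          (exec-fold-loop A I C T ρ f _ Inv sizes next (eval l γ []) (eval z γ δ)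
            (⟪ S ⟫ + ⟪ growth z P ⟫ , m≤m+n ⟪ S ⟫ _ , z≤X , z-small , l-small))))
      (s≤s (+-mono-≤ (s≤s z≤n) res-size)) res-size
    where
    L = growth l P
    P′ = P :+ L
    X = S :+ growth (fold l z b) P
    A = ⟪ sizeBound (list σ) L ⟫
    I = ⟪ sizeBound σ L ⟫
    C = ⟪ sizeBound τ X ⟫
    T = ⟪ time b P′ X ⟫
    Q = ⟪ growth b P′ ⟫
    f = λ a x → eval b (x ∷ γ) (a ∷ δ)
    l-small : Small ⟪ L ⟫ (list σ) (eval l γ [])
    l-small = growth-sound l P 0 p []ˢ
    z-small = growth-sound z P ⟪ S ⟫ p q
    -- A potential argument: the bound `w` of the accumulator grows by `Q` per round while the list
    -- loses an element, so `w` plus `Q` for each remaining element never exceeds `X`.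
    Inv : List (El σ) → El τ → Set
    Inv l a = ∃ λ w → ⟪ S ⟫ ≤ w × w + length l * Q ≤ ⟪ X ⟫ × Small w τ a × Small ⟪ L ⟫ (list σ) l
    z≤X : ⟪ S ⟫ + ⟪ growth z P ⟫ + length (eval l γ []) * Q ≤ ⟪ X ⟫
    z≤X = ≤-trans (+-monoʳ-≤ (⟪ S ⟫ + ⟪ growth z P ⟫) (*-monoˡ-≤ Q (proj₁ l-small)))
                  (≤-reflexive (+-assoc ⟪ S ⟫ _ _))
    sizes : ∀ {l a} → Inv l a → size (enc (list σ) l) ≤ A × size (enc τ a) ≤ C
    sizes (w , s≤w , w≤X , pa , pl) =
      small-size (list σ) L pl , small-size τ X (small-mono τ (≤-trans (m≤m+n w _) w≤X) pa)
    next : ∀ {x l a} → Inv (x ∷ l) a → Inv l (f a x) × size (enc σ x) ≤ I ×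
           (∀ {v} → Exec (enc τ a ∷ enc σ x ∷ v ∷ ρ) _ (enc τ (f a x)) T)
    next {x} {l} {a} (w , s≤w , w≤X , pa , len , px ∷ pxs) =
      (w + Q , ≤-trans s≤w (m≤m+n w Q) , ≤-trans (≤-reflexive (+-assoc w Q _)) w≤X ,
       growth-sound b P′ w px∷p (pa ∷ˢ smallEnv-mono {γ = δ} s≤w q) , ≤-trans (n≤1+n _) len , pxs) ,
      small-size σ L px ,
      λ {v} → compile-correct b P′ X {x ∷ γ} {a ∷ δ} px∷p
        (small-mono τ (≤-trans (m≤m+n w _) w≤X) pa ∷ˢ smallEnv-mono {γ = δ} (≤-trans s≤w (≤-trans (m≤m+n w _) w≤X)) q)
        (agree-extend refl (agree-shift (_ ∷ _ ∷ _ ∷ []) g)) (agree-extend refl (agree-shift (_ ∷ _ ∷ _ ∷ []) h))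
      where
      px∷p : SmallEnv ⟪ P′ ⟫ (x ∷ γ)
      px∷p = small-mono σ (m≤n+m ⟪ L ⟫ ⟪ P ⟫) px ∷ˢ smallEnv-mono {γ = γ} (m≤m+n ⟪ P ⟫ ⟪ L ⟫) p
    l-size : size (enc (list σ) (eval l γ [])) ≤ A
    l-size = small-size (list σ) L l-small
    z-size : size (enc τ (eval z γ δ)) ≤ C
    z-size = small-size τ X (small-mono τ (≤-trans (m≤m+n _ _) z≤X) z-small)
    res-size : size (enc τ (eval (fold l z b) γ δ)) ≤ C
    res-size = value-size (fold l z b) P S p q

pattern #0 = here refl
pattern #1 = there #0
pattern #2 = there #1
pattern #3 = there #2
pattern #4 = there #3
pattern #5 = there #4
pattern #6 = there #5

-- A facility consists of opening cost, sign and absolute value of the capacity; a row pairs demands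
-- with cost codes; a fraction has sign, numerator and denominator. An entry holds its key (a
-- budget), its position (units served) and the output so far. `PreTy` lists the largest guess, the
-- number of keys, `R`, the total demand and the sites.
FacTy RowTy FracTy OutTy EntryTy InTy PreTy : Ty
FacTy   = num ⊗ (num ⊗ num)
RowTy   = list (num ⊗ num)
FracTy  = (num ⊗ num) ⊗ num
OutTy   = list num ⊗ list (list FracTy)
EntryTy = num ⊗ (num ⊗ OutTy)
InTy    = (list FacTy ⊗ (list num ⊗ list (list num))) ⊗ FracTy
PreTy   = num ⊗ (num ⊗ (num ⊗ (num ⊗ list (FacTy ⊗ RowTy))))

Entry : Set
Entry = El EntryTy

Site : Set
Site = El (FacTy ⊗ RowTy)

key position : Entry → ℕ
key      e = proj₁ e
position e = proj₁ (proj₂ e)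

-- The algorithm

-- A fold runs over one list only, so the other one waits in the accumulator and is taken apart by
-- `caseL`. The result comes out reversed, as the left folds over it need it.
zipWithDemands : ∀ {Γ Δ} → Tm Γ [] (list num) → Tm Γ Δ (list num) → Tm Γ Δ RowTy
zipWithDemands row ds =
  snd (fold row (pair ds nil)
    (caseL (fst (sv #0)) (sv #0) (pair (sv #0) (cons (pair (sv #1) (nv #0)) (snd (sv #2))))))

prepare : Tm (InTy ∷ []) [] PreTy
prepare =
  letN (fold (fst (snd (fst (nv #0)))) (lit 0) (nv #0 +ₜ sv #0))
  (letN (lit 1 +ₜ snd (snd (nv #1)) /ₜ snd (fst (snd (nv #1))))
  -- Counting starts at 1 and gives m + 1, the number of roundings to allow for.
  (letN (fold (snd (snd (fst (nv #2)))) (lit 1) (lit 1 +ₜ sv #0))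
  (letN ((lit 2 *ₜ nv #0) *ₜ nv #1)
    -- The largest guess: a crude upper bound on the cost of a plan, plus 1 so that there is a guess
    -- at all.
    (pair (lit 1 +ₜ (fold (fst (fst (nv #4))) (lit 0) (fst (nv #0) +ₜ sv #0) +ₜ
                     nv #3 *ₜ fold (snd (snd (fst (nv #4)))) (lit 0) (fold (nv #0) (sv #0) (nv #0 +ₜ sv #0))))
    (pair (nv #0 +ₜ nv #1)
    (pair (nv #0)
    (pair (nv #3)
      (snd (fold (snd (snd (fst (nv #4)))) (pair (fst (fst (nv #4))) nil)
        (caseL (fst (sv #0)) (sv #0)
          (pair (sv #0) (cons (pair (sv #1) (zipWithDemands (nv #0) (fst (snd (fst (nv #5)))))) (snd (sv #2))))))))))))))

-- The minimum, by truncated subtraction.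
least : ∀ {Γ Δ} → Tm Γ Δ num → Tm Γ Δ num → Tm Γ Δ num
least a b = a ∸ₜ (a ∸ₜ b)

-- The state of the greedy run through the clients: units to skip because they are already served,
-- capacity left, money left, position reached, fractions.
ServeTy : Ty
ServeTy = num ⊗ (num ⊗ (num ⊗ (num ⊗ list FracTy)))

serveTm : ∀ {Γ Δ} → Tm ((num ⊗ num) ∷ Γ) (ServeTy ∷ Δ) ServeTy
serveTm {Γ} {Δ} =
  pair (τ ∸ₜ d)
  -- A client that is not served to its end stops the run: without capacity no later unit is served,
  -- which keeps the block consecutive.
  (pair (cond (avail ∸ₜ x) (lit 0) (U ∸ₜ x))
  (pair (M ∸ₜ (snd (nv #0) ∸ₜ lit 1) *ₜ x)
  (pair (t +ₜ x)
        (cons (pair (pair (lit 0) x) d) (snd (snd (snd (snd (sv #0)))))))))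
  where
  d τ U M t avail x : Tm ((num ⊗ num) ∷ Γ) (ServeTy ∷ Δ) num
  d     = fst (nv #0)
  τ     = fst (sv #0)
  U     = fst (snd (sv #0))
  M     = fst (snd (snd (sv #0)))
  t     = fst (snd (snd (snd (sv #0))))
  avail = d ∸ₜ τ
  -- Cost codes are 0 for infinite and c + 1 for finite cost c. Infinite cost affords nothing, cost
  -- 0 everything, any other cost c the quotient of the money by c.
  x     = least avail (least U (cond (snd (nv #0))
            (cond (snd (nv #0) ∸ₜ lit 1) (M /ₜ (snd (nv #0) ∸ₜ lit 1)) avail) (lit 0)))

preR preD : ∀ {Γ Δ} → PreTy ∈ Γ → Tm Γ Δ num
preR i = fst (snd (snd (nv i)))
preD i = fst (snd (snd (snd (nv i))))

extendTm : ∀ {Γ Δ} → num ∈ Γ → PreTy ∈ Γ → (FacTy ⊗ RowTy) ∈ Γ → (k b : Tm Γ Δ num) →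
           Tm Γ Δ EntryTy → Tm Γ Δ EntryTy
extendTm {Γ} {Δ} V pre site k b e =
  pair k (pair (fst (snd (snd (snd served))))
    (pair (cons flag (fst (snd (snd e)))) (cons (snd (snd (snd (snd served)))) (snd (snd (snd e))))))
  where
  fac : Tm Γ Δ FacTy
  fac = fst (nv site)
  money flag : Tm Γ Δ num
  money = (nv V *ₜ b) /ₜ preR pre
  -- Sign 1 means negative capacity; such a facility is open in no feasible solution.
  flag  = cond (fst (snd fac)) (lit 0) (fst fac ≤ₜ money)
  served : Tm Γ Δ ServeTy
  served = fold (snd (nv site))
    (pair (fst (snd e)) (pair (cond flag (snd (snd fac)) (lit 0))
      (pair (money ∸ₜ fst fac) (pair (fst (snd e)) nil)))) serveTm

CoreCtx : Ctx
CoreCtx = list num ∷ list num ∷ PreTy ∷ []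

-- The table is an accumulator and cannot be folded over. Both passes through it are folds over the
-- keys, a normal list at least as long, which take the table apart by `caseL`.
tableTm : ∀ {Δ} → Tm ((FacTy ⊗ RowTy) ∷ num ∷ CoreCtx) (list EntryTy ∷ Δ) (list EntryTy)
tableTm {Δ₀} =
  snd (fold (nv #3) (pair (sv #0) nil)
    (caseL (fst (sv #0)) (sv #0)
      (pair (sv #0)
        (cons (snd (fold (nv #4)
                 (pair (sv #3) (extendTm #2 #5 #1 (fst (sv #1)) (lit 0) (sv #1)))
                 (caseL (fst (sv #0)) (sv #0)
                   (pair (sv #0)
                     (cond (fst (sv #1) ≤ₜ fst (sv #4))
                       (cond (lit 1 +ₜ fst (snd (snd (sv #2))) ≤ₜ fst (snd candidate)) candidate (snd (sv #2)))
                       (snd (sv #2)))))))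
              (snd (sv #2))))))
  where
  candidate : ∀ {τ τ′ Δ} → Tm (num ∷ num ∷ (FacTy ⊗ RowTy) ∷ num ∷ CoreCtx)
                        (τ ∷ EntryTy ∷ (list EntryTy ⊗ EntryTy) ∷ τ′ ∷ EntryTy ∷ Δ) EntryTy
  candidate = extendTm #3 #6 #2 (fst (sv #4)) (fst (sv #4) ∸ₜ fst (sv #1)) (sv #1)

chooseTm : ∀ {Δ} → Tm (num ∷ CoreCtx) Δ (list EntryTy) → Tm (num ∷ CoreCtx) Δ (list EntryTy)
chooseTm table =
  snd (fold (nv #2) (pair table nil)
    (caseL (fst (sv #0)) (sv #0)
      (pair (sv #0)
        (cond (preD #4 ≤ₜ fst (snd (sv #1)))
          (caseL (snd (sv #2)) (cons (sv #1) nil)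
            (cond (lit 1 +ₜ fst (sv #3) ≤ₜ fst (sv #1)) (cons (sv #3) nil) (snd (sv #4))))
          (snd (sv #2))))))

core : Tm CoreCtx [] OutTy
core =
  caseL (fold (nv #0) nil
          (caseL (sv #0)
            (chooseTm (fold (snd (snd (snd (snd (nv #3)))))
              (fold (nv #2) nil (cons (pair (nv #0) (pair (lit 0) (pair nil nil))) (sv #0)))
              tableTm))
            (sv #2)))
    (pair nil nil) (snd (snd (sv #1)))

-- The functions computed by the terms

bit : Bool → ℕ
bit b = if b then 1 else 0

zipRow : List ℕ → List ℕ → List (ℕ × ℕ)
zipRow ds row = proj₂ (foldl (λ s c → uncons (proj₁ s) s λ d ds → ds , (d , c) ∷ proj₂ s) (ds , []) row)

zipSites : List (El FacTy) → List ℕ → List (List ℕ) → List Site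
zipSites facs ds rows =
  proj₂ (foldl (λ s row → uncons (proj₁ s) s λ f fs → fs , (f , zipRow ds row) ∷ proj₂ s) (facs , []) rows)

Parameters : Set
Parameters = El PreTy

-- Equal to the value of `prepare` by computation, just as `result` of `guesses` is to that of
-- `core`; terms and functions therefore need no further comparison.
parameters : El InTy → Parameters
parameters ((facs , (ds , rows)) , ((_ , p) , q)) =
  1 + (foldl (λ s f → proj₁ f + s) 0 facs + D * foldl (λ s row → foldl (λ s c → c + s) s row) 0 rows) ,
  R + m , R , D , zipSites facs ds rows
  where
  D = foldl (λ s d → d + s) 0 ds
  m = foldl (λ s _ → 1 + s) 1 rows
  R = 2 * m * (1 + quot q p)

ServeState : Set
ServeState = El ServeTy

amount : ℕ → ℕ → ℕ → ℕ → ℕ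
amount avail c U M = avail ∸ (avail ∸ (U ∸ (U ∸ branch c (branch (c ∸ 1) (quot M (c ∸ 1)) avail) 0)))

serve : ServeState → ℕ × ℕ → ServeState
serve (τ , U , M , t , xs) (d , c) =
  τ ∸ d , branch (d ∸ τ ∸ x) 0 (U ∸ x) , M ∸ (c ∸ 1) * x , t + x , ((0 , x) , d) ∷ xs
  where x = amount (d ∸ τ) c U M

serveRow : (t U M : ℕ) → List (ℕ × ℕ) → ServeState
serveRow t U M = foldl serve (t , U , M , t , [])

-- The list ks only bounds the number of steps.
walk : ∀ {A B : Set} → List ℕ → List A → B → (B → A → B) → B
walk ks xs z f = proj₂ (foldl (λ s _ → uncons (proj₁ s) s λ x xs → xs , f (proj₂ s) x) (xs , z) ks)

module Search (V : ℕ) (ks : List ℕ) (pre : Parameters) where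

  R D : ℕ
  R = proj₁ (proj₂ (proj₂ pre))
  D = proj₁ (proj₂ (proj₂ (proj₂ pre)))

  sites : List Site
  sites = proj₂ (proj₂ (proj₂ (proj₂ pre)))

  money : ℕ → ℕ
  money b = quot (V * b) R

  flag : El FacTy → ℕ → ℕ
  flag (f , sign , cap) b = branch sign 0 (bit (f ℕ.≤ᵇ money b))

  served : Site → ℕ → ℕ → ServeState
  served ((f , sign , cap) , row) b t =
    serveRow t (branch (flag (f , sign , cap) b) cap 0) (money b ∸ f) row

  extendBy : Site → ℕ → ℕ → Entry → Entry
  extendBy site k b (_ , t , flags , rows) =
    k , proj₁ (proj₂ (proj₂ (proj₂ (served site b t)))) ,
    flag (proj₁ site) b ∷ flags , proj₂ (proj₂ (proj₂ (proj₂ (served site b t)))) ∷ rows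

  improve : Site → Entry → Entry → Entry → Entry
  improve site e best e′ =
    branch (bit (key e′ ℕ.≤ᵇ key e))
      (branch (bit (1 + position best ℕ.≤ᵇ position candidate)) candidate best) best
    where candidate = extendBy site (key e) (key e ∸ key e′) e′

  nextTable : List Entry → Site → List Entry
  nextTable T site =
    walk ks T [] λ new e → walk ks T (extendBy site (key e) 0 e) (improve site e) ∷ new

  table₀ : List Entry
  table₀ = foldl (λ T k → (k , 0 , [] , []) ∷ T) [] ks

  chooseBetter : List Entry → Entry → List Entry
  chooseBetter best e =
    branch (bit (D ℕ.≤ᵇ position e))
      (uncons best (e ∷ []) λ e′ _ → branch (bit (1 + key e ℕ.≤ᵇ key e′)) (e ∷ []) best) best

  search : List Entry
  search = walk ks (foldl nextTable table₀ sites) [] chooseBetter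

guesses : List ℕ → List ℕ → Parameters → List Entry
guesses Vs ks pre = foldl (λ found V → uncons found (Search.search V ks pre) λ _ _ → found) [] Vs

result : List Entry → El OutTy
result found = uncons found ([] , []) λ e _ → proj₂ (proj₂ e)

-- The positive numbers among k, f k, f (f k), …, the last one first; N only bounds
-- the number of steps.
iterates : (ℕ → ℕ) → ℕ → ℕ → List ℕ → List ℕ
iterates f zero    k       acc = acc
iterates f (suc N) zero    acc = acc
iterates f (suc N) (suc k) acc = iterates f N (f (suc k)) (suc k ∷ acc)

-- The compiled loop knows no step count and stops only at 0. This condition makes it agree with
-- `iterates`, whose recursion is on the step count.
ReachesZero : (ℕ → ℕ) → ℕ → ℕ → Set
ReachesZero f zero    k = k ≡ 0
ReachesZero f (suc N) k = ReachesZero f N (f k)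

iteratesTest : ∀ {n} → Exp (suc n)
iteratesTest = op₁ fst (var zero)

iteratesBody : ∀ {n} → Op₂ → ℕ → Exp (suc n)
iteratesBody o c = op₂ cons (op₂ o (op₁ fst (var zero)) (lit c))
                            (op₂ cons (op₁ fst (var zero)) (op₁ snd (var zero)))

-- Written directly for the machine: a typed term can only bound the bit length of a number, which
-- says too little about a list with as many elements as its value.
iteratesExp : ∀ {n} → Op₂ → ℕ → Exp n → Exp n
iteratesExp o c e = op₁ snd (while (op₂ cons e (lit 0)) iteratesTest (iteratesBody o c))

size-nat-mono : ∀ {j k} → j ≤ k → size (nat j) ≤ size (nat k)
size-nat-mono j≤k = s≤s (⌈log₂⌉-mono-≤ (s≤s j≤k))

module IteratesTime (A S W : ℕ) where
  Q test body : ℕ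
  Q    = 1 + (A + S)
  test = 1 + (1 + Q + (Q + A))
  body = 1 + ((1 + (test + (1 + W) + (A + W + A))) + (1 + (test + (1 + (1 + Q + (Q + S))) + (A + S + S))) +
              (A + S + Q))

module _ {n} (ρ : Vec Val n) (o : Op₂) (c : ℕ) (f : ℕ → ℕ) (A S : ℕ)
         (o-f : ∀ k → apply₂ o (nat k) (nat c) ≡ nat (f k)) (f≤ : ∀ k → f k ≤ k) where

  open IteratesTime A S (size (nat c))

  exec-iterates-loop : ∀ N k acc → ReachesZero f N k → size (nat k) ≤ A →
    size (enc (list num) acc) + N * (1 + A) ≤ S →
    LoopExec ρ iteratesTest (iteratesBody o c) (pair (nat k) (enc (list num) acc))
      (pair (nat 0) (enc (list num) (iterates f N k acc))) (N * (1 + (test + body)) + (1 + test))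
  exec-iterates-loop N zero acc r p q =
    subst (λ l → LoopExec ρ iteratesTest (iteratesBody o c) (pair (nat 0) (enc (list num) acc))
                   (pair (nat 0) (enc (list num) l)) (N * (1 + (test + body)) + (1 + test))) (eq N)
      (exec-≤ˡ (m≤n+m _ (N * (1 + (test + body)))) (exec-stop (exec-op₁ (exec-var refl Q≤) Q≤ p) refl))
    where
    Q≤ : size (pair (nat 0) (enc (list num) acc)) ≤ Q
    Q≤ = s≤s (+-mono-≤ p (≤-trans (m≤m+n _ _) q))
    eq : ∀ N → acc ≡ iterates f N zero acc
    eq zero    = refl
    eq (suc N) = refl
  exec-iterates-loop (suc N) (suc k) acc r p q =
    exec-≤ˡ (≤-reflexive (cong suc (sym (+-assoc (test + body) (N * (1 + (test + body))) (1 + test)))))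
      (exec-step (exec-op₁ (exec-var refl Q≤) Q≤ p) refl
        (exec-op₂
          (subst (λ v → Exec (pair (nat (suc k)) (enc (list num) acc) ∷ ρ) (op₂ o (op₁ fst (var zero)) (lit c)) v (1 + (test + (1 + size (nat c)) + (A + size (nat c) + A))))
            (o-f (suc k))
            (exec-op₂ {o = o} (exec-op₁ (exec-var refl Q≤) Q≤ p) (_ , ⇓lit , ≤-refl) p ≤-refl
              (≤-trans (≤-reflexive (cong size (o-f (suc k)))) p′)))
          (exec-op₂ (exec-op₁ (exec-var refl Q≤) Q≤ p) (exec-op₁ (exec-var refl Q≤) Q≤ q₀) p q₀ q₁)
          p′ q₁ (s≤s (+-mono-≤ p′ q₁)))
        (exec-iterates-loop N (f (suc k)) (suc k ∷ acc) r p′ q′))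
    where
    p′ : size (nat (f (suc k))) ≤ A
    p′ = ≤-trans (size-nat-mono (f≤ (suc k))) p
    q′ : size (enc (list num) (suc k ∷ acc)) + N * (1 + A) ≤ S
    q′ = ≤-trans (≤-trans (+-monoˡ-≤ (N * (1 + A)) (≤-trans (s≤s (+-monoˡ-≤ _ p)) (≤-reflexive (+-comm (1 + A) _))))
                          (≤-reflexive (+-assoc _ (1 + A) (N * (1 + A))))) q
    q₀ : size (enc (list num) acc) ≤ S
    q₀ = ≤-trans (m≤m+n _ _) q
    q₁ : size (enc (list num) (suc k ∷ acc)) ≤ S
    q₁ = ≤-trans (m≤m+n _ _) q′
    Q≤ : size (pair (nat (suc k)) (enc (list num) acc)) ≤ Q
    Q≤ = s≤s (+-mono-≤ p q₀)

  exec-iterates : ∀ {e T} N k → Exec ρ e (nat k) T → ReachesZero f N k → size (nat k) ≤ A → 1 + N * (1 + A) ≤ S →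
    Exec ρ (iteratesExp o c e) (enc (list num) (iterates f N k []))
      (1 + (1 + (1 + (T + 2 + (A + 1 + Q)) + (N * (1 + (test + body)) + (1 + test))) + (Q + S)))
  exec-iterates N k ex r p q =
    exec-op₁
      (exec-while (exec-op₂ ex (_ , ⇓lit , ≤-refl) p ≤-refl (s≤s (+-mono-≤ p (≤-trans (s≤s z≤n) q))))
        (exec-iterates-loop N k [] r p q))
      (s≤s (+-mono-≤ (≤-trans (s≤s z≤n) p) res)) res
    where
    list-size : ∀ N k acc → size (nat k) ≤ A → size (enc (list num) (iterates f N k acc)) ≤ size (enc (list num) acc) + N * (1 + A)
    list-size zero    k       acc p = m≤m+n _ _
    list-size (suc N) zero    acc p = m≤m+n _ _
    list-size (suc N) (suc k) acc p =
      ≤-trans (list-size N (f (suc k)) (suc k ∷ acc) (≤-trans (size-nat-mono (f≤ (suc k))) p))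
        (≤-trans (+-monoˡ-≤ (N * (1 + A)) (≤-trans (s≤s (+-monoˡ-≤ _ p)) (≤-reflexive (+-comm (1 + A) _))))
                 (≤-reflexive (+-assoc _ (1 + A) (N * (1 + A)))))
    res : size (enc (list num) (iterates f N k [])) ≤ S
    res = ≤-trans (list-size N k [] p) q

iterates-length : ∀ f N k acc → length (iterates f N k acc) ≤ N + length acc
iterates-length f zero    k       acc = ≤-refl
iterates-length f (suc N) zero    acc = m≤n+m _ (suc N)
iterates-length f (suc N) (suc k) acc =
  ≤-trans (iterates-length f N (f (suc k)) (suc k ∷ acc)) (≤-reflexive (+-suc N _))

iterates-bounded : ∀ {f} → (∀ k → f k ≤ k) → ∀ b N k acc → k ≤ b → All (_≤ b) acc → All (_≤ b) (iterates f N k acc)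
iterates-bounded f≤ b zero    k       acc k≤b p = p
iterates-bounded f≤ b (suc N) zero    acc k≤b p = p
iterates-bounded f≤ b (suc N) (suc k) acc k≤b p =
  iterates-bounded f≤ b N _ _ (≤-trans (f≤ (suc k)) k≤b) (k≤b ∷ p)

pred-reaches : ∀ N k → k ≤ N → ReachesZero (_∸ 1) N k
pred-reaches zero    zero    z≤n = refl
pred-reaches (suc N) k k≤N = pred-reaches N (k ∸ 1) (∸-monoˡ-≤ 1 k≤N)

half-reaches : ∀ N k → k < 2 ^ N → ReachesZero (ℕ._/ 2) N k
half-reaches zero    zero    _   = refl
half-reaches zero    (suc k) (s≤s ())
half-reaches (suc N) k       k<  =
  half-reaches N (k ℕ./ 2) (m<n*o⇒m/o<n (<-≤-trans k< (≤-reflexive (*-comm 2 (2 ^ N)))))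

-- The program and its time bound

inputPosition : Positions (InTy ∷ []) 1
inputPosition _ = zero

corePosition : Positions CoreCtx 4
corePosition = extend zero (extend (suc zero) (extend (suc (suc zero)) none))

program : Program
program =
  bind (compile inputPosition none prepare)
    (bind (iteratesExp sub 1 (op₁ fst (op₁ snd (var zero))))
      (bind (iteratesExp div 2 (op₁ fst (var (suc zero))))
        (compile corePosition none core)))

opaque

  -- `var zero` stands for the input size and `var (suc zero)` for `⌈1/ ε ⌉`. `valueBound` controls
  -- bit lengths; `keyBound` bounds the value of `B = 2 (m + 1) E + m + 1`, with m at most the input
  -- size and `E ≤ ⌈1/ ε ⌉ + 1`.
  valueBound keyBound : Polynomial 2
  valueBound = growth prepare (var zero)
  keyBound   = con 2 :* (var zero :+ con 1) :* (var (suc zero) :+ con 1) :+ (var zero :+ con 1)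

  keyBound-eval : ∀ a b → ⟦ keyBound ⟧ (a ∷ b ∷ []) ≡ 2 * (a + 1) * (b + 1) + (a + 1)
  keyBound-eval a b = refl

coreBound : Polynomial 2
coreBound = valueBound :+ keyBound

opaque

  prepareTime coreTime : Polynomial 2
  prepareTime = time prepare (var zero) (con 0)
  coreTime    = time core coreBound (con 0)

iteratesTime : (N A T : Polynomial 2) → ℕ → Polynomial 2
iteratesTime N A T W =
  con 1 :+ ((con 1 :+ ((con 1 :+ ((T :+ con 2) :+ ((A :+ con 1) :+ Q))) :+
    (N :* (con 1 :+ (test :+ body)) :+ (con 1 :+ test)))) :+ (Q :+ S))
  where
  S Q test body : Polynomial 2
  S    = con 1 :+ N :* (con 1 :+ A)
  Q    = con 1 :+ (A :+ S)
  test = con 1 :+ ((con 1 :+ Q) :+ (Q :+ A))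
  body = con 1 :+ (((con 1 :+ ((test :+ (con 1 :+ con W)) :+ ((A :+ con W) :+ A))) :+
                    (con 1 :+ ((test :+ (con 1 :+ ((con 1 :+ Q) :+ (Q :+ S)))) :+ ((A :+ S) :+ S)))) :+
                   ((A :+ S) :+ Q))

opaque

  programTime : Polynomial 2
  programTime =
    con 1 :+ (prepareTime :+
    (con 1 :+ (iteratesTime keyBound A (con 1 :+ ((con 1 :+ ((con 1 :+ Q) :+ (Q :+ Q))) :+ (Q :+ A))) (size (nat 1)) :+
    (con 1 :+ (iteratesTime valueBound A (con 1 :+ ((con 1 :+ Q) :+ (Q :+ A))) (size (nat 2)) :+
      coreTime)))))
    where
    Q A : Polynomial 2
    Q = sizeBound PreTy valueBound
    A = con 1 :+ valueBound

module _ (xs : Vec ℕ 2) where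

  open Growth xs
  open Running xs

  keys scales : Parameters → List ℕ
  keys pre   = iterates (_∸ 1) ⟪ keyBound ⟫ (proj₁ (proj₂ pre)) []
  scales pre = iterates (ℕ._/ 2) ⟪ valueBound ⟫ (proj₁ pre) []

  opaque
    unfolding valueBound prepareTime

    parameters-small : ∀ x → Small (lookup xs zero) InTy x → Small ⟪ valueBound ⟫ PreTy (parameters x)
    parameters-small x p = growth-sound prepare (var zero) 0 {γ = x ∷ []} {δ = []} (p ∷ˢ λ ()) []ˢ

    prepare-runs : ∀ x → Small (lookup xs zero) InTy x →
      Exec (enc InTy x ∷ []) (compile inputPosition none prepare) (enc PreTy (parameters x)) ⟪ prepareTime ⟫
    prepare-runs x p =
      compile-correct prepare (var zero) (con 0) {x ∷ []} {r = inputPosition} (p ∷ˢ λ ()) []ˢ (agree λ { #0 → refl }) agree-none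

    core-runs : ∀ Vs ks pre {v} → Small ⟪ coreBound ⟫ (list num) Vs → Small ⟪ coreBound ⟫ (list num) ks →
      Small ⟪ coreBound ⟫ PreTy pre →
      Exec (enc (list num) Vs ∷ enc (list num) ks ∷ enc PreTy pre ∷ v ∷ []) (compile corePosition none core)
        (enc OutTy (result (guesses Vs ks pre))) ⟪ coreTime ⟫
    core-runs Vs ks pre p q r =
      compile-correct core coreBound (con 0) {Vs ∷ ks ∷ pre ∷ []} (p ∷ˢ q ∷ˢ r ∷ˢ []ˢ) []ˢ
        (agree-extend refl (agree-extend refl (agree-extend refl agree-none))) agree-none

  opaque
    unfolding programTime

    program-correct : ∀ x → Small (lookup xs zero) InTy x → proj₁ (proj₂ (parameters x)) ≤ ⟪ keyBound ⟫ →
      Exec (enc InTy x ∷ []) program (enc OutTy (result (guesses (scales (parameters x)) (keys (parameters x)) (parameters x))))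
        ⟪ programTime ⟫
    program-correct x p B≤ =
      exec-bind (prepare-runs x p)
        (exec-bind
          (exec-iterates _ sub 1 (_∸ 1) ⟪ A ⟫ (1 + ⟪ keyBound ⟫ * (1 + ⟪ A ⟫)) (λ _ → refl) (λ k → m∸n≤m k 1) ⟪ keyBound ⟫ B
            (exec-op₁ (exec-op₁ (exec-var refl Q≤) Q≤ Q′≤) Q′≤ (small-size num valueBound (proj₁ (proj₂ small))))
            (pred-reaches ⟪ keyBound ⟫ B B≤) (small-size num valueBound (proj₁ (proj₂ small))) ≤-refl)
          (exec-bind
            (exec-iterates _ div 2 (ℕ._/ 2) ⟪ A ⟫ (1 + ⟪ valueBound ⟫ * (1 + ⟪ A ⟫)) (λ _ → refl) (λ k → m/n≤m k 2) ⟪ valueBound ⟫ U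
              (exec-op₁ (exec-var refl Q≤) Q≤ (small-size num valueBound (proj₁ small)))
              (half-reaches ⟪ valueBound ⟫ U (proj₁ small)) (small-size num valueBound (proj₁ small)) ≤-refl)
            (core-runs Vs Ks pre
              (small-mono (list num) (m≤m+n _ ⟪ keyBound ⟫) Vs-small)
              (small-mono (list num) (m≤n+m _ ⟪ valueBound ⟫) Ks-small)
              (small-mono PreTy (m≤m+n _ ⟪ keyBound ⟫) small))))
      where
      pre : Parameters
      pre = parameters x
      U B : ℕ
      U = proj₁ pre
      B = proj₁ (proj₂ pre)
      Q A : Polynomial 2
      Q = sizeBound PreTy valueBound
      A = con 1 :+ valueBound
      Vs Ks : List ℕ
      Vs = scales pre
      Ks = keys pre
      small : Small ⟪ valueBound ⟫ PreTy pre
      small = parameters-small x p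
      Q≤ : size (enc PreTy pre) ≤ ⟪ Q ⟫
      Q≤ = small-size PreTy valueBound small
      Q′≤ : size (enc (num ⊗ (num ⊗ (num ⊗ list (FacTy ⊗ RowTy)))) (proj₂ pre)) ≤ ⟪ Q ⟫
      Q′≤ = ≤-trans (m≤n+m _ (suc (size (nat U)))) Q≤
      Vs-small : Small ⟪ valueBound ⟫ (list num) Vs
      Vs-small =
        ≤-trans (iterates-length (ℕ._/ 2) ⟪ valueBound ⟫ U []) (≤-reflexive (+-identityʳ _)) ,
        All.map (λ k≤U → ≤-<-trans k≤U (proj₁ small)) (iterates-bounded (λ k → m/n≤m k 2) U ⟪ valueBound ⟫ U [] ≤-refl [])
      Ks-small : Small ⟪ keyBound ⟫ (list num) Ks
      Ks-small =
        ≤-trans (iterates-length (_∸ 1) ⟪ keyBound ⟫ B []) (≤-reflexive (+-identityʳ _)) ,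
        All.map (λ k≤B → ≤-<-trans (≤-trans k≤B B≤) (n<2^n _)) (iterates-bounded (λ k → m∸n≤m k 1) B ⟪ keyBound ⟫ B [] ≤-refl [])

-- Unit costs and the greedy run of one facility

[]-injective : ∀ {a b} → _≡_ {A = ℕ∞} [ a ] [ b ] → a ≡ b
[]-injective refl = refl

+∞-assoc : ∀ a b c → (a +∞ b) +∞ c ≡ a +∞ (b +∞ c)
+∞-assoc [ a ] [ b ] [ c ] = cong [_] (+-assoc a b c)
+∞-assoc [ a ] [ b ] ⊤⁺    = refl
+∞-assoc [ a ] ⊤⁺    c     = refl
+∞-assoc ⊤⁺    b     c     = refl

+∞-comm : ∀ a b → a +∞ b ≡ b +∞ a
+∞-comm [ a ] [ b ] = cong [_] (+-comm a b)
+∞-comm [ a ] ⊤⁺    = refl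
+∞-comm ⊤⁺    [ b ] = refl
+∞-comm ⊤⁺    ⊤⁺    = refl

+∞-identityʳ : ∀ a → a +∞ [ 0 ] ≡ a
+∞-identityʳ [ a ] = cong [_] (+-identityʳ a)
+∞-identityʳ ⊤⁺    = refl

+∞-finite : ∀ a b {g} → a +∞ b ≡ [ g ] → ∃ λ k → ∃ λ l → a ≡ [ k ] × b ≡ [ l ] × k + l ≡ g
+∞-finite [ a ] [ b ] refl = a , b , refl , refl , refl

value code : ℕ∞ → ℕ
value [ c ] = c
value ⊤⁺    = 0
code [ c ] = suc c
code ⊤⁺    = 0

-- ψ d c u is the unit cost of the u-th unit of demand, counted from the last
-- client; units that do not exist get ∞.
ψ : ∀ {n} → (Fin n → ℕ) → (Fin n → ℕ∞) → ℕ → ℕ∞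
ψ {zero}  d c u = ⊤⁺
ψ {suc n} d c u =
  if does (u <? ∑ (d ∘ suc)) then ψ (d ∘ suc) (c ∘ suc) u else
  if does (u <? ∑ d) then c zero else ⊤⁺

module _ {n} (d : Fin (suc n) → ℕ) (c : Fin (suc n) → ℕ∞) {u : ℕ} where

  ψ-tail : u < ∑ (d ∘ suc) → ψ d c u ≡ ψ (d ∘ suc) (c ∘ suc) u
  ψ-tail p rewrite dec-true (u <? ∑ (d ∘ suc)) p = refl

  ψ-head : ∑ (d ∘ suc) ≤ u → u < ∑ d → ψ d c u ≡ c zero
  ψ-head p q rewrite dec-false (u <? ∑ (d ∘ suc)) (≤⇒≯ p) | dec-true (u <? ∑ d) q = refl

ψ-out : ∀ {n} (d : Fin n → ℕ) c {u} → ∑ d ≤ u → ψ d c u ≡ ⊤⁺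
ψ-out {zero}  d c p = refl
ψ-out {suc n} d c {u} p
  rewrite dec-false (u <? ∑ (d ∘ suc)) (≤⇒≯ (≤-trans (m≤n+m _ (d zero)) p)) | dec-false (u <? ∑ d) (≤⇒≯ p) = refl

ψ-finite⇒in : ∀ {n} (d : Fin n → ℕ) c {u g} → ψ d c u ≡ [ g ] → u < ∑ d
ψ-finite⇒in d c {u} eq with u <? ∑ d
... | yes p = p
... | no ¬p with trans (sym eq) (ψ-out d c (≮⇒≥ ¬p))
... | ()

seg : (ℕ → ℕ∞) → ℕ → ℕ → ℕ∞
seg φ s zero    = [ 0 ]
seg φ s (suc k) = seg φ s k +∞ φ (s + k)

seg-cong : ∀ {φ χ} s k → (∀ u → s ≤ u → u < s + k → φ u ≡ χ u) → seg φ s k ≡ seg χ s k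
seg-cong s zero    h = refl
seg-cong s (suc k) h =
  cong₂ _+∞_ (seg-cong s k λ u p q → h u p (<-≤-trans q (+-monoʳ-≤ s (n≤1+n k))))
    (h (s + k) (m≤m+n s k) (≤-reflexive (sym (+-suc s k))))

seg-+ : ∀ φ s j k → seg φ s (j + k) ≡ seg φ s j +∞ seg φ (s + j) k
seg-+ φ s j zero    = trans (cong (seg φ s) (+-identityʳ j)) (sym (+∞-identityʳ _))
seg-+ φ s j (suc k) rewrite +-suc j k | seg-+ φ s j k | +-assoc s j k = +∞-assoc (seg φ s j) _ _

seg-const : ∀ {φ c} s k → (∀ u → s ≤ u → u < s + k → φ u ≡ [ c ]) → seg φ s k ≡ [ c * k ]
seg-const {c = c} s zero    h = cong [_] (sym (*-zeroʳ c))
seg-const {c = c} s (suc k) h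
  rewrite seg-const s k (λ u p q → h u p (<-≤-trans q (+-monoʳ-≤ s (n≤1+n k))))
        | h (s + k) (m≤m+n s k) (≤-reflexive (sym (+-suc s k))) =
  cong [_] (trans (+-comm (c * k) c) (sym (*-suc c k)))

seg-prefix : ∀ φ s j k {g} → j ≤ k → seg φ s k ≡ [ g ] → ∃ λ h → seg φ s j ≡ [ h ] × h ≤ g
seg-prefix φ s j k j≤k eq
  with +∞-finite _ _ (trans (sym (seg-+ φ s j (k ∸ j))) (trans (cong (seg φ s) (m+[n∸m]≡n j≤k)) eq))
... | h , l , p , _ , refl = h , p , m≤m+n h l

seg-finite : ∀ φ s k {g} → seg φ s k ≡ [ g ] → ∀ u → s ≤ u → u < s + k → ∃ λ h → φ u ≡ [ h ]
seg-finite φ s zero    eq u p q = ⊥-elim (<⇒≱ q (≤-trans (≤-reflexive (+-identityʳ s)) p))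
seg-finite φ s (suc k) eq u p q with +∞-finite _ _ eq | u <? s + k
... | _ , l , e , _ , _ | yes r = seg-finite φ s k e u p r
... | _ , l , _ , e , _ | no ¬r =
  l , trans (cong φ (≤-antisym (≤-pred (≤-trans q (≤-reflexive (+-suc s k)))) (≮⇒≥ ¬r))) e

branch-least : ∀ a b → a ∸ (a ∸ b) ≡ a ⊓ b
branch-least a b with ≤-total a b
... | inj₁ a≤b rewrite m≤n⇒m∸n≡0 a≤b = sym (m≤n⇒m⊓n≡m a≤b)
... | inj₂ b≤a = trans (m∸[m∸n]≡n b≤a) (sym (m≥n⇒m⊓n≡n b≤a))

affordable : ℕ → ℕ → ℕ∞ → ℕ
affordable M a c = branch (code c) (branch (code c ∸ 1) (quot M (code c ∸ 1)) a) 0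

amount-⊓ : ∀ a c U M → amount a (code c) U M ≡ a ⊓ (U ⊓ affordable M a c)
amount-⊓ a c U M = trans (branch-least a _) (cong (a ⊓_) (branch-least U _))

amount≤a : ∀ a c U M → amount a (code c) U M ≤ a
amount≤a a c U M rewrite amount-⊓ a c U M = m⊓n≤m a _

amount≤U : ∀ a c U M → amount a (code c) U M ≤ U
amount≤U a c U M rewrite amount-⊓ a c U M = ≤-trans (m⊓n≤n a _) (m⊓n≤m U _)

amount-affordable : ∀ a c U M → value c * amount a (code c) U M ≤ M
amount-affordable a ⊤⁺ U M = z≤n
amount-affordable a [ zero ] U M = z≤n
amount-affordable a [ suc c ] U M rewrite amount-⊓ a [ suc c ] U M =
  ≤-trans (*-monoʳ-≤ (suc c) (≤-trans (m⊓n≤n a _) (m⊓n≤n U _)))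
    (≤-trans (≤-reflexive (*-comm (suc c) _)) (m/n*n≤m M (suc c)))

amount-infinite : ∀ a c U M → c ≡ ⊤⁺ → amount a (code c) U M ≡ 0
amount-infinite a ⊤⁺ U M refl rewrite amount-⊓ a ⊤⁺ U M | ⊓-zeroʳ U = ⊓-zeroʳ a

amount-maximal : ∀ a c U M y → y ≤ a → y ≤ U → c * y ≤ M → y ≤ amount a (code [ c ]) U M
amount-maximal a c U M y p q r rewrite amount-⊓ a [ c ] U M = ⊓-glb p (⊓-glb q (afford c r))
  where
  afford : ∀ c → c * y ≤ M → y ≤ affordable M a [ c ]
  afford zero    r = p
  afford (suc c) r =
    ≤-trans (≤-reflexive (sym (m*n/n≡m y (suc c)))) (/-monoˡ-≤ (suc c) (≤-trans (≤-reflexive (*-comm y (suc c))) r))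

-- The part of client j's demand among the first t units.
fill : ∀ {n} → (Fin n → ℕ) → Fin n → ℕ → ℕ
fill d zero    t = (t ∸ ∑ (d ∘ suc)) ⊓ d zero
fill d (suc j) t = fill (d ∘ suc) j t

fill-zero : ∀ {n} (d : Fin n → ℕ) j → fill d j 0 ≡ 0
fill-zero d zero    rewrite 0∸n≡0 (∑ (d ∘ suc)) = refl
fill-zero d (suc j) = fill-zero (d ∘ suc) j

fill-full : ∀ {n} (d : Fin n → ℕ) j {t} → ∑ d ≤ t → fill d j t ≡ d j
fill-full d zero    {t} p = m≥n⇒m⊓n≡n (≤-trans (≤-reflexive (sym (m+n∸n≡m (d zero) (∑ (d ∘ suc))))) (∸-monoˡ-≤ (∑ (d ∘ suc)) p))
fill-full d (suc j) p = fill-full (d ∘ suc) j (≤-trans (m≤n+m _ (d zero)) p)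

clientRow : ∀ {n} → (Fin n → ℕ) → (Fin n → ℕ∞) → List (ℕ × ℕ)
clientRow d c = tabulate λ j → d j , code (c j)

capacityLeft moneyLeft reached : ServeState → ℕ
capacityLeft s = proj₁ (proj₂ s)
moneyLeft    s = proj₁ (proj₂ (proj₂ s))
reached      s = proj₁ (proj₂ (proj₂ (proj₂ s)))

-- The outcome of a run from position `t` with capacity `U` and money `M`. `maximal` is what
-- completeness of the tables rests on; amounts, money and `filled` account for the solution that is
-- returned.
record Served {n} (d : Fin n → ℕ) (c : Fin n → ℕ∞) (t U M : ℕ) (s : ServeState) : Set where
  field
    x             : Fin n → ℕ
    total spent   : ℕ
    τ-eq          : proj₁ s ≡ t ∸ ∑ d
    reached-eq    : reached s ≡ t + total
    within        : total ≤ U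
    moneyLeft-eq  : spent + moneyLeft s ≡ M
    paid          : seg (ψ d c) t total ≡ [ spent ]
    -- Either all units of the clients seen so far are served and the capacity left is exact, or the
    -- run has ended early and its capacity was set to 0.
    status        : (t + total ≡ t ⊔ ∑ d × total + capacityLeft s ≡ U) ⊎ (t + total < ∑ d × capacityLeft s ≡ 0)
    maximal       : ∀ y g → y ≤ U → g ≤ M → seg (ψ d c) t y ≡ [ g ] → y ≤ total
    fractions     : proj₂ (proj₂ (proj₂ (proj₂ s))) ≡ tabulate λ j → (0 , x j) , d j
    total-eq      : ∑ x ≡ total
    spent-eq      : ∑ (λ j → value (c j) * x j) ≡ spent
    infinite      : ∀ j → c j ≡ ⊤⁺ → x j ≡ 0
    filled        : ∀ j → fill d j t + x j ≡ fill d j (t + total)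

-- If everything below `E` is served, serving what is left of the next client moves the end of the
-- run from `t ⊔ E` to `t ⊔ (d + E)`.
⊔-∸ : ∀ t E d → t ⊔ E + (d ∸ (t ∸ E)) ≡ t ⊔ (d + E)
⊔-∸ t E d with ≤-total t E
... | inj₁ t≤E rewrite m≤n⇒m∸n≡0 t≤E | m≤n⇒m⊔n≡n t≤E | m≤n⇒m⊔n≡n (≤-trans t≤E (m≤n+m E d)) = +-comm E d
... | inj₂ E≤t rewrite m≥n⇒m⊔n≡m E≤t = begin
  t + (d ∸ (t ∸ E))             ≡⟨ cong (_+ (d ∸ (t ∸ E))) (sym (m∸n+n≡m E≤t)) ⟩
  t ∸ E + E + (d ∸ (t ∸ E))     ≡⟨ cong (_+ (d ∸ (t ∸ E))) (+-comm (t ∸ E) E) ⟩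
  E + (t ∸ E) + (d ∸ (t ∸ E))   ≡⟨ +-assoc E (t ∸ E) _ ⟩
  E + (t ∸ E + (d ∸ (t ∸ E)))   ≡⟨ cong (E +_) (sym (m⊔n≡m+[n∸m] (t ∸ E) d)) ⟩
  E + (t ∸ E ⊔ d)               ≡⟨ +-distribˡ-⊔ E (t ∸ E) d ⟩
  (E + (t ∸ E)) ⊔ (E + d)       ≡⟨ cong₂ _⊔_ (m+[n∸m]≡n E≤t) (+-comm E d) ⟩
  t ⊔ (d + E)                   ∎
  where
  open Relation.Binary.PropositionalEquality.≡-Reasoning
  m⊔n≡m+[n∸m] : ∀ m n → m ⊔ n ≡ m + (n ∸ m)
  m⊔n≡m+[n∸m] zero    n       = refl
  m⊔n≡m+[n∸m] (suc m) zero    = cong suc (sym (+-identityʳ m))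
  m⊔n≡m+[n∸m] (suc m) (suc n) = cong suc (m⊔n≡m+[n∸m] m n)

fill-step : ∀ p d x → x ≤ d ∸ p → p ⊓ d + x ≡ (p + x) ⊓ d
fill-step p d x x≤ with ≤-total p d
... | inj₁ p≤d rewrite m≤n⇒m⊓n≡m p≤d =
  sym (m≤n⇒m⊓n≡m (≤-trans (+-monoʳ-≤ p x≤) (≤-reflexive (m+[n∸m]≡n p≤d))))
... | inj₂ d≤p rewrite m≤n⇒m∸n≡0 d≤p | n≤0⇒n≡0 x≤ | +-identityʳ (p ⊓ d) | +-identityʳ p = refl

-- Client `zero` owns the topmost units, from `E` on. The run through the other clients either has
-- stopped below `E`, and then nothing changes, or it has reached `E`, and then only units of this
-- one client, all of the same cost, can follow.
serve-step : ∀ {n} (d : Fin (suc n) → ℕ) (c : Fin (suc n) → ℕ∞) t U M {s} →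
             Served (d ∘ suc) (c ∘ suc) t U M s → Served d c t U M (serve s (d zero , code (c zero)))
serve-step {n} d c t U M {s} r = record
  { x            = λ { zero → x₀ ; (suc j) → r.x j }
  ; total        = r.total + x₀
  ; spent        = r.spent + value (c zero) * x₀
  ; τ-eq         = trans (cong (_∸ d zero) r.τ-eq) (trans (∸-+-assoc t E (d zero)) (cong (t ∸_) (+-comm E (d zero))))
  ; reached-eq   = trans (cong (_+ x₀) r.reached-eq) (+-assoc t r.total x₀)
  ; within       = within
  ; moneyLeft-eq = moneyLeft-eq
  ; paid         = paid
  ; status       = status
  ; maximal      = maximal
  ; fractions    = cong₂ _∷_ refl r.fractions
  ; total-eq     = trans (cong (x₀ +_) r.total-eq) (+-comm x₀ r.total)
  ; spent-eq     = trans (cong (value (c zero) * x₀ +_) r.spent-eq) (+-comm (value (c zero) * x₀) r.spent)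
  ; infinite     = λ { zero → amount-infinite a (c zero) U′ M′ ; (suc j) → r.infinite j }
  ; filled       = λ { zero → filled₀ ; (suc j) → trans (r.filled j) (filled₁ j) }
  }
  where
  module r = Served r
  E a x₀ U′ M′ : ℕ
  E  = ∑ (d ∘ suc)
  U′ = capacityLeft s
  M′ = moneyLeft s
  a  = d zero ∸ proj₁ s
  x₀ = amount a (code (c zero)) U′ M′

  φ : ℕ → ℕ∞
  φ = ψ d c

  a≡ : a ≡ d zero ∸ (t ∸ E)
  a≡ = cong (d zero ∸_) r.τ-eq

  x₀≤a : x₀ ≤ d zero ∸ (t ∸ E)
  x₀≤a = ≤-trans (amount≤a a (c zero) U′ M′) (≤-reflexive a≡)

  short⇒x₀≡0 : U′ ≡ 0 → x₀ ≡ 0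
  short⇒x₀≡0 eq = n≤0⇒n≡0 (≤-trans (amount≤U a (c zero) U′ M′) (≤-reflexive eq))

  within : r.total + x₀ ≤ U
  within with r.status
  ... | inj₁ (_ , eq) = ≤-trans (+-monoʳ-≤ r.total (amount≤U a (c zero) U′ M′)) (≤-reflexive eq)
  ... | inj₂ (_ , eq) rewrite short⇒x₀≡0 eq | +-identityʳ r.total = r.within

  moneyLeft-eq : r.spent + value (c zero) * x₀ + (M′ ∸ (code (c zero) ∸ 1) * x₀) ≡ M
  moneyLeft-eq = trans (+-assoc r.spent _ _)
    (trans (cong (r.spent +_)
             (trans (cong (λ v → value (c zero) * x₀ + (M′ ∸ v * x₀)) (code∸1 (c zero)))
                    (m+[n∸m]≡n (amount-affordable a (c zero) U′ M′))))
           r.moneyLeft-eq)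
    where
    code∸1 : ∀ e → code e ∸ 1 ≡ value e
    code∸1 [ _ ] = refl
    code∸1 ⊤⁺    = refl

  tail-eq : ∀ k → t + k ≤ E → seg φ t k ≡ seg (ψ (d ∘ suc) (c ∘ suc)) t k
  tail-eq k le = seg-cong t k λ u _ q → ψ-tail d c (<-≤-trans q le)

  seg-total : seg φ t r.total ≡ [ r.spent ]
  seg-total with r.status
  ... | inj₂ (lt , _) = trans (tail-eq r.total (<⇒≤ lt)) r.paid
  ... | inj₁ (eq , _) with ≤-total t E
  ...   | inj₁ t≤E = trans (tail-eq r.total (≤-reflexive (trans eq (m≤n⇒m⊔n≡n t≤E)))) r.paid
  -- The units of the other clients all lie before `t`, so the run is still empty.
  ...   | inj₂ E≤t = trans (subst (λ k → seg φ t k ≡ seg (ψ (d ∘ suc) (c ∘ suc)) t k) (sym X≡0) refl) r.paid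
    where
    X≡0 : r.total ≡ 0
    X≡0 = +-cancelˡ-≡ t _ _ (trans eq (trans (m≥n⇒m⊔n≡m E≤t) (sym (+-identityʳ t))))

  x₀-finite : ∀ e → x₀ ≢ 0 → c zero ≡ e → e ≡ [ value e ]
  x₀-finite [ _ ] _ _  = refl
  x₀-finite ⊤⁺    p eq = ⊥-elim (p (amount-infinite a (c zero) U′ M′ eq))

  full-end : t + r.total ≡ t ⊔ E → t + r.total + a ≡ t ⊔ ∑ d
  full-end eq rewrite eq | a≡ = ⊔-∸ t E (d zero)

  -- Beyond the demand already met, only units of client 0 are left.
  seg-new : ∀ k → t + r.total ≡ t ⊔ E → k ≤ a → ∀ u → t + r.total ≤ u → u < t + r.total + k → φ u ≡ c zero
  seg-new k eq k≤a u p q = ψ-head d c (≤-trans (m≤n⊔m t E) (≤-trans (≤-reflexive (sym eq)) p)) (u< (≤-total t (∑ d)))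
    where
    u<⊔ : u < t ⊔ ∑ d
    u<⊔ = <-≤-trans q (≤-trans (+-monoʳ-≤ (t + r.total) k≤a) (≤-reflexive (full-end eq)))
    u< : t ≤ ∑ d ⊎ ∑ d ≤ t → u < ∑ d
    u< (inj₁ t≤) = <-≤-trans u<⊔ (≤-reflexive (m≤n⇒m⊔n≡n t≤))
    u< (inj₂ ≤t) = ⊥-elim (<⇒≱ (<-≤-trans u<⊔ (≤-reflexive (m≥n⇒m⊔n≡m ≤t))) (≤-trans (m≤m+n t r.total) p))

  paid-new : seg φ (t + r.total) x₀ ≡ [ value (c zero) * x₀ ]
  paid-new with r.status
  ... | inj₂ (_ , eq) rewrite short⇒x₀≡0 eq = cong [_] (sym (*-zeroʳ (value (c zero))))
  ... | inj₁ (eq , _) with x₀ ℕ.≟ 0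
  ...   | yes z rewrite z = cong [_] (sym (*-zeroʳ (value (c zero))))
  ...   | no nz = seg-const (t + r.total) x₀ λ u p q →
                    trans (seg-new x₀ eq (amount≤a a (c zero) U′ M′) u p q) (x₀-finite (c zero) nz refl)

  paid : seg φ t (r.total + x₀) ≡ [ r.spent + value (c zero) * x₀ ]
  paid rewrite seg-+ φ t r.total x₀ | seg-total | paid-new = refl

  status : (t + (r.total + x₀) ≡ t ⊔ ∑ d × r.total + x₀ + branch (a ∸ x₀) 0 (U′ ∸ x₀) ≡ U) ⊎
           (t + (r.total + x₀) < ∑ d × branch (a ∸ x₀) 0 (U′ ∸ x₀) ≡ 0)
  status with r.status
  ... | inj₂ (lt , eq) =
    inj₂ (≤-trans (≤-trans (s≤s (≤-reflexive (cong (t +_) (trans (cong (r.total +_) (short⇒x₀≡0 eq)) (+-identityʳ _))))) lt) (m≤n+m E (d zero)) ,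
          both (a ∸ x₀) (trans (cong (_∸ x₀) eq) (0∸n≡0 x₀)))
    where
    both : ∀ k {v} → v ≡ 0 → branch k 0 v ≡ 0
    both zero    e = e
    both (suc k) e = refl
  ... | inj₁ (eq , eqU) = byRest (a ∸ x₀) refl
    where
    byRest : ∀ k → a ∸ x₀ ≡ k →
      (t + (r.total + x₀) ≡ t ⊔ ∑ d × r.total + x₀ + branch k 0 (U′ ∸ x₀) ≡ U) ⊎
      (t + (r.total + x₀) < ∑ d × branch k 0 (U′ ∸ x₀) ≡ 0)
    byRest zero p = inj₁
      (trans (sym (+-assoc t r.total x₀)) (trans (cong (t + r.total +_) x₀≡a) (full-end eq)) ,
       trans (+-assoc r.total x₀ _) (trans (cong (r.total +_) (m+[n∸m]≡n (amount≤U a (c zero) U′ M′))) eqU))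
      where
      x₀≡a : x₀ ≡ a
      x₀≡a = ≤-antisym (amount≤a a (c zero) U′ M′) (m∸n≡0⇒m≤n p)
    byRest (suc k) p = inj₂ (lt , refl)
      where
      x₀<a : x₀ < a
      x₀<a = m∸n≢0⇒n<m λ e → 1+n≢0 (trans (sym p) e)
      <⊔ : t + (r.total + x₀) < t ⊔ ∑ d
      <⊔ = ≤-trans (s≤s (≤-reflexive (sym (+-assoc t r.total x₀))))
             (≤-trans (+-monoʳ-< (t + r.total) x₀<a) (≤-reflexive (full-end eq)))
      lt : t + (r.total + x₀) < ∑ d
      lt with ≤-total t (∑ d)
      ... | inj₁ t≤ = <-≤-trans <⊔ (≤-reflexive (m≤n⇒m⊔n≡n t≤))
      ... | inj₂ ≤t = ⊥-elim (<⇒≱ (<-≤-trans <⊔ (≤-reflexive (m≥n⇒m⊔n≡m ≤t))) (m≤m+n t _))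

  maximal : ∀ y g → y ≤ U → g ≤ M → seg φ t y ≡ [ g ] → y ≤ r.total + x₀
  maximal y g y≤U g≤M eq with r.status
  ... | inj₂ (lt , _) with t + y ≤? E
  ...   | yes p = ≤-trans (r.maximal y g y≤U g≤M (trans (sym (tail-eq y p)) eq)) (m≤m+n r.total x₀)
  -- A longer block would contain an affordable prefix ending at `E`, and the run, being maximal,
  -- would have reached `E`.
  ...   | no ¬p with seg-prefix φ t (E ∸ t) y y₀≤y eq
    where
    y₀≤y : E ∸ t ≤ y
    y₀≤y = ≤-trans (∸-monoˡ-≤ t (<⇒≤ (≰⇒> ¬p))) (≤-reflexive (m+n∸m≡n t y))
  ...     | h , eq′ , h≤g = ⊥-elim (<⇒≱ lt
            (≤-trans (≤-reflexive (sym t+≡E)) (+-monoʳ-≤ t (r.maximal (E ∸ t) h (≤-trans y₀≤y y≤U) (≤-trans h≤g g≤M)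
              (trans (sym (tail-eq (E ∸ t) (≤-reflexive t+≡E))) eq′)))))
    where
    t+≡E : t + (E ∸ t) ≡ E
    t+≡E = m+[n∸m]≡n (≤-trans (m≤m+n t r.total) (<⇒≤ lt))
    y₀≤y : E ∸ t ≤ y
    y₀≤y = ≤-trans (∸-monoˡ-≤ t (<⇒≤ (≰⇒> ¬p))) (≤-reflexive (m+n∸m≡n t y))
  maximal y g y≤U g≤M eq | inj₁ (full , eqU) with ≤-total y r.total
  ... | inj₁ y≤ = ≤-trans y≤ (m≤m+n r.total x₀)
  ... | inj₂ ≤y = ≤-trans (≤-reflexive (sym (m+[n∸m]≡n ≤y))) (+-monoʳ-≤ r.total (rest (y ∸ r.total) y₂≤U eq₂))
    where
    y₂≤U : y ∸ r.total ≤ U′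
    y₂≤U = ≤-trans (∸-monoˡ-≤ r.total y≤U) (≤-reflexive (trans (cong (_∸ r.total) (sym eqU)) (m+n∸m≡n r.total U′)))
    eq₂ : seg φ t r.total +∞ seg φ (t + r.total) (y ∸ r.total) ≡ [ g ]
    eq₂ = trans (sym (seg-+ φ t r.total (y ∸ r.total))) (trans (cong (seg φ t) (m+[n∸m]≡n ≤y)) eq)
    rest : ∀ y₂ → y₂ ≤ U′ → seg φ t r.total +∞ seg φ (t + r.total) y₂ ≡ [ g ] → y₂ ≤ x₀
    rest zero _ _ = z≤n
    rest (suc y₂) y₂≤U′ eq₂ with +∞-finite _ _ eq₂
    -- The last of the additional units has finite cost and therefore exists; hence all of them fit
    -- into the open demand of client `zero`.
    ... | k , l , p , q , k+l≡g with seg-finite φ (t + r.total) (suc y₂) q (t + r.total + y₂) (m≤m+n _ y₂) (+-monoʳ-< (t + r.total) ≤-refl)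
    ...   | h , last-eq = found (c zero) refl
      where
      last< : t + r.total + y₂ < ∑ d
      last< = ψ-finite⇒in d c last-eq
      y₂≤a : suc y₂ ≤ a
      y₂≤a = +-cancelˡ-≤ (t + r.total) _ _ (≤-trans (≤-reflexive (+-suc (t + r.total) y₂))
               (≤-trans last< (≤-trans (m≤n⊔m t (∑ d)) (≤-reflexive (sym (full-end full))))))
      found : ∀ e → c zero ≡ e → suc y₂ ≤ x₀
      found ⊤⁺ ceq with trans (sym last-eq) (trans (seg-new (suc y₂) full y₂≤a _ (m≤m+n _ y₂) (+-monoʳ-< (t + r.total) ≤-refl)) ceq)
      ... | ()
      found [ v ] ceq = subst (λ e → suc y₂ ≤ amount a (code e) U′ M′) (sym ceq)
        (amount-maximal a v U′ M′ (suc y₂) y₂≤a y₂≤U′ (+-cancelˡ-≤ r.spent _ _ bound))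
        where
        l≡ : v * suc y₂ ≡ l
        l≡ = []-injective (trans (sym (seg-const (t + r.total) (suc y₂) λ u p q → trans (seg-new (suc y₂) full y₂≤a u p q) ceq)) q)
        k≡ : r.spent ≡ k
        k≡ = []-injective (trans (sym seg-total) p)
        bound : r.spent + v * suc y₂ ≤ r.spent + M′
        bound = ≤-trans (≤-reflexive (trans (cong₂ _+_ k≡ l≡) k+l≡g)) (≤-trans g≤M (≤-reflexive (sym r.moneyLeft-eq)))

  filled₀ : fill d zero t + x₀ ≡ fill d zero (t + (r.total + x₀))
  filled₀ with r.status
  ... | inj₂ (lt , eq) rewrite short⇒x₀≡0 eq | +-identityʳ r.total
      | m≤n⇒m∸n≡0 (<⇒≤ lt) | m≤n⇒m∸n≡0 (≤-trans (m≤m+n t r.total) (<⇒≤ lt)) = refl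
  ... | inj₁ (eq , _) = trans (fill-step (t ∸ E) (d zero) x₀ x₀≤a) (cong (_⊓ d zero) (sym shifted))
    where
    shifted : t + (r.total + x₀) ∸ E ≡ t ∸ E + x₀
    shifted = trans (cong (_∸ E) (trans (sym (+-assoc t r.total x₀)) (trans (cong (_+ x₀) eq) (+-comm (t ⊔ E) x₀))))
                (trans (+-∸-assoc x₀ (m≤n⊔m t E)) (trans (cong (x₀ +_) (trans (∸-distribʳ-⊔ E t E) (trans (cong (t ∸ E ⊔_) (n∸n≡0 E)) (⊔-identityʳ _)))) (+-comm x₀ _)))

  filled₁ : ∀ j → fill (d ∘ suc) j (t + r.total) ≡ fill (d ∘ suc) j (t + (r.total + x₀))
  filled₁ j with r.status
  ... | inj₂ (_ , eq) rewrite short⇒x₀≡0 eq | +-identityʳ r.total = refl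
  ... | inj₁ (eq , _) = trans (fill-full (d ∘ suc) j E≤) (sym (fill-full (d ∘ suc) j
          (≤-trans E≤ (+-monoʳ-≤ t (m≤m+n r.total x₀)))))
    where
    E≤ : E ≤ t + r.total
    E≤ = ≤-trans (m≤n⊔m t E) (≤-reflexive (sym eq))

serve-row : ∀ {n} (d : Fin n → ℕ) (c : Fin n → ℕ∞) t U M →
            Served d c t U M (foldr (flip serve) (t , U , M , t , []) (clientRow d c))
serve-row {zero} d c t U M = record
  { x = λ () ; total = 0 ; spent = 0 ; τ-eq = refl ; reached-eq = sym (+-identityʳ t) ; within = z≤n
  ; moneyLeft-eq = refl ; paid = refl ; status = inj₁ (trans (+-identityʳ t) (sym (⊔-identityʳ t)) , refl)
  ; maximal = maximal ; fractions = refl ; total-eq = refl ; spent-eq = refl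
  ; infinite = λ () ; filled = λ () }
  where
  maximal : ∀ y g → y ≤ U → g ≤ M → seg (ψ d c) t y ≡ [ g ] → y ≤ 0
  maximal zero    g _ _ _  = z≤n
  maximal (suc y) g _ _ eq with +∞-finite _ _ eq
  ... | _ , _ , _ , () , _
serve-row {suc n} d c t U M = serve-step d c t U M (serve-row (d ∘ suc) (c ∘ suc) t U M)

-- Correctness of the dynamic program

branch-bit : ∀ {A : Set} a b {x y : A} →
             (a ≤ b × branch (bit (a ℕ.≤ᵇ b)) x y ≡ x) ⊎ (b < a × branch (bit (a ℕ.≤ᵇ b)) x y ≡ y)
branch-bit a b with a ℕ.≤ᵇ b in eq
... | true  = inj₁ (≤ᵇ⇒≤ a b (subst Data.Bool.T (sym eq) tt) , refl)
... | false = inj₂ (≰⇒> (λ p → subst Data.Bool.T eq (≤⇒≤ᵇ p)) , refl)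

walk-foldl : ∀ {A B : Set} ks (xs : List A) (z : B) f → length xs ≤ length ks → walk ks xs z f ≡ foldl f z xs
walk-foldl []       []       z f le       = refl
walk-foldl (k ∷ ks) []       z f le       = walk-foldl ks [] z f z≤n
walk-foldl (k ∷ ks) (x ∷ xs) z f (s≤s le) = walk-foldl ks xs (f z x) f le

foldl-map-ʳ++ : ∀ {A B : Set} (g : A → B) ys xs → foldl (λ acc x → g x ∷ acc) ys xs ≡ map g xs ʳ++ ys
foldl-map-ʳ++ g ys []       = refl
foldl-map-ʳ++ g ys (x ∷ xs) = foldl-map-ʳ++ g (g x ∷ ys) xs

quot-≥ : ∀ g a b → 0 < b → g * b ≤ a → g ≤ quot a b
quot-≥ g a (suc b) _ le = ≤-trans (≤-reflexive (sym (m*n/n≡m g (suc b)))) (/-monoˡ-≤ (suc b) le)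

quot-* : ∀ a b → quot a b * b ≤ a
quot-* a zero    = z≤n
quot-* a (suc b) = m/n*n≤m a (suc b)

suc-quot-* : ∀ a b → 0 < b → a ≤ (1 + quot a b) * b
suc-quot-* a (suc b) _ =
  ≤-trans (≤-reflexive (m≡m%n+[m/n]*n a (suc b))) (+-monoˡ-≤ _ (<⇒≤ (m%n<n a (suc b))))

site : ∀ {n} → (Fin n → ℕ) → El FacTy → (Fin n → ℕ∞) → Site
site d fac c = fac , reverse (clientRow d c)

-- A facility ships the units s, …, s + y - 1 at cost at most g.
Shipment : ∀ {n} → (Fin n → ℕ) → El FacTy → (Fin n → ℕ∞) → (s y g : ℕ) → Set
Shipment d (f , sign , cap) c s y g =
  y ≡ 0 ⊎ (sign ≡ 0 × y ≤ cap × ∃ λ h → seg (ψ d c) s y ≡ [ h ] × f + h ≤ g)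

-- The block of the first facility comes after those of all others, so it starts at the sum of their
-- lengths.
Plan : ∀ {m n} → (Fin n → ℕ) → (Fin m → El FacTy) → (Fin m → Fin n → ℕ∞) → (y g : Fin m → ℕ) → Set
Plan {zero}  d fac c y g = ⊤
Plan {suc m} d fac c y g =
  Shipment d (fac zero) (c zero) (∑ (y ∘ suc)) (y zero) (g zero) × Plan d (fac ∘ suc) (c ∘ suc) (y ∘ suc) (g ∘ suc)

-- The running time of the search depends on the list ks, its result only on
-- the keys that ks contains.
module Analysis (V : ℕ) (V>0 : 0 < V) (ks : List ℕ) (B : ℕ) (ks≤B : All (_≤ B) ks)
                (ks-complete : ∀ k → 0 < k → k ≤ B → k ∈ ks) (pre : Parameters) where

  open Search V ks pre

  module _ {n} (d : Fin n → ℕ) (R>0 : 0 < R) where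

    tables : ∀ {m} → (Fin m → El FacTy) → (Fin m → Fin n → ℕ∞) → List Entry
    tables fac c = foldr (flip nextTable) table₀ (tabulate λ i → site d (fac i) (c i))

    served-sound : ∀ fac c b t → Served d c t (branch (flag fac b) (proj₂ (proj₂ fac)) 0) (money b ∸ proj₁ fac)
                                   (served (site d fac c) b t)
    served-sound fac c b t =
      subst (Served d c t _ _) (sym (reverse-foldl serve _ (clientRow d c))) (serve-row d c t _ _)

    extend-≥ : ∀ fac c k b e → position e ≤ position (extendBy (site d fac c) k b e)
    extend-≥ fac c k b e =
      ≤-trans (m≤m+n (position e) _) (≤-reflexive (sym (Served.reached-eq (served-sound fac c b (position e)))))

    -- Starting further along is no disadvantage: what remains of the block is a final piece of it,
    -- which needs no more capacity or money, and the greedy run is at least as long. This is why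
    -- one entry per budget, the longest run, suffices.
    extend-complete : ∀ fac c s y g k b e → Shipment d fac c s y g → s ≤ position e → g ≤ money b →
                      s + y ≤ position (extendBy (site d fac c) k b e)
    extend-complete fac c s y g k b e (inj₁ refl) s≤ g≤ =
      ≤-trans (≤-reflexive (+-identityʳ s)) (≤-trans s≤ (extend-≥ fac c k b e))
    extend-complete fac@(f , sign , cap) c s y g k b e (inj₂ (refl , y≤cap , h , eq , f+h≤g)) s≤ g≤
      with ≤-total (s + y) (position e)
    ... | inj₁ le = ≤-trans le (extend-≥ fac c k b e)
    ... | inj₂ t≤ = ≤-trans (≤-reflexive (sym t+y′)) (≤-trans (+-monoʳ-≤ t y′≤) (≤-reflexive (sym S.reached-eq)))
      where
      t y′ : ℕ
      t  = position e
      y′ = s + y ∸ t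
      module S = Served (served-sound fac c b t)
      t+y′ : t + y′ ≡ s + y
      t+y′ = m+[n∸m]≡n t≤
      split : (t ∸ s) + y′ ≡ y
      split = +-cancelˡ-≡ s _ _ (trans (sym (+-assoc s (t ∸ s) y′)) (trans (cong (_+ y′) (m+[n∸m]≡n s≤)) t+y′))
      paid : ∃ λ h′ → seg (ψ d c) t y′ ≡ [ h′ ] × h′ ≤ h
      paid with +-finite-split
        where
        +-finite-split : ∃ λ k → ∃ λ l → seg (ψ d c) s (t ∸ s) ≡ [ k ] × seg (ψ d c) t y′ ≡ [ l ] × k + l ≡ h
        +-finite-split = subst (λ u → ∃ λ k → ∃ λ l → seg (ψ d c) s (t ∸ s) ≡ [ k ] × seg (ψ d c) u y′ ≡ [ l ] × k + l ≡ h)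
          (m+[n∸m]≡n s≤)
          (+∞-finite _ _ (trans (sym (seg-+ (ψ d c) s (t ∸ s) y′)) (trans (cong (seg (ψ d c) s) split) eq)))
      ... | k , l , _ , q , k+l = l , q , ≤-trans (m≤n+m l k) (≤-reflexive k+l)
      cap-open : branch (flag fac b) cap 0 ≡ cap
      cap-open with branch-bit f (money b) {cap} {0}
      ... | inj₁ (_ , eq) = eq
      ... | inj₂ (lt , _) = ⊥-elim (<⇒≱ lt (≤-trans (m≤m+n f h) (≤-trans f+h≤g g≤)))
      y′≤ : y′ ≤ S.total
      y′≤ = S.maximal y′ (proj₁ paid)
        (≤-trans (≤-trans (m≤n+m y′ (t ∸ s)) (≤-reflexive split)) (≤-trans y≤cap (≤-reflexive (sym cap-open))))
        (≤-trans (proj₂ (proj₂ paid)) (≤-trans (≤-reflexive (sym (m+n∸m≡n f h))) (∸-monoˡ-≤ f (≤-trans f+h≤g g≤))))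
        (proj₁ (proj₂ paid))

    improve-spec : ∀ s e best e′ → let candidate = extendBy s (key e) (key e ∸ key e′) e′ in
      (improve s e best e′ ≡ best ⊎ (key e′ ≤ key e × improve s e best e′ ≡ candidate)) ×
      position best ≤ position (improve s e best e′) ×
      (key e′ ≤ key e → position candidate ≤ position (improve s e best e′))
    improve-spec s e best e′ with branch-bit (key e′) (key e) {branch (bit (1 + position best ℕ.≤ᵇ position (extendBy s (key e) (key e ∸ key e′) e′))) (extendBy s (key e) (key e ∸ key e′) e′) best} {best}
    ... | inj₂ (lt , eq) = inj₁ eq , ≤-reflexive (cong position (sym eq)) , λ le → ⊥-elim (<⇒≱ lt le)
    ... | inj₁ (le , eq) with branch-bit (1 + position best) (position (extendBy s (key e) (key e ∸ key e′) e′)) {extendBy s (key e) (key e ∸ key e′) e′} {best}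
    ...   | inj₁ (lt , eq′) = inj₂ (le , trans eq eq′) ,
              ≤-trans (<⇒≤ lt) (≤-reflexive (cong position (sym (trans eq eq′)))) ,
              λ _ → ≤-reflexive (cong position (sym (trans eq eq′)))
    ...   | inj₂ (lt , eq′) = inj₁ (trans eq eq′) , ≤-reflexive (cong position (sym (trans eq eq′))) ,
              λ _ → ≤-trans (≤-pred lt) (≤-reflexive (cong position (sym (trans eq eq′))))

    improveAll : Site → Entry → List Entry → Entry
    improveAll s e T = foldl (improve s e) (extendBy s (key e) 0 e) T

    improve-from : ∀ s e T best →
      (foldl (improve s e) best T ≡ best ⊎ ∃ λ e′ → e′ ∈ T × key e′ ≤ key e × foldl (improve s e) best T ≡ extendBy s (key e) (key e ∸ key e′) e′) ×
      position best ≤ position (foldl (improve s e) best T) ×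
      (∀ {e′} → e′ ∈ T → key e′ ≤ key e → position (extendBy s (key e) (key e ∸ key e′) e′) ≤ position (foldl (improve s e) best T))
    improve-from s e []       best = inj₁ refl , ≤-refl , λ ()
    improve-from s e (e′ ∷ T) best with improve-spec s e best e′ | improve-from s e T (improve s e best e′)
    ... | from , grows , beats | from′ , grows′ , beats′ =
      origin from from′ , ≤-trans grows grows′ ,
      λ { (here refl) le → ≤-trans (beats le) grows′ ; (there i) le → beats′ i le }
      where
      origin : (improve s e best e′ ≡ best ⊎ (key e′ ≤ key e × improve s e best e′ ≡ extendBy s (key e) (key e ∸ key e′) e′)) →
        (foldl (improve s e) (improve s e best e′) T ≡ improve s e best e′ ⊎ ∃ λ e″ → e″ ∈ T × key e″ ≤ key e × foldl (improve s e) (improve s e best e′) T ≡ extendBy s (key e) (key e ∸ key e″) e″) →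
        foldl (improve s e) (improve s e best e′) T ≡ best ⊎ ∃ λ e″ → e″ ∈ (e′ ∷ T) × key e″ ≤ key e × foldl (improve s e) (improve s e best e′) T ≡ extendBy s (key e) (key e ∸ key e″) e″
      origin (inj₁ p)        (inj₁ q) = inj₁ (trans q p)
      origin (inj₂ (le , p)) (inj₁ q) = inj₂ (e′ , here refl , le , trans q p)
      origin _ (inj₂ (e″ , i , le , q)) = inj₂ (e″ , there i , le , q)

    improveAll-from : ∀ s e T → e ∈ T →
      ∃ λ e′ → e′ ∈ T × key e′ ≤ key e × ∃ λ b → key e′ + b ≤ key e × improveAll s e T ≡ extendBy s (key e) b e′
    improveAll-from s e T i with proj₁ (improve-from s e T (extendBy s (key e) 0 e))
    ... | inj₁ p = e , i , ≤-refl , 0 , ≤-reflexive (+-identityʳ _) , p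
    ... | inj₂ (e′ , j , le , p) = e′ , j , le , key e ∸ key e′ , ≤-reflexive (m+[n∸m]≡n le) , p

    nextTable-eq : ∀ T s → length T ≤ length ks → nextTable T s ≡ reverse (map (λ e → improveAll s e T) T)
    nextTable-eq T s le =
      trans (walk-foldl ks T [] _ le) (trans (congFold T []) (foldl-map-ʳ++ (λ e → improveAll s e T) [] T))
      where
      congFold : ∀ (xs acc : List Entry) → foldl (λ (new : List Entry) (e : Entry) → walk ks T (extendBy s (key e) 0 e) (improve s e) ∷ new) acc xs ≡
                            foldl (λ (new : List Entry) (e : Entry) → improveAll s e T ∷ new) acc xs
      congFold []       acc = refl
      congFold (x ∷ xs) acc rewrite walk-foldl ks T (extendBy s (key x) 0 x) (improve s x) le = congFold xs (improveAll s x T ∷ acc)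

    initial : ℕ → Entry
    initial k = k , 0 , [] , []

    table₀-eq : table₀ ≡ reverse (map initial ks)
    table₀-eq = foldl-map-ʳ++ initial [] ks

    tables-length : ∀ {m} (fac : Fin m → El FacTy) c → length (tables fac c) ≤ length ks
    tables-length {zero} fac c rewrite table₀-eq =
      ≤-reflexive (trans (length-reverse (map initial ks)) (length-map initial ks))
    tables-length {suc m} fac c
      rewrite nextTable-eq (tables (fac ∘ suc) (c ∘ suc)) (site d (fac zero) (c zero)) (tables-length (fac ∘ suc) (c ∘ suc)) =
      ≤-trans (≤-reflexive (trans (length-reverse (map g T)) (length-map g T)))
        (tables-length (fac ∘ suc) (c ∘ suc))
      where
      T : List Entry
      T = tables (fac ∘ suc) (c ∘ suc)
      g : Entry → Entry
      g e = improveAll (site d (fac zero) (c zero)) e T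

    module _ {m} (fac : Fin (suc m) → El FacTy) (c : Fin (suc m) → Fin n → ℕ∞) where

      private
        T : List Entry
        T = tables (fac ∘ suc) (c ∘ suc)
        s : Site
        s = site d (fac zero) (c zero)

      ∈-tables⁺ : ∀ {e} → e ∈ T → improveAll s e T ∈ tables fac c
      ∈-tables⁺ {e} i = subst (improveAll s e T ∈_) (sym (nextTable-eq T s (tables-length (fac ∘ suc) (c ∘ suc))))
        (reverse⁺ (∈-map⁺ (λ e → improveAll s e T) i))

      ∈-tables⁻ : ∀ {e} → e ∈ tables fac c → ∃ λ e′ → e′ ∈ T × e ≡ improveAll s e′ T
      ∈-tables⁻ {e} i = ∈-map⁻ (λ e → improveAll s e T)
        (reverse⁻ {xs = map (λ e → improveAll s e T) T} (subst (e ∈_) (nextTable-eq T s (tables-length (fac ∘ suc) (c ∘ suc))) i))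

    improveAll-key : ∀ s e T → e ∈ T → key (improveAll s e T) ≡ key e
    improveAll-key s e T i with improveAll-from s e T i
    ... | _ , _ , _ , _ , _ , eq = cong key eq

    tables-keys : ∀ {m} (fac : Fin m → El FacTy) c k → 0 < k → k ≤ B → ∃ λ e → e ∈ tables fac c × key e ≡ k
    tables-keys {zero} fac c k k>0 k≤B =
      (k , 0 , [] , []) , subst (_ ∈_) (sym table₀-eq) (reverse⁺ (∈-map⁺ initial (ks-complete k k>0 k≤B))) , refl
    tables-keys {suc m} fac c k k>0 k≤B with tables-keys (fac ∘ suc) (c ∘ suc) k k>0 k≤B
    ... | e , i , eq = _ , ∈-tables⁺ fac c i , trans (improveAll-key (site d (fac zero) (c zero)) e (tables (fac ∘ suc) (c ∘ suc)) i) eq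

    -- Every entry results from extensions whose budgets sum up to at most its key.
    Trace : ∀ {m} → (Fin m → El FacTy) → (Fin m → Fin n → ℕ∞) → ℕ → El (num ⊗ OutTy) → Set
    Trace {zero}  fac c β (t , flags , rows) = t ≡ 0 × flags ≡ [] × rows ≡ []
    Trace {suc m} fac c β p =
      ∃ λ p′ → ∃ λ β′ → ∃ λ b → β′ + b ≤ β × Trace (fac ∘ suc) (c ∘ suc) β′ p′ ×
        p ≡ proj₂ (extendBy (site d (fac zero) (c zero)) 0 b (0 , p′))

    tables-sound : ∀ {m} (fac : Fin m → El FacTy) c {e} → e ∈ tables fac c → key e ≤ B × Trace fac c (key e) (proj₂ e)
    tables-sound {zero} fac c {e} i with ∈-map⁻ initial (reverse⁻ {xs = map initial ks} (subst (e ∈_) table₀-eq i))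
    ... | k , j , refl = All.lookup ks≤B j , refl , refl , refl
    tables-sound {suc m} fac c i with ∈-tables⁻ fac c i
    ... | e′ , j , refl with improveAll-from (site d (fac zero) (c zero)) e′ _ j | tables-sound (fac ∘ suc) (c ∘ suc) j
    ...   | e″ , l , le , b , le′ , eq | key≤ , _ =
      ≤-trans (≤-reflexive (improveAll-key (site d (fac zero) (c zero)) e′ (tables (fac ∘ suc) (c ∘ suc)) j)) key≤ ,
      proj₂ e″ , key e″ , b , ≤-trans le′ (≤-reflexive (sym (improveAll-key (site d (fac zero) (c zero)) e′ (tables (fac ∘ suc) (c ∘ suc)) j))) ,
      proj₂ (tables-sound (fac ∘ suc) (c ∘ suc) l) , cong proj₂ eq

    -- A number of budget units of worth V / R that buys `g`. Adding 1 to the floor, instead of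
    -- taking the exact ceiling, already keeps the loss within one unit.
    share : ℕ → ℕ
    share g = 1 + quot (g * R) V

    share-money : ∀ g → g ≤ money (share g)
    share-money g = quot-≥ g _ R R>0 (≤-trans (suc-quot-* (g * R) V V>0) (≤-reflexive (*-comm (share g) V)))

    share-bound : ∀ g → share g * V ≤ V + g * R
    share-bound g = +-monoʳ-≤ V (quot-* (g * R) V)

    -- The leading 1 is the smallest key: keys are positive, so the empty run is found at 1 rather
    -- than 0. With one rounding per facility this makes m + 1 units of loss.
    tables-complete : ∀ {m} (fac : Fin m → El FacTy) c y g → Plan d fac c y g → 1 + ∑ (share ∘ g) ≤ B →
      ∃ λ e → e ∈ tables fac c × key e ≡ 1 + ∑ (share ∘ g) × ∑ y ≤ position e
    tables-complete {zero} fac c y g plan le with tables-keys fac c 1 (s≤s z≤n) le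
    ... | e , i , eq = e , i , eq , z≤n
    tables-complete {suc m} fac c y g (ship , plan) le
      with tables-complete (fac ∘ suc) (c ∘ suc) (y ∘ suc) (g ∘ suc) plan (≤-trans (s≤s (m≤n+m _ (share (g zero)))) le)
         | tables-keys (fac ∘ suc) (c ∘ suc) _ (s≤s z≤n) le
    ... | e′ , i′ , eq′ , reach | e , i , eq =
      improveAll s e T , ∈-tables⁺ fac c i , trans (improveAll-key s e T i) eq ,
      ≤-trans (≤-reflexive (+-comm (y zero) _))
        (≤-trans (extend-complete (fac zero) (c zero) _ (y zero) (g zero) (key e) (key e ∸ key e′) e′ ship reach
                   (≤-trans (share-money (g zero)) (≤-reflexive (cong money (sym budget)))))
                 (proj₂ (proj₂ (improve-from s e T (extendBy s (key e) 0 e))) i′ key≤))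
      where
      T : List Entry
      T = tables (fac ∘ suc) (c ∘ suc)
      s : Site
      s = site d (fac zero) (c zero)
      rest : ℕ
      rest = ∑ (share ∘ g ∘ suc)
      budget : key e ∸ key e′ ≡ share (g zero)
      budget = trans (cong₂ _∸_ eq eq′) (m+n∸n≡m (share (g zero)) rest)
      key≤ : key e′ ≤ key e
      key≤ = ≤-trans (≤-reflexive eq′) (≤-trans (s≤s (m≤n+m rest (share (g zero)))) (≤-reflexive (sym eq)))

    Best : List Entry → List Entry → Set
    Best T found =
      (found ≡ [] × (∀ {e} → e ∈ T → position e < D)) ⊎
      (∃ λ e → found ≡ e ∷ [] × e ∈ T × D ≤ position e × (∀ {e′} → e′ ∈ T → D ≤ position e′ → key e ≤ key e′))

    private
      -- `Best` for an arbitrary start value, as induction on the list requires.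
      Chosen : List Entry → List Entry → List Entry → Set
      Chosen T best found =
        (found ≡ [] × best ≡ [] × (∀ {e} → e ∈ T → position e < D)) ⊎
        (∃ λ e → found ≡ e ∷ [] × (best ≡ e ∷ [] ⊎ (e ∈ T × D ≤ position e)) ×
          (∀ {e′ l} → best ≡ e′ ∷ l → key e ≤ key e′) × (∀ {e′} → e′ ∈ T → D ≤ position e′ → key e ≤ key e′))

    choose-spec : ∀ best e → (best ≡ [] ⊎ ∃ λ e′ → best ≡ e′ ∷ []) → Chosen (e ∷ []) best (chooseBetter best e)
    choose-spec best e shape with branch-bit D (position e) {uncons best (e ∷ []) λ e′ _ → branch (bit (1 + key e ℕ.≤ᵇ key e′)) (e ∷ []) best} {best}
    choose-spec .[] e (inj₁ refl) | inj₂ (lt , eq) = inj₁ (eq , refl , λ { (here refl) → lt })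
    choose-spec .(e′ ∷ []) e (inj₂ (e′ , refl)) | inj₂ (lt , eq) =
      inj₂ (e′ , eq , inj₁ refl , (λ { refl → ≤-refl }) , λ { (here refl) le → ⊥-elim (<⇒≱ lt le) })
    choose-spec .[] e (inj₁ refl) | inj₁ (le , eq) =
      inj₂ (e , eq , inj₂ (here refl , le) , (λ ()) , λ { (here refl) _ → ≤-refl })
    choose-spec .(e′ ∷ []) e (inj₂ (e′ , refl)) | inj₁ (le , eq) with branch-bit (1 + key e) (key e′) {e ∷ []} {e′ ∷ []}
    ... | inj₁ (lt , eq′) =
      inj₂ (e , trans eq eq′ , inj₂ (here refl , le) , (λ { refl → <⇒≤ lt }) , λ { (here refl) _ → ≤-refl })
    ... | inj₂ (lt , eq′) =
      inj₂ (e′ , trans eq eq′ , inj₁ refl , (λ { refl → ≤-refl }) , λ { (here refl) _ → ≤-pred lt })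

    choose-from : ∀ T best → (best ≡ [] ⊎ ∃ λ e′ → best ≡ e′ ∷ []) → Chosen T best (foldl chooseBetter best T)
    choose-from [] .[] (inj₁ refl) = inj₁ (refl , refl , λ ())
    choose-from [] .(e ∷ []) (inj₂ (e , refl)) = inj₂ (e , refl , inj₁ refl , (λ { refl → ≤-refl }) , λ ())
    choose-from (e ∷ T) best shape with choose-spec best e shape
    ... | inj₁ (eq , eq′ , below) with choose-from T (chooseBetter best e) (inj₁ eq)
    ...   | inj₁ (p , _ , below′) = inj₁ (p , eq′ , λ { (here refl) → below (here refl) ; (there i) → below′ i })
    ...   | inj₂ (e₁ , p , inj₁ q , _) with trans (sym eq) q
    ...     | ()
    choose-from (e ∷ T) best shape | inj₁ (eq , refl , below) | inj₂ (e₁ , p , inj₂ (i , le) , _ , least) =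
      inj₂ (e₁ , p , inj₂ (there i , le) , (λ ()) ,
        λ { (here refl) le → ⊥-elim (<⇒≱ (below (here refl)) le) ; (there j) le → least j le })
    choose-from (e ∷ T) best shape | inj₂ (e₀ , eq , from , leb , least) with choose-from T (chooseBetter best e) (inj₂ (e₀ , eq))
    ... | inj₁ (_ , q , _) with trans (sym eq) q
    ...   | ()
    choose-from (e ∷ T) best shape | inj₂ (e₀ , eq , from , leb , least) | inj₂ (e₁ , p , from′ , leb′ , least′) =
      inj₂ (e₁ , p , origin from′ , (λ q → ≤-trans (leb′ eq) (leb q)) ,
        λ { (here refl) le → ≤-trans (leb′ eq) (least (here refl) le) ; (there j) le → least′ j le })
      where
      origin : (chooseBetter best e ≡ e₁ ∷ [] ⊎ (e₁ ∈ T × D ≤ position e₁)) → best ≡ e₁ ∷ [] ⊎ (e₁ ∈ (e ∷ T) × D ≤ position e₁)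
      origin (inj₂ (i , le)) = inj₂ (there i , le)
      origin (inj₁ q) = first from (∷-injectiveˡ (trans (sym eq) q))
        where
        first : (best ≡ e₀ ∷ [] ⊎ (e₀ ∈ (e ∷ []) × D ≤ position e₀)) → e₀ ≡ e₁ → best ≡ e₁ ∷ [] ⊎ (e₁ ∈ (e ∷ T) × D ≤ position e₁)
        first (inj₁ r) refl = inj₁ r
        first (inj₂ (here refl , le)) refl = inj₂ (here refl , le)

    search-best : ∀ {m} (fac : Fin m → El FacTy) c → sites ≡ reverse (tabulate λ i → site d (fac i) (c i)) →
                  Best (tables fac c) search
    search-best fac c eq = subst (Best (tables fac c)) (sym search≡) best
      where
      search≡ : search ≡ foldl chooseBetter [] (tables fac c)
      search≡ = trans (cong (λ T → walk ks T [] chooseBetter)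
                        (trans (cong (foldl nextTable table₀) eq) (reverse-foldl nextTable table₀ (tabulate λ i → site d (fac i) (c i)))))
                      (walk-foldl ks (tables fac c) [] chooseBetter (tables-length fac c))
      best : Best (tables fac c) (foldl chooseBetter [] (tables fac c))
      best with choose-from (tables fac c) [] (inj₁ refl)
      ... | inj₁ (p , _ , below) = inj₁ (p , below)
      ... | inj₂ (e , p , inj₂ (i , le) , _ , least) = inj₂ (e , p , i , le , least)

-- From table entries to assignments in whole units

∑-zero⁻ : ∀ {n} (x : Fin n → ℕ) → ∑ x ≡ 0 → ∀ j → x j ≡ 0
∑-zero⁻ x eq zero    = m+n≡0⇒m≡0 (x zero) eq
∑-zero⁻ x eq (suc j) = ∑-zero⁻ (x ∘ suc) (m+n≡0⇒n≡0 (x zero) eq) j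

∑-zero⁺ : ∀ {n} (x : Fin n → ℕ) → (∀ j → x j ≡ 0) → ∑ x ≡ 0
∑-zero⁺ {zero}  x p = refl
∑-zero⁺ {suc n} x p rewrite p zero = ∑-zero⁺ (x ∘ suc) (p ∘ suc)

if₀ : Bool → ℕ → ℕ
if₀ b k = if b then k else 0

isOpen : ℕ → El FacTy → Bool
isOpen M (f , zero  , cap) = f ℕ.≤ᵇ M
isOpen M (f , suc _ , cap) = false

facilityCost : ∀ {n} → El FacTy → (Fin n → ℕ∞) → Bool → (Fin n → ℕ) → ℕ
facilityCost fac c o x = if₀ o (proj₁ fac) + ∑ λ j → value (c j) * x j

record Assignment {m n} (d : Fin n → ℕ) (fac : Fin m → El FacTy) (c : Fin m → Fin n → ℕ∞)
                  (t : ℕ) (out : El OutTy) : Set where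
  field
    o        : Fin m → Bool
    x        : Fin m → Fin n → ℕ
    out-eq   : out ≡ (tabulate (bit ∘ o) , tabulate λ i → tabulate λ j → (0 , x i j) , d j)
    signs    : ∀ i → o i ≡ true → proj₁ (proj₂ (fac i)) ≡ 0
    caps     : ∀ i → o i ≡ true → ∑ (x i) ≤ proj₂ (proj₂ (fac i))
    closed   : ∀ i j → o i ≡ false → x i j ≡ 0
    infinite : ∀ i j → c i j ≡ ⊤⁺ → x i j ≡ 0
    filled   : ∀ j → ∑ (λ i → x i j) ≡ fill d j t

  totalCost : ℕ
  totalCost = ∑ λ i → facilityCost (fac i) (c i) (o i) (x i)

module _ (V : ℕ) (V>0 : 0 < V) (ks : List ℕ) (B : ℕ) (ks≤B : All (_≤ B) ks)
         (ks-complete : ∀ k → 0 < k → k ≤ B → k ∈ ks) (pre : Parameters) where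

  open Search V ks pre
  open Analysis V V>0 ks B ks≤B ks-complete pre

  module _ {n} (d : Fin n → ℕ) (R>0 : 0 < R) where

    flag-isOpen : ∀ fac b → flag fac b ≡ bit (isOpen (money b) fac)
    flag-isOpen (f , zero  , cap) b = refl
    flag-isOpen (f , suc _ , cap) b = refl

    -- A facility with budget `b` spends at most the floor of V b / R, so its cost times `R` is at
    -- most `V * b`. Rounding down is harmless here, and the budgets add up to at most `β`.
    trace-assignment : ∀ {m} (fac : Fin m → El FacTy) (c : Fin m → Fin n → ℕ∞) {β t out} →
      Trace d R>0 fac c β (t , out) →
      Σ (Assignment d fac c t out) λ A → Assignment.totalCost A * R ≤ V * β
    trace-assignment {zero} fac c (refl , refl , refl) =
      record { o = λ () ; x = λ () ; out-eq = refl ; signs = λ () ; caps = λ () ; closed = λ () ; infinite = λ ()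
             ; filled = λ j → sym (fill-zero d j) } , z≤n
    trace-assignment {suc m} fac c {β} ((t′ , flags , rows) , β′ , b , β′+b≤β , tr , refl) = assignment , spending
      where
      ih = trace-assignment (fac ∘ suc) (c ∘ suc) tr
      module A = Assignment (proj₁ ih)
      module S = Served (served-sound d R>0 (fac zero) (c zero) b t′)
      f₀ cap₀ : ℕ
      f₀   = proj₁ (fac zero)
      cap₀ = proj₂ (proj₂ (fac zero))
      o₀ : Bool
      o₀ = isOpen (money b) (fac zero)
      o : Fin (suc m) → Bool
      o zero    = o₀
      o (suc i) = A.o i
      x : Fin (suc m) → Fin n → ℕ
      x zero    = S.x
      x (suc i) = A.x i
      U≡ : branch (flag (fac zero) b) cap₀ 0 ≡ if₀ o₀ cap₀
      U≡ rewrite flag-isOpen (fac zero) b with o₀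
      ... | true  = refl
      ... | false = refl
      open⇒sign : ∀ fac₀ → isOpen (money b) fac₀ ≡ true → proj₁ (proj₂ fac₀) ≡ 0
      open⇒sign (f , zero , cap) _ = refl
      open⇒f : ∀ fac₀ → isOpen (money b) fac₀ ≡ true → proj₁ fac₀ ≤ money b
      open⇒f (f , zero , cap) eq = ≤ᵇ⇒≤ f (money b) (subst Data.Bool.T (sym eq) tt)
      total≤ : S.total ≤ if₀ o₀ cap₀
      total≤ = ≤-trans S.within (≤-reflexive U≡)
      closed₀ : o₀ ≡ false → ∀ j → S.x j ≡ 0
      closed₀ eq = ∑-zero⁻ S.x (trans S.total-eq (n≤0⇒n≡0 (subst (λ v → S.total ≤ if₀ v cap₀) eq total≤)))
      assignment : Assignment d fac c (reached (served (site d (fac zero) (c zero)) b t′)) _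
      assignment = record
        { o = o ; x = x
        ; out-eq = cong₂ _,_
            (cong₂ _∷_ (flag-isOpen (fac zero) b) (cong proj₁ A.out-eq))
            (cong₂ _∷_ S.fractions (cong proj₂ A.out-eq))
        ; signs = λ { zero eq → open⇒sign (fac zero) eq ; (suc i) eq → A.signs i eq }
        ; caps = λ { zero eq → ≤-trans (≤-reflexive S.total-eq) (subst (λ v → S.total ≤ if₀ v cap₀) eq total≤)
                   ; (suc i) eq → A.caps i eq }
        ; closed = λ { zero j eq → closed₀ eq j ; (suc i) j eq → A.closed i j eq }
        ; infinite = λ { zero j eq → S.infinite j eq ; (suc i) j eq → A.infinite i j eq }
        ; filled = λ j → trans (cong (S.x j +_) (A.filled j))
            (trans (+-comm (S.x j) _) (trans (S.filled j) (cong (fill d j) (sym S.reached-eq))))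
        }
      spent≤ : S.spent ≤ money b ∸ f₀
      spent≤ = ≤-trans (m≤m+n S.spent _) (≤-reflexive S.moneyLeft-eq)
      cost₀≤ : ∀ v → o₀ ≡ v → if₀ v f₀ + ∑ (λ j → value (c zero j) * S.x j) ≤ money b
      cost₀≤ true eq = ≤-trans (+-monoʳ-≤ f₀ (≤-trans (≤-reflexive S.spent-eq) spent≤))
        (≤-reflexive (m+[n∸m]≡n (open⇒f (fac zero) eq)))
      cost₀≤ false eq rewrite ∑-zero⁺ (λ j → value (c zero j) * S.x j)
        (λ j → trans (cong (value (c zero j) *_) (closed₀ eq j)) (*-zeroʳ (value (c zero j)))) = z≤n
      spending : Assignment.totalCost assignment * R ≤ V * β
      spending = begin
        (facilityCost (fac zero) (c zero) o₀ S.x + A.totalCost) * R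
          ≡⟨ *-distribʳ-+ R (facilityCost (fac zero) (c zero) o₀ S.x) A.totalCost ⟩
        facilityCost (fac zero) (c zero) o₀ S.x * R + A.totalCost * R
          ≤⟨ +-mono-≤ (≤-trans (*-monoˡ-≤ R (cost₀≤ o₀ refl)) (quot-* (V * b) R)) (proj₂ ih) ⟩
        V * b + V * β′   ≡⟨ sym (*-distribˡ-+ V b β′) ⟩
        V * (b + β′)     ≤⟨ *-monoʳ-≤ V (≤-trans (≤-reflexive (+-comm b β′)) β′+b≤β) ⟩
        V * β            ∎
        where open ≤-Reasoning

-- Doubling guesses: consecutive ones differ by a factor of about 2, up to U.
Doubling : ℕ → ℕ → List ℕ → Set
Doubling U p []       = U ≤ p
Doubling U p (V ∷ Vs) = 0 < V × V ≤ 2 * p + 1 × Doubling U V Vs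

-- Guessing the optimal cost

module Guessing {m n} (d : Fin n → ℕ) (fac : Fin m → El FacTy) (c : Fin m → Fin n → ℕ∞)
                (ks : List ℕ) (B : ℕ) (ks≤B : All (_≤ B) ks)
                (ks-complete : ∀ k → 0 < k → k ≤ B → k ∈ ks) (pre : Parameters)
                (E : ℕ) (E>0 : 0 < E)
                (R-eq : proj₁ (proj₂ (proj₂ pre)) ≡ 2 * suc m * E)
                (B-eq : B ≡ 2 * suc m * E + suc m)
                (D-eq : proj₁ (proj₂ (proj₂ (proj₂ pre))) ≡ ∑ d)
                (sites-eq : proj₂ (proj₂ (proj₂ (proj₂ pre))) ≡ reverse (tabulate λ i → site d (fac i) (c i)))
                where

  R : ℕ
  R = proj₁ (proj₂ (proj₂ pre))

  R>0 : 0 < R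
  R>0 = ≤-trans (*-mono-≤ {1} {2 * suc m} {1} {E} (s≤s z≤n) E>0) (≤-reflexive (sym R-eq))

  PlanOf : ℕ → Set
  PlanOf z = ∃ λ y → ∃ λ g → Plan d fac c y g × ∑ y ≡ ∑ d × ∑ g ≡ z

  Good : El OutTy → Set
  Good out = ∃ λ t → ∑ d ≤ t × Σ (Assignment d fac c t out) λ A →
               ∀ z → PlanOf z → Assignment.totalCost A * E ≤ z * (1 + E)

  continue : List Entry → ℕ → List Entry
  continue found V = uncons found (Search.search V ks pre) λ _ _ → found

  continue-found : ∀ e Vs → foldl continue (e ∷ []) Vs ≡ e ∷ []
  continue-found e []       = refl
  continue-found e (V ∷ Vs) = continue-found e Vs

  module _ (V : ℕ) (V>0 : 0 < V) where

    open Analysis V V>0 ks B ks≤B ks-complete pre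

    ∑-share : ∀ {k} (g : Fin k → ℕ) → ∑ (share d R>0 ∘ g) * V ≤ k * V + ∑ g * R
    ∑-share {zero}  g = z≤n
    ∑-share {suc k} g = begin
      (share d R>0 (g zero) + ∑ (share d R>0 ∘ g ∘ suc)) * V   ≡⟨ *-distribʳ-+ V (share d R>0 (g zero)) _ ⟩
      share d R>0 (g zero) * V + ∑ (share d R>0 ∘ g ∘ suc) * V ≤⟨ +-mono-≤ (share-bound d R>0 (g zero)) (∑-share (g ∘ suc)) ⟩
      (V + g zero * R) + (k * V + ∑ (g ∘ suc) * R)             ≡⟨ regroup V (g zero * R) (k * V) _ ⟩
      (V + k * V) + (g zero * R + ∑ (g ∘ suc) * R)             ≡⟨ cong (V + k * V +_) (sym (*-distribʳ-+ R (g zero) _)) ⟩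
      (V + k * V) + (g zero + ∑ (g ∘ suc)) * R                 ∎
      where
      open ≤-Reasoning
      regroup : ∀ a b c e → (a + b) + (c + e) ≡ (a + c) + (b + e)
      regroup = solve-∀

    planKey-bound : ∀ (g : Fin m → ℕ) → (1 + ∑ (share d R>0 ∘ g)) * V ≤ suc m * V + ∑ g * R
    planKey-bound g = ≤-trans (+-monoʳ-≤ V (∑-share g)) (≤-reflexive (sym (+-assoc V (m * V) (∑ g * R))))

    -- The origin of `B`: a plan of cost at most `V` takes `R` units for its cost and one for each
    -- of the m + 1 roundings.
    planKey≤B : ∀ (g : Fin m → ℕ) → ∑ g ≤ V → 1 + ∑ (share d R>0 ∘ g) ≤ B
    planKey≤B g z≤V = *-cancelʳ-≤ _ _ V ⦃ ℕ.>-nonZero V>0 ⦄ (begin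
      (1 + ∑ (share d R>0 ∘ g)) * V  ≤⟨ planKey-bound g ⟩
      suc m * V + ∑ g * R            ≤⟨ +-monoʳ-≤ (suc m * V) (*-monoˡ-≤ R z≤V) ⟩
      suc m * V + V * R              ≡⟨ trans (+-comm (suc m * V) (V * R)) (cong (_+ suc m * V) (*-comm V R)) ⟩
      R * V + suc m * V              ≡⟨ sym (*-distribʳ-+ V R (suc m)) ⟩
      (R + suc m) * V                ≡⟨ cong (_* V) (trans (cong (_+ suc m) R-eq) (sym B-eq)) ⟩
      B * V                          ∎)
      where open ≤-Reasoning

    -- The rounding loses at most V / 2E.
    rounding : ∀ κ z → κ * R ≤ suc m * V + z * R → κ * (2 * E) ≤ V + z * (2 * E)
    rounding κ z le = *-cancelˡ-≤ (suc m) (begin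
      suc m * (κ * (2 * E))          ≡⟨ eq₁ (suc m) κ E ⟩
      κ * (2 * suc m * E)            ≡⟨ cong (κ *_) (sym R-eq) ⟩
      κ * R                          ≤⟨ le ⟩
      suc m * V + z * R              ≡⟨ cong (λ r → suc m * V + z * r) R-eq ⟩
      suc m * V + z * (2 * suc m * E) ≡⟨ eq₂ (suc m) V z E ⟩
      suc m * (V + z * (2 * E))      ∎)
      where
      open ≤-Reasoning
      eq₁ : ∀ a k e → a * (k * (2 * e)) ≡ k * (2 * a * e)
      eq₁ = solve-∀
      eq₂ : ∀ a v z e → a * v + z * (2 * a * e) ≡ a * (v + z * (2 * e))
      eq₂ = solve-∀

  -- Here `p` is the failed guess before `V`, or 0. In the first case `V ≤ 1`, the loss V / 2E is
  -- below 1, and integrality gives `κ ≤ z`. In the second `V ≤ 2 * p + 1 < 2 * z`, so that the loss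
  -- is at most z / E.
  approximation : ∀ p V κ z → V ≤ 2 * p + 1 → p ≡ 0 ⊎ p < z → κ * (2 * E) ≤ V + z * (2 * E) → κ * E ≤ z * (1 + E)
  approximation p V κ z V≤ (inj₁ refl) le with κ ≤? z
  ... | yes κ≤z = *-mono-≤ κ≤z (n≤1+n E)
  ... | no κ≰z = ⊥-elim (<⇒≱ (s≤s (s≤s z≤n)) (+-cancelʳ-≤ (z * (2 * E)) 2 1 (begin
    2 + z * (2 * E)         ≤⟨ +-monoˡ-≤ (z * (2 * E)) (*-monoʳ-≤ 2 E>0) ⟩
    2 * E + z * (2 * E)     ≤⟨ *-monoˡ-≤ (2 * E) (≰⇒> κ≰z) ⟩
    κ * (2 * E)             ≤⟨ le ⟩
    V + z * (2 * E)         ≤⟨ +-monoˡ-≤ (z * (2 * E)) V≤ ⟩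
    1 + z * (2 * E)         ∎)))
    where open ≤-Reasoning
  approximation p V κ z V≤ (inj₂ p<z) le = *-cancelˡ-≤ 2 (begin
    2 * (κ * E)             ≡⟨ eq₁ κ E ⟩
    κ * (2 * E)             ≤⟨ le ⟩
    V + z * (2 * E)         ≤⟨ +-monoˡ-≤ (z * (2 * E)) (≤-trans V≤ (≤-trans (≤-trans (≤-reflexive (+-comm (2 * p) 1)) (n≤1+n _)) (≤-reflexive (sym (*-suc 2 p))))) ⟩
    2 * suc p + z * (2 * E) ≤⟨ +-monoˡ-≤ (z * (2 * E)) (*-monoʳ-≤ 2 p<z) ⟩
    2 * z + z * (2 * E)     ≡⟨ eq₂ z E ⟩
    2 * (z * (1 + E))       ∎)
    where
    open ≤-Reasoning
    eq₁ : ∀ k e → 2 * (k * e) ≡ k * (2 * e)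
    eq₁ = solve-∀
    eq₂ : ∀ z e → 2 * z + z * (2 * e) ≡ 2 * (z * (1 + e))
    eq₂ = solve-∀

  -- A plan of cost at most `V` would show up in the table for `V`, so failure at `V` means that all
  -- plans cost more. The guesses cannot all fail, since they end at `U` and some plan costs at most
  -- `U`.
  guesses-good : ∀ U → 0 < U → (∃ λ z → z ≤ U × PlanOf z) → ∀ p Vs → Doubling U p Vs →
    (∀ z → PlanOf z → p ≡ 0 ⊎ p < z) → ∃ λ e → foldl continue [] Vs ≡ e ∷ [] × Good (proj₂ (proj₂ e))
  guesses-good U U>0 (z , z≤U , plan) p [] U≤p above with above z plan
  ... | inj₁ refl = ⊥-elim (<⇒≱ U>0 U≤p)
  ... | inj₂ p<z  = ⊥-elim (<⇒≱ p<z (≤-trans z≤U U≤p))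
  guesses-good U U>0 some p (V ∷ Vs) (V>0 , V≤ , doubling) above
    with Analysis.search-best V V>0 ks B ks≤B ks-complete pre d R>0 fac c sites-eq
  ... | inj₁ (eq , below) rewrite eq = guesses-good U U>0 some V Vs doubling λ { z plan → inj₂ (above′ z plan) }
    where
    open Analysis V V>0 ks B ks≤B ks-complete pre
    above′ : ∀ z → PlanOf z → V < z
    above′ z (y , g , plan , ∑y≡ , ∑g≡z) with z ≤? V
    ... | no z≰V = ≰⇒> z≰V
    ... | yes z≤V with tables-complete d R>0 fac c y g plan (planKey≤B V V>0 g (≤-trans (≤-reflexive ∑g≡z) z≤V))
    ...   | e , i , _ , reach = ⊥-elim (<⇒≱ (below i) (≤-trans (≤-reflexive (trans D-eq (sym ∑y≡))) reach))
  ... | inj₂ (e , eq , i , D≤ , least) =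
    e , trans (cong (λ l → foldl continue l Vs) eq) (continue-found e Vs) ,
    position e , ≤-trans (≤-reflexive (sym D-eq)) D≤ , proj₁ assigned ,
    λ z plan → approximation p V (Assignment.totalCost (proj₁ assigned)) z V≤ (above z plan) (rounding V V>0 (Assignment.totalCost (proj₁ assigned)) z (bound z plan))
    where
    open Analysis V V>0 ks B ks≤B ks-complete pre
    sound = tables-sound d R>0 fac c i
    assigned = trace-assignment V V>0 ks B ks≤B ks-complete pre d R>0 fac c (proj₂ sound)
    spent : Assignment.totalCost (proj₁ assigned) * R ≤ key e * V
    spent = ≤-trans (proj₂ assigned) (≤-reflexive (*-comm V (key e)))
    bound : ∀ z → PlanOf z → Assignment.totalCost (proj₁ assigned) * R ≤ suc m * V + z * R
    bound z (y , g , plan , ∑y≡ , refl) with ∑ g ≤? V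
    -- A guess below the optimum may succeed as well. Then the size of the key is enough: `B` units
    -- are worth `V` plus the m + 1 roundings.
    ... | no z≰V = ≤-trans spent (≤-trans (*-monoˡ-≤ V (proj₁ sound)) (≤-trans (≤-reflexive B*V)
                     (+-monoʳ-≤ (suc m * V) (*-monoˡ-≤ R (<⇒≤ (≰⇒> z≰V))))))
      where
      eq₃ : ∀ r a v → (r + a) * v ≡ a * v + v * r
      eq₃ = solve-∀
      B*V : B * V ≡ suc m * V + V * R
      B*V = trans (cong (_* V) (trans B-eq (cong (_+ suc m) (sym R-eq)))) (eq₃ R (suc m) V)
    ... | yes z≤V with tables-complete d R>0 fac c y g plan (planKey≤B V V>0 g z≤V)
    ...   | e′ , j , key≡ , reach = ≤-trans spent (≤-trans (*-monoˡ-≤ V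
              (≤-trans (least j (≤-trans (≤-reflexive (trans D-eq (sym ∑y≡))) reach)) (≤-reflexive key≡)))
              (planKey-bound V V>0 g))

-- Monge costs: consecutive blocks are optimal

≤⁺-reflexive : ∀ {a b} → a ≡ b → a ≤⁺ b
≤⁺-reflexive {[ a ]} refl = [ ≤-refl ]
≤⁺-reflexive {⊤⁺}    refl = ⊤⁺ ≤⊤⁺

≤⁺-transitive : ∀ {a b c} → a ≤⁺ b → b ≤⁺ c → a ≤⁺ c
≤⁺-transitive = ≤⁺-trans ≤-trans

+∞-mono : ∀ {a b c e} → a ≤⁺ b → c ≤⁺ e → a +∞ c ≤⁺ b +∞ e
+∞-mono [ p ]     [ q ]     = [ +-mono-≤ p q ]
+∞-mono [ p ]     (_ ≤⊤⁺)   = _ ≤⊤⁺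
+∞-mono (_ ≤⊤⁺)   q         = _ ≤⊤⁺

+∞-monoˡ : ∀ {a b} c → a ≤⁺ b → a +∞ c ≤⁺ b +∞ c
+∞-monoˡ c p = +∞-mono p (≤⁺-reflexive refl)

+∞-monoʳ : ∀ {a b} c → a ≤⁺ b → c +∞ a ≤⁺ c +∞ b
+∞-monoʳ c p = +∞-mono (≤⁺-reflexive refl) p

∑-cong : ∀ {n} {x y : Fin n → ℕ} → (∀ j → x j ≡ y j) → ∑ x ≡ ∑ y
∑-cong h = sum-cong-≗ h

-- The Monge property in reversed order: units are counted from the last client, so the client of
-- `q` does not come before that of `q′`.
MongeUnits : ∀ {m} → (Fin m → ℕ → ℕ∞) → Set
MongeUnits φ = ∀ {h i} → h Fin.< i → ∀ {q q′} → q ≤ q′ → φ i q +∞ φ h q′ ≤⁺ φ h q +∞ φ i q′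

-- One unit varies and the other is fixed: `a` and `a′` will be the costs of a unit of client
-- `zero`, compared with units of the clients after it.
ψ-monge₁ : ∀ {n} (d : Fin n → ℕ) (c c′ : Fin n → ℕ∞) a a′ → (∀ k → c′ k +∞ a ≤⁺ c k +∞ a′) →
           ∀ q → ψ d c′ q +∞ a ≤⁺ ψ d c q +∞ a′
ψ-monge₁ {zero}  d c c′ a a′ h q = ⊤⁺ ≤⊤⁺
ψ-monge₁ {suc n} d c c′ a a′ h q with q <? ∑ (d ∘ suc) | q <? ∑ d
... | yes p | _     rewrite ψ-tail d c p | ψ-tail d c′ p = ψ-monge₁ (d ∘ suc) (c ∘ suc) (c′ ∘ suc) a a′ (h ∘ suc) q
... | no ¬p | yes p rewrite ψ-head d c (≮⇒≥ ¬p) p | ψ-head d c′ (≮⇒≥ ¬p) p = h zero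
... | no ¬p | no ¬q rewrite ψ-out d c (≮⇒≥ ¬q) = _ ≤⊤⁺

ψ-monge : ∀ {n} (d : Fin n → ℕ) (c c′ : Fin n → ℕ∞) →
          (∀ {j k} → j Fin.< k → c j +∞ c′ k ≤⁺ c k +∞ c′ j) →
          ∀ {q q′} → q ≤ q′ → ψ d c′ q +∞ ψ d c q′ ≤⁺ ψ d c q +∞ ψ d c′ q′
ψ-monge {zero}  d c c′ h {q} {q′} le = _ ≤⊤⁺
ψ-monge {suc n} d c c′ h {q} {q′} le with q′ <? ∑ (d ∘ suc)
... | yes p rewrite ψ-tail d c p | ψ-tail d c′ p | ψ-tail d c (≤-<-trans le p) | ψ-tail d c′ (≤-<-trans le p) =
  ψ-monge (d ∘ suc) (c ∘ suc) (c′ ∘ suc) (λ lt → h (s≤s lt)) le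
... | no ¬p with q′ <? ∑ d
...   | no ¬q rewrite ψ-out d c′ (≮⇒≥ ¬q) = ≤⁺-transitive (_ ≤⊤⁺) (≤⁺-reflexive (+∞-comm ⊤⁺ (ψ d c q)))
...   | yes r with q <? ∑ (d ∘ suc)
...     | yes p rewrite ψ-head d c (≮⇒≥ ¬p) r | ψ-head d c′ (≮⇒≥ ¬p) r | ψ-tail d c p | ψ-tail d c′ p =
  ψ-monge₁ (d ∘ suc) (c ∘ suc) (c′ ∘ suc) (c zero) (c′ zero)
    (λ k → ≤⁺-transitive (≤⁺-reflexive (+∞-comm (c′ (suc k)) (c zero))) (h (s≤s z≤n))) q
...     | no ¬s rewrite ψ-head d c (≮⇒≥ ¬p) r | ψ-head d c′ (≮⇒≥ ¬p) r
                      | ψ-head d c (≮⇒≥ ¬s) (≤-<-trans le r) | ψ-head d c′ (≮⇒≥ ¬s) (≤-<-trans le r) =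
  ≤⁺-reflexive (+∞-comm (c′ zero) (c zero))

-- The cost of serving consecutive blocks of R i units, the first of them by the last facility.
blockCost : ∀ {m} → (Fin m → ℕ → ℕ∞) → (Fin m → ℕ) → ℕ∞
blockCost {zero}  φ R = [ 0 ]
blockCost {suc m} φ R = blockCost (φ ∘ suc) (R ∘ suc) +∞ seg (φ zero) (∑ (R ∘ suc)) (R zero)

bump : ∀ {m} → Fin m → (Fin m → ℕ) → Fin m → ℕ
bump zero    R zero    = suc (R zero)
bump zero    R (suc i) = R (suc i)
bump (suc k) R zero    = R zero
bump (suc k) R (suc i) = bump k (R ∘ suc) i

∑-bump : ∀ {m} (k : Fin m) R → ∑ (bump k R) ≡ suc (∑ R)
∑-bump zero    R = refl
∑-bump (suc k) R = trans (cong (R zero +_) (∑-bump k (R ∘ suc))) (+-suc (R zero) _)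

blockCost-cong : ∀ {m} {φ χ : Fin m → ℕ → ℕ∞} {R S : Fin m → ℕ} → (∀ i → R i ≡ S i) →
                 (∀ i u → u < ∑ R → φ i u ≡ χ i u) → blockCost φ R ≡ blockCost χ S
blockCost-cong {zero} p h = refl
blockCost-cong {suc m} {φ} {χ} {R} {S} p h rewrite sym (p zero) | sym (∑-cong (p ∘ suc)) =
  cong₂ _+∞_ (blockCost-cong (p ∘ suc) λ i u lt → h (suc i) u (<-≤-trans lt (m≤n+m _ (R zero))))
    (seg-cong (∑ (R ∘ suc)) (R zero) λ u _ lt → h zero u (<-≤-trans lt (≤-reflexive (+-comm _ (R zero)))))

-- The unit served at cost `χ` moves past the block of `φ` by exchanges of neighbouring units, each
-- of them one Monge inequality.
seg-shift : ∀ {φ χ : ℕ → ℕ∞} → (∀ {q q′} → q ≤ q′ → χ q +∞ φ q′ ≤⁺ φ q +∞ χ q′) →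
            ∀ s r → χ s +∞ seg φ (suc s) r ≤⁺ seg φ s r +∞ χ (s + r)
seg-shift {φ} {χ} monge s zero = ≤⁺-reflexive (trans (+∞-comm (χ s) [ 0 ]) (cong (λ u → [ 0 ] +∞ χ u) (sym (+-identityʳ s))))
seg-shift {φ} {χ} monge s (suc r) rewrite +-suc s r =
  ≤⁺-transitive (≤⁺-reflexive (sym (+∞-assoc (χ s) (seg φ (suc s) r) _)))
    (≤⁺-transitive (+∞-monoˡ _ (seg-shift monge s r))
      (≤⁺-transitive (≤⁺-reflexive (+∞-assoc (seg φ s r) _ _))
        (≤⁺-transitive (+∞-monoʳ (seg φ s r) (monge (n≤1+n (s + r))))
          (≤⁺-reflexive (sym (+∞-assoc (seg φ s r) _ _))))))

-- Exchange argument: a further unit at the end served by facility k can be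
-- moved to the block of k, shifting the blocks of the facilities before k.
blockCost-bump : ∀ {m} (φ : Fin m → ℕ → ℕ∞) → MongeUnits φ → ∀ k R →
                 blockCost φ (bump k R) ≤⁺ blockCost φ R +∞ φ k (∑ R)
blockCost-bump φ monge zero R =
  ≤⁺-reflexive (trans (sym (+∞-assoc (blockCost (φ ∘ suc) (R ∘ suc)) _ _))
    (cong (λ u → (blockCost (φ ∘ suc) (R ∘ suc) +∞ seg (φ zero) (∑ (R ∘ suc)) (R zero)) +∞ φ zero u) (+-comm (∑ (R ∘ suc)) (R zero))))
blockCost-bump φ monge (suc k) R rewrite ∑-bump k (R ∘ suc) =
  ≤⁺-transitive (+∞-monoˡ _ (blockCost-bump (φ ∘ suc) (λ lt → monge (s≤s lt)) k (R ∘ suc)))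
    (≤⁺-transitive (≤⁺-reflexive (+∞-assoc B _ _))
      (≤⁺-transitive (+∞-monoʳ B (seg-shift (monge (s≤s z≤n)) S (R zero)))
        (≤⁺-reflexive (trans (sym (+∞-assoc B _ _)) (cong (λ u → (B +∞ seg (φ zero) S (R zero)) +∞ φ (suc k) u) (+-comm S (R zero)))))))
  where
  B : ℕ∞
  B = blockCost (φ ∘ suc) (R ∘ suc)
  S : ℕ
  S = ∑ (R ∘ suc)

pick : ∀ {m} (w : Fin m → ℕ) {K} → ∑ w ≡ suc K → ∃ λ i → ∃ λ w′ → ∀ j → w j ≡ bump i w′ j
pick {suc m} w eq with w zero in e
... | suc k = zero , (λ { zero → k ; (suc j) → w (suc j) }) , λ { zero → e ; (suc j) → refl }
... | zero with pick (w ∘ suc) eq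
...   | i , w′ , h = suc i , (λ { zero → 0 ; (suc j) → w′ j }) , λ { zero → e ; (suc j) → h j }

bump-+ : ∀ {m} (k : Fin m) (w R : Fin m → ℕ) j → bump k w j + R j ≡ bump k (λ i → w i + R i) j
bump-+ zero    w R zero    = refl
bump-+ zero    w R (suc j) = refl
bump-+ (suc k) w R zero    = refl
bump-+ (suc k) w R (suc j) = bump-+ k (w ∘ suc) (R ∘ suc) j

∑-*-bump : ∀ {m} (v : Fin m → ℕ) k w → ∑ (λ i → v i * bump k w i) ≡ ∑ (λ i → v i * w i) + v k
∑-*-bump v zero w rewrite *-suc (v zero) (w zero) =
  trans (+-assoc (v zero) _ _) (+-comm (v zero) _)
∑-*-bump v (suc k) w rewrite ∑-*-bump (v ∘ suc) k (w ∘ suc) = sym (+-assoc (v zero * w zero) _ _)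

bump-pos : ∀ {m} (k : Fin m) w → bump k w k ≢ 0
bump-pos zero    w ()
bump-pos (suc k) w = bump-pos k (w ∘ suc)

bump-≢0 : ∀ {m} (k : Fin m) w i → w i ≢ 0 → bump k w i ≢ 0
bump-≢0 zero    w zero    p = λ ()
bump-≢0 zero    w (suc i) p = p
bump-≢0 (suc k) w zero    p = p
bump-≢0 (suc k) w (suc i) p = bump-≢0 k (w ∘ suc) i p

-- The units of one client are appended one by one, each for some facility that still has a share in
-- `w`. The order is arbitrary, since facility i pays `v i` for any unit in the range of this
-- client.
blockCost-column : ∀ {m} (φ : Fin m → ℕ → ℕ∞) → MongeUnits φ → (v R : Fin m → ℕ) → ∀ K w → ∑ w ≡ K →
  (∀ i → w i ≢ 0 → ∀ u → ∑ R ≤ u → u < K + ∑ R → φ i u ≡ [ v i ]) →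
  blockCost φ (λ i → w i + R i) ≤⁺ blockCost φ R +∞ [ ∑ (λ i → v i * w i) ]
blockCost-column φ monge v R zero w eq h =
  ≤⁺-reflexive (trans (blockCost-cong (λ i → cong (_+ R i) (w≡0 i)) (λ _ _ _ → refl))
    (trans (sym (+∞-identityʳ _)) (cong (λ k → blockCost φ R +∞ [ k ])
      (sym (∑-zero⁺ (λ i → v i * w i) λ i → trans (cong (v i *_) (w≡0 i)) (*-zeroʳ (v i)))))))
  where
  w≡0 : ∀ i → w i ≡ 0
  w≡0 = ∑-zero⁻ w eq
blockCost-column φ monge v R (suc K) w eq h with pick w eq
... | k , w′ , w≡ =
  ≤⁺-transitive (≤⁺-reflexive (blockCost-cong (λ i → trans (cong (_+ R i) (w≡ i)) (bump-+ k w′ R i)) (λ _ _ _ → refl)))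
    (≤⁺-transitive (blockCost-bump φ monge k (λ i → w′ i + R i))
      (≤⁺-transitive (+∞-mono ih (≤⁺-reflexive last))
        (≤⁺-reflexive (trans (+∞-assoc (blockCost φ R) _ _)
          (cong (λ t → blockCost φ R +∞ [ t ]) (sym (trans (∑-cong λ i → cong (v i *_) (w≡ i)) (∑-*-bump v k w′))))))))
  where
  ∑w′ : ∑ w′ ≡ K
  ∑w′ = suc-injective (trans (sym (∑-bump k w′)) (trans (sym (∑-cong w≡)) eq))
  total : ∑ (λ i → w′ i + R i) ≡ K + ∑ R
  total = trans (∑-distrib-+ w′ R) (cong (_+ ∑ R) ∑w′)
  ih = blockCost-column φ monge v R K w′ ∑w′ λ i p u q r →
         h i (λ e → bump-≢0 k w′ i p (trans (sym (w≡ i)) e)) u q (<-≤-trans r (n≤1+n _))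
  last : φ k (∑ (λ i → w′ i + R i)) ≡ [ v k ]
  last = h k (λ e → bump-pos k w′ (trans (sym (w≡ k)) e)) _
           (≤-trans (m≤n+m (∑ R) K) (≤-reflexive (sym total))) (s≤s (≤-reflexive total))

-- Hoffman's theorem that a corner rule solves the transportation problem with Monge costs: the
-- blocks have the row sums of `W`. Induction on the clients, with client `zero`, who owns the
-- topmost units, added last.
blockCost-optimal : ∀ {m n} (e : Fin n → ℕ) (c : Fin m → Fin n → ℕ∞) (W : Fin m → Fin n → ℕ) →
  (∀ {h i j k} → h Fin.< i → j Fin.< k → c h j +∞ c i k ≤⁺ c h k +∞ c i j) →
  (∀ j → ∑ (λ i → W i j) ≡ e j) → (∀ i j → c i j ≡ ⊤⁺ → W i j ≡ 0) →
  blockCost (λ i → ψ e (c i)) (λ i → ∑ (W i)) ≤⁺ [ ∑ (λ i → ∑ λ j → value (c i j) * W i j) ]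
blockCost-optimal {m} {zero} e c W monge served finite =
  ≤⁺-reflexive (trans (zeros m) (cong [_] (sym (∑-zero⁺ {m} (λ _ → 0) λ _ → refl))))
  where
  zeros : ∀ m {φ : Fin m → ℕ → ℕ∞} → blockCost φ (λ _ → 0) ≡ [ 0 ]
  zeros zero    = refl
  zeros (suc m) = cong (_+∞ [ 0 ]) (zeros m)
blockCost-optimal {m} {suc n} e c W monge served finite =
  ≤⁺-transitive (blockCost-column φ unitMonge v R′ (e zero) (λ i → W i zero) (served zero) inRange)
    (≤⁺-transitive (+∞-monoˡ _ (≤⁺-transitive (≤⁺-reflexive tailEq) ih))
      (≤⁺-reflexive (cong [_] (trans (+-comm (∑ (λ i → ∑ λ j → value (c i (suc j)) * W i (suc j))) (∑ λ i → v i * W i zero)) (sym (∑-distrib-+ (λ i → v i * W i zero) _))))))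
  where
  φ : Fin m → ℕ → ℕ∞
  φ i = ψ e (c i)
  v R′ : Fin m → ℕ
  v  i = value (c i zero)
  R′ i = ∑ (W i ∘ suc)
  unitMonge : MongeUnits φ
  unitMonge {h} {i} lt = ψ-monge e (c h) (c i) (monge lt)
  ∑R′ : ∑ R′ ≡ ∑ (e ∘ suc)
  ∑R′ = trans (∑-comm (λ i j → W i (suc j))) (∑-cong (served ∘ suc))
  tailEq : blockCost φ R′ ≡ blockCost (λ i → ψ (e ∘ suc) (c i ∘ suc)) R′
  tailEq = blockCost-cong (λ _ → refl) λ i u lt → ψ-tail e (c i) (<-≤-trans lt (≤-reflexive ∑R′))
  ih = blockCost-optimal (e ∘ suc) (λ i → c i ∘ suc) (λ i → W i ∘ suc) (λ p q → monge p (s≤s q))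
         (served ∘ suc) (λ i j → finite i (suc j))
  inRange : ∀ i → W i zero ≢ 0 → ∀ u → ∑ R′ ≤ u → u < e zero + ∑ R′ → φ i u ≡ [ v i ]
  inRange i p u q r = trans (ψ-head e (c i) (≤-trans (≤-reflexive (sym ∑R′)) q) (<-≤-trans r (≤-reflexive (cong (e zero +_) ∑R′))))
                            (fin (c i zero) refl)
    where
    fin : ∀ a → c i zero ≡ a → a ≡ [ value a ]
    fin [ _ ] _  = refl
    fin ⊤⁺    eq = ⊥-elim (p (finite i zero eq))

-- Rounding the ends of blocks to whole units

segN : (ℕ → ℕ) → ℕ → ℕ → ℕ
segN f s zero    = 0
segN f s (suc k) = segN f s k + f (s + k)

below : (ℕ → ℕ) → ℕ → ℕ
below f zero    = 0
below f (suc k) = below f k + f k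

below-+ : ∀ f s k → below f (s + k) ≡ below f s + segN f s k
below-+ f s zero    = trans (cong (below f) (+-identityʳ s)) (sym (+-identityʳ _))
below-+ f s (suc k) rewrite +-suc s k | below-+ f s k = +-assoc (below f s) _ _

below-cong : ∀ {f g} k → (∀ r → r < k → f r ≡ g r) → below f k ≡ below g k
below-cong zero    h = refl
below-cong (suc k) h = cong₂ _+_ (below-cong k λ r lt → h r (<-≤-trans lt (n≤1+n k))) (h k ≤-refl)

below-zero : ∀ k → below (λ _ → 0) k ≡ 0
below-zero zero    = refl
below-zero (suc k) rewrite below-zero k = refl

below-distrib : ∀ f g k → below (λ r → f r + g r) k ≡ below f k + below g k
below-distrib f g zero    = refl
below-distrib f g (suc k) rewrite below-distrib f g k = interchange (below f k) (below g k) (f k) (g k)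
  where
  interchange : ∀ a b c d → a + b + (c + d) ≡ a + c + (b + d)
  interchange = solve-∀

-- Moving a window of length `k` by one exchanges its first term for the one after its last; both
-- sides are sums to avoid subtraction.
below-shift : ∀ (h : ℕ → ℕ) Y k → below (λ r → h (suc Y + r)) k + h Y ≡ below (λ r → h (Y + r)) k + h (Y + k)
below-shift h Y zero    = cong h (sym (+-identityʳ Y))
below-shift h Y (suc k) = begin
  below (λ r → h (suc Y + r)) k + h (suc Y + k) + h Y  ≡⟨ swapʳ _ (h (suc Y + k)) (h Y) ⟩
  below (λ r → h (suc Y + r)) k + h Y + h (suc Y + k)  ≡⟨ cong (_+ h (suc Y + k)) (below-shift h Y k) ⟩
  below (λ r → h (Y + r)) k + h (Y + k) + h (suc Y + k) ≡⟨ cong (λ q → below (λ r → h (Y + r)) k + h (Y + k) + h q) (sym (+-suc Y k)) ⟩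
  below (λ r → h (Y + r)) k + h (Y + k) + h (Y + suc k) ∎
  where
  open Relation.Binary.PropositionalEquality.≡-Reasoning
  swapʳ : ∀ a b c → a + b + c ≡ a + c + b
  swapʳ = solve-∀

below-average : ∀ g k → ∃ λ r → r < suc k × suc k * g r ≤ below g (suc k)
below-average g zero = 0 , s≤s z≤n , ≤-reflexive (+-identityʳ (g 0))
below-average g (suc k) with below-average g k
... | r , r< , le with ≤-total (g r) (g (suc k))
...   | inj₁ p = r , <-≤-trans r< (n≤1+n _) ,
                 ≤-trans (≤-reflexive (+-comm (g r) _)) (+-mono-≤ le p)
...   | inj₂ p = suc k , ≤-refl ,
                 ≤-trans (≤-reflexive (+-comm (g (suc k)) _)) (+-monoˡ-≤ _ (≤-trans (*-monoʳ-≤ (suc k) p) le))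

-- Averaging needs finite numbers, so `b` replaces infinity. A total below `b` then certifies that
-- no infinite cost is involved (`segN⇒seg`).
cap∞ : ℕ → ℕ∞ → ℕ
cap∞ b [ k ] = k
cap∞ b ⊤⁺    = b

seg⇒segN : ∀ b φ s k {x} → seg φ s k ≡ [ x ] → segN (cap∞ b ∘ φ) s k ≡ x
seg⇒segN b φ s zero    refl = refl
seg⇒segN b φ s (suc k) eq with +∞-finite _ _ eq
... | _ , _ , p , q , refl = cong₂ _+_ (seg⇒segN b φ s k p) (cong (cap∞ b) q)

segN⇒seg : ∀ b φ s k → segN (cap∞ b ∘ φ) s k < b → seg φ s k ≡ [ segN (cap∞ b ∘ φ) s k ]
segN⇒seg b φ s zero    lt = refl
segN⇒seg b φ s (suc k) lt =
  cong₂ _+∞_ (segN⇒seg b φ s k (≤-<-trans (m≤m+n _ _) lt)) (fin (φ (s + k)) (≤-<-trans (m≤n+m _ _) lt))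
  where
  fin : ∀ a → cap∞ b a < b → a ≡ [ cap∞ b a ]
  fin [ _ ] _  = refl
  fin ⊤⁺    lt = ⊥-elim (<-irrefl refl lt)

blockCostN : ∀ {m} → (Fin m → ℕ → ℕ) → (Fin m → ℕ) → ℕ
blockCostN {zero}  f R = 0
blockCostN {suc m} f R = blockCostN (f ∘ suc) (R ∘ suc) + segN (f zero) (∑ (R ∘ suc)) (R zero)

blockCost⇒N : ∀ {m} b (φ : Fin m → ℕ → ℕ∞) R {x} → blockCost φ R ≡ [ x ] → blockCostN (λ i → cap∞ b ∘ φ i) R ≡ x
blockCost⇒N {zero}  b φ R refl = refl
blockCost⇒N {suc m} b φ R eq with +∞-finite _ _ eq
... | _ , _ , p , q , refl = cong₂ _+_ (blockCost⇒N b (φ ∘ suc) (R ∘ suc) p) (seg⇒segN b (φ zero) (∑ (R ∘ suc)) (R zero) q)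

-- A unit is split into N equal parts; the part q belongs to unit q / N.
-- Rounding the ends Y of the blocks of parts to (Y + r) / N for r < N yields N
-- plans in whole units whose costs add up to the cost of the blocks of parts.
module Sampling (N-1 : ℕ) where

  N : ℕ
  N = suc N-1

  <-/ : ∀ {q k} → q < N * k → q ℕ./ N < k
  <-/ {q} {k} lt = m<n*o⇒m/o<n (<-≤-trans lt (≤-reflexive (*-comm N k)))

  ≤-/ : ∀ {q k} → N * k ≤ q → k ≤ q ℕ./ N
  ≤-/ {q} {k} le = quot-≥ k q N (s≤s z≤n) (≤-trans (≤-reflexive (*-comm k N)) le)

  ∑-scale : ∀ {n} (d : Fin n → ℕ) → ∑ (λ j → N * d j) ≡ N * ∑ d
  ∑-scale d = sym (*-distribˡ-sum N d)

  ψ-scale : ∀ {n} (d : Fin n → ℕ) c q → ψ (λ j → N * d j) c q ≡ ψ d c (q ℕ./ N)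
  ψ-scale {zero}  d c q = refl
  ψ-scale {suc n} d c q with q <? N * ∑ (d ∘ suc)
  ... | yes p = trans (ψ-tail (λ j → N * d j) c (<-≤-trans p (≤-reflexive (sym (∑-scale (d ∘ suc))))))
                  (trans (ψ-scale (d ∘ suc) (c ∘ suc) q) (sym (ψ-tail d c (<-/ p))))
  ... | no ¬p with q <? N * ∑ d
  ...   | yes r = trans (ψ-head (λ j → N * d j) c (≤-trans (≤-reflexive (∑-scale (d ∘ suc))) (≮⇒≥ ¬p)) (<-≤-trans r (≤-reflexive (sym (∑-scale d)))))
                    (sym (ψ-head d c (≤-/ (≮⇒≥ ¬p)) (<-/ r)))
  ...   | no ¬r = trans (ψ-out (λ j → N * d j) c (≤-trans (≤-reflexive (∑-scale d)) (≮⇒≥ ¬r))) (sym (ψ-out d c (≤-/ (≮⇒≥ ¬r))))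

  -- With F the partial sums of `f`, going from `Y` to `suc Y` replaces F at Y / N by F at Y / N +
  -- 1, which adds `f` at Y / N. For constant `f` = 1 this is Hermite's identity.
  below-rounded : ∀ f Y → below (λ r → below f ((Y + r) ℕ./ N)) N ≡ below (λ q → f (q ℕ./ N)) Y
  below-rounded f zero = trans (below-cong N λ r lt → cong (below f) (m<n⇒m/n≡0 lt)) (below-zero N)
  below-rounded f (suc Y) = +-cancelʳ-≡ (h Y) _ _ (begin
    below (λ r → h (suc Y + r)) N + h Y              ≡⟨ below-shift h Y N ⟩
    below (λ r → h (Y + r)) N + h (Y + N)            ≡⟨ cong₂ _+_ (below-rounded f Y) (cong (below f) next) ⟩
    below g Y + (h Y + f (Y ℕ./ N))                  ≡⟨ cong (below g Y +_) (+-comm (h Y) _) ⟩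
    below g Y + (f (Y ℕ./ N) + h Y)                  ≡⟨ sym (+-assoc (below g Y) _ _) ⟩
    below g Y + f (Y ℕ./ N) + h Y                    ∎)
    where
    open Relation.Binary.PropositionalEquality.≡-Reasoning
    h g : ℕ → ℕ
    h q = below f (q ℕ./ N)
    g q = f (q ℕ./ N)
    next : (Y + N) ℕ./ N ≡ suc (Y ℕ./ N)
    next = trans (+-distrib-/-∣ʳ Y (∣-refl {N})) (trans (cong (Y ℕ./ N +_) (n/n≡1 N)) (+-comm _ 1))

  module _ (r : ℕ) where

    end : ∀ {m} → (Fin m → ℕ) → ℕ
    end R = (∑ R + r) ℕ./ N

    end-mono : ∀ {m} (R : Fin (suc m) → ℕ) → end (R ∘ suc) ≤ end R
    end-mono R = /-monoˡ-≤ N (+-monoˡ-≤ r (m≤n+m _ (R zero)))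

    rounded : ∀ {m} → (Fin m → ℕ) → Fin m → ℕ
    rounded R zero    = end R ∸ end (R ∘ suc)
    rounded R (suc i) = rounded (R ∘ suc) i

    roundedCost : ∀ {m} → (Fin m → ℕ → ℕ) → (Fin m → ℕ) → Fin m → ℕ
    roundedCost f R zero    = segN (f zero) (end (R ∘ suc)) (end R ∸ end (R ∘ suc))
    roundedCost f R (suc i) = roundedCost (f ∘ suc) (R ∘ suc) i

    ∑-rounded : ∀ {m} (R : Fin m → ℕ) → r < N → ∑ (rounded R) ≡ end R
    ∑-rounded {zero}  R lt = sym (m<n⇒m/n≡0 lt)
    ∑-rounded {suc m} R lt rewrite ∑-rounded (R ∘ suc) lt = m∸n+n≡m (end-mono R)

    rounded-plan : ∀ {m n} (d : Fin n → ℕ) (fac : Fin m → El FacTy) (c : Fin m → Fin n → ℕ∞) (o : Fin m → Bool) R b →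
      r < N → (∀ i → o i ≡ true → proj₁ (proj₂ (fac i)) ≡ 0 × R i ≤ N * proj₂ (proj₂ (fac i))) →
      (∀ i → o i ≡ false → R i ≡ 0) → ∑ (roundedCost (λ i → cap∞ b ∘ ψ d (c i)) R) < b →
      Plan d fac c (rounded R) (λ i → if₀ (o i) (proj₁ (fac i)) + roundedCost (λ i → cap∞ b ∘ ψ d (c i)) R i)
    rounded-plan {zero}  d fac c o R b lt opens shut cheap = tt
    rounded-plan {suc m} d fac c o R b lt opens shut cheap =
      shipment (o zero) refl ,
      rounded-plan d (fac ∘ suc) (c ∘ suc) (o ∘ suc) (R ∘ suc) b lt (opens ∘ suc) (shut ∘ suc) (≤-<-trans (m≤n+m _ _) cheap)
      where
      f₀ cap₀ : ℕ
      f₀   = proj₁ (fac zero)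
      cap₀ = proj₂ (proj₂ (fac zero))
      shipment : ∀ v → o zero ≡ v → Shipment d (fac zero) (c zero) (∑ (rounded (R ∘ suc))) (rounded R zero)
                   (if₀ v f₀ + roundedCost (λ i → cap∞ b ∘ ψ d (c i)) R zero)
      shipment false eq rewrite shut zero eq = inj₁ (n∸n≡0 (end (R ∘ suc)))
      shipment true  eq rewrite ∑-rounded (R ∘ suc) lt =
        inj₂ (proj₁ (opens zero eq) , within , _ , segN⇒seg b (ψ d (c zero)) (end (R ∘ suc)) (rounded R zero) (≤-<-trans (m≤m+n _ _) cheap) , ≤-refl)
        where
        -- The same `r` is added at both ends of the block, so a length of at most N times the
        -- capacity rounds to at most the capacity.
        within : end R ∸ end (R ∘ suc) ≤ cap₀
        within = m≤n+o⇒m∸n≤o (end R) (end (R ∘ suc)) (begin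
          (R zero + ∑ (R ∘ suc) + r) ℕ./ N        ≤⟨ /-monoˡ-≤ N (+-monoˡ-≤ r (+-monoˡ-≤ _ (proj₂ (opens zero eq)))) ⟩
          (N * cap₀ + ∑ (R ∘ suc) + r) ℕ./ N      ≡⟨ cong (ℕ._/ N) (+-assoc (N * cap₀) _ r) ⟩
          (N * cap₀ + (∑ (R ∘ suc) + r)) ℕ./ N    ≡⟨ +-distrib-/-∣ˡ (∑ (R ∘ suc) + r) (m∣m*n cap₀) ⟩
          (N * cap₀) ℕ./ N + end (R ∘ suc)        ≡⟨ cong (_+ end (R ∘ suc)) (trans (cong (ℕ._/ N) (*-comm N cap₀)) (m*n/n≡m cap₀ N)) ⟩
          cap₀ + end (R ∘ suc)                    ≡⟨ +-comm cap₀ _ ⟩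
          end (R ∘ suc) + cap₀                    ∎)
          where open ≤-Reasoning

  -- The cost of a rounded block is a difference of two partial sums, and `below-rounded` adds up
  -- each of them over `r`.
  below-roundedCost : ∀ {m} (f : Fin m → ℕ → ℕ) R →
    below (λ r → ∑ (roundedCost r f R)) N ≡ blockCostN (λ i q → f i (q ℕ./ N)) R
  below-roundedCost {zero}  f R = below-zero N
  below-roundedCost {suc m} f R = begin
    below (λ r → first r + rest r) N                      ≡⟨ below-distrib first rest N ⟩
    below first N + below rest N                          ≡⟨ +-comm (below first N) _ ⟩
    below rest N + below first N                          ≡⟨ cong₂ _+_ (below-roundedCost (f ∘ suc) (R ∘ suc)) firstEq ⟩
    blockCostN (λ i q → f (suc i) (q ℕ./ N)) (R ∘ suc) + segN g S (R zero) ∎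
    where
    open Relation.Binary.PropositionalEquality.≡-Reasoning
    first rest : ℕ → ℕ
    first r = roundedCost r f R zero
    rest  r = ∑ (roundedCost r (f ∘ suc) (R ∘ suc))
    S : ℕ
    S = ∑ (R ∘ suc)
    g : ℕ → ℕ
    g q = f zero (q ℕ./ N)
    firstEq : below first N ≡ segN g S (R zero)
    firstEq = +-cancelˡ-≡ (below g S) _ _ (begin
      below g S + below first N
        ≡⟨ cong (_+ below first N) (sym (below-rounded (f zero) S)) ⟩
      below (λ r → below (f zero) (end r (R ∘ suc))) N + below first N
        ≡⟨ sym (below-distrib (λ r → below (f zero) (end r (R ∘ suc))) first N) ⟩
      below (λ r → below (f zero) (end r (R ∘ suc)) + first r) N
        ≡⟨ below-cong N (λ r _ → trans (sym (below-+ (f zero) (end r (R ∘ suc)) _)) (cong (below (f zero)) (m+[n∸m]≡n (end-mono r R)))) ⟩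
      below (λ r → below (f zero) (end r R)) N
        ≡⟨ below-rounded (f zero) (∑ R) ⟩
      below g (R zero + S)
        ≡⟨ trans (cong (below g) (+-comm (R zero) S)) (below-+ g S (R zero)) ⟩
      below g S + segN g S (R zero) ∎)

  plan-exists : ∀ {m n} (d : Fin n → ℕ) (fac : Fin m → El FacTy) (c : Fin m → Fin n → ℕ∞) (o : Fin m → Bool)
    (W : Fin m → Fin n → ℕ) →
    (∀ {h i j k} → h Fin.< i → j Fin.< k → c h j +∞ c i k ≤⁺ c h k +∞ c i j) →
    (∀ j → ∑ (λ i → W i j) ≡ N * d j) → (∀ i j → c i j ≡ ⊤⁺ → W i j ≡ 0) →
    (∀ i → o i ≡ true → proj₁ (proj₂ (fac i)) ≡ 0 × ∑ (W i) ≤ N * proj₂ (proj₂ (fac i))) →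
    (∀ i → o i ≡ false → ∑ (W i) ≡ 0) →
    ∃ λ y → ∃ λ g → Plan d fac c y g × ∑ y ≡ ∑ d ×
      N * ∑ g ≤ N * ∑ (λ i → if₀ (o i) (proj₁ (fac i))) + ∑ (λ i → ∑ λ j → value (c i j) * W i j)
  plan-exists {m} {n} d fac c o W monge served finite opens shut
    with blockCost (λ i → ψ (λ j → N * d j) (c i)) (λ i → ∑ (W i)) in eq
       | blockCost-optimal (λ j → N * d j) c W monge served finite
  -- Some `r` costs at most the average X / N. With `suc X` in place of infinity, this rounding uses
  -- no forbidden pair. It also opens nothing new, as an empty block stays empty.
  ... | [ X ] | [ X≤ ] with below-average (λ r → ∑ (roundedCost r (λ i → cap∞ (suc X) ∘ ψ d (c i)) (λ i → ∑ (W i)))) N-1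
  ...   | r , r<N , average =
    rounded r R , _ , rounded-plan r d fac c o R b r<N opens shut (s≤s s≤X) ,
    trans (∑-rounded r R r<N) (trans (cong (λ t → (t + r) ℕ./ N) ∑R) end≡) ,
    (begin
      N * ∑ (λ i → open₀ i + s i)                ≡⟨ cong (N *_) (∑-distrib-+ open₀ s) ⟩
      N * (∑ open₀ + ∑ s)                        ≡⟨ *-distribˡ-+ N (∑ open₀) (∑ s) ⟩
      N * ∑ open₀ + N * ∑ s                      ≤⟨ +-monoʳ-≤ (N * ∑ open₀) (≤-trans N*s≤X X≤) ⟩
      N * ∑ open₀ + ∑ (λ i → ∑ λ j → value (c i j) * W i j) ∎)
    where
    open ≤-Reasoning
    b : ℕ
    b = suc X
    R open₀ s : Fin m → ℕ
    R i = ∑ (W i)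
    f : Fin m → ℕ → ℕ
    f i = cap∞ b ∘ ψ d (c i)
    open₀ i = if₀ (o i) (proj₁ (fac i))
    s = roundedCost r f R
    total : below (λ r → ∑ (roundedCost r f R)) N ≡ X
    total = trans (below-roundedCost f R) (blockCost⇒N b (λ i q → ψ d (c i) (q ℕ./ N)) R
      (trans (blockCost-cong (λ _ → refl) (λ i u _ → sym (ψ-scale d (c i) u))) eq))
    N*s≤X : N * ∑ s ≤ X
    N*s≤X = ≤-trans average (≤-reflexive total)
    s≤X : ∑ s ≤ X
    s≤X = ≤-trans (m≤m+n (∑ s) (N-1 * ∑ s)) N*s≤X
    ∑R : ∑ R ≡ N * ∑ d
    ∑R = trans (∑-comm W) (trans (∑-cong served) (∑-scale d))
    end≡ : (N * ∑ d + r) ℕ./ N ≡ ∑ d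
    end≡ = trans (+-distrib-/-∣ˡ r (m∣m*n (∑ d)))
      (trans (cong₂ _+_ (trans (cong (ℕ._/ N) (*-comm N (∑ d))) (m*n/n≡m (∑ d) N)) (m<n⇒m/n≡0 r<N)) (+-identityʳ _))

-- Rational solutions

open import Data.Integer as ℤ using (ℤ; +_; -[1+_])
import Data.Integer.Properties as ℤ

fromℕ-+ : ∀ a b → fromℕ (a + b) ≃ fromℕ a ℚ.+ fromℕ b
fromℕ-+ a b = *≡* (cong (ℤ._* + 1) (sym (cong₂ ℤ._+_ (ℤ.*-identityʳ (+ a)) (ℤ.*-identityʳ (+ b)))))

fromℕ-* : ∀ a b → fromℕ (a * b) ≃ fromℕ a ℚ.* fromℕ b
fromℕ-* a b = *≡* (cong (ℤ._* + 1) (ℤ.pos-* a b))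

fromℕ-mono : ∀ {a b} → a ≤ b → fromℕ a ℚ.≤ fromℕ b
fromℕ-mono le = *≤* (ℤ.*-monoʳ-≤-nonNeg (+ 1) (ℤ.+≤+ le))

fromℕ-cancel : ∀ {a b} → fromℕ a ℚ.≤ fromℕ b → a ≤ b
fromℕ-cancel {a} {b} (*≤* p) = ℤ.drop‿+≤+ (ℤ.*-cancelʳ-≤-pos (+ a) (+ b) (+ 1) p)

-- a = k / N
record Scaled (N : ℕ) (a : ℚᵘ) (k : ℕ) : Set where
  constructor scaled
  field eq : fromℕ N ℚ.* a ≃ fromℕ k

scaled-resp : ∀ {N a b k} → a ≃ b → Scaled N a k → Scaled N b k
scaled-resp {N} a≃b (scaled eq) = scaled (ℚ.≃-trans (ℚ.*-congˡ {fromℕ N} (ℚ.≃-sym a≃b)) eq)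

scaled-0 : ∀ {N} → Scaled N 0ℚᵘ 0
scaled-0 {N} = scaled (ℚ.*-zeroʳ (fromℕ N))

scaled-fromℕ : ∀ N k → Scaled N (fromℕ k) (N * k)
scaled-fromℕ N k = scaled (ℚ.≃-sym (fromℕ-* N k))

scaled-+ : ∀ {N a b k l} → Scaled N a k → Scaled N b l → Scaled N (a ℚ.+ b) (k + l)
scaled-+ {N} {a} {b} {k} {l} (scaled p) (scaled q) = scaled (begin
  fromℕ N ℚ.* (a ℚ.+ b)                ≈⟨ ℚ.*-distribˡ-+ (fromℕ N) a b ⟩
  fromℕ N ℚ.* a ℚ.+ fromℕ N ℚ.* b      ≈⟨ ℚ.+-cong p q ⟩
  fromℕ k ℚ.+ fromℕ l                  ≈⟨ ℚ.≃-sym (fromℕ-+ k l) ⟩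
  fromℕ (k + l)                        ∎)
  where open ℚ.≃-Reasoning

scaled-*ˡ : ∀ {N a k} c → Scaled N a k → Scaled N (fromℕ c ℚ.* a) (c * k)
scaled-*ˡ {N} {a} {k} c (scaled p) = scaled (begin
  fromℕ N ℚ.* (fromℕ c ℚ.* a)   ≈⟨ ℚ.≃-sym (ℚ.*-assoc (fromℕ N) (fromℕ c) a) ⟩
  fromℕ N ℚ.* fromℕ c ℚ.* a     ≈⟨ ℚ.*-congʳ {a} (ℚ.*-comm (fromℕ N) (fromℕ c)) ⟩
  fromℕ c ℚ.* fromℕ N ℚ.* a     ≈⟨ ℚ.*-assoc (fromℕ c) (fromℕ N) a ⟩
  fromℕ c ℚ.* (fromℕ N ℚ.* a)   ≈⟨ ℚ.*-congˡ {fromℕ c} p ⟩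
  fromℕ c ℚ.* fromℕ k           ≈⟨ ℚ.≃-sym (fromℕ-* c k) ⟩
  fromℕ (c * k)                 ∎)
  where open ℚ.≃-Reasoning

scaled-*ʳ : ∀ {N a k} c → Scaled N a k → Scaled N (a ℚ.* fromℕ c) (c * k)
scaled-*ʳ {a = a} c p = scaled-resp (ℚ.*-comm (fromℕ c) a) (scaled-*ˡ c p)

scaled-refine : ∀ {N a k} c → Scaled N a k → Scaled (c * N) a (c * k)
scaled-refine {N} {a} {k} c (scaled p) = scaled (begin
  fromℕ (c * N) ℚ.* a           ≈⟨ ℚ.*-congʳ {a} (fromℕ-* c N) ⟩
  fromℕ c ℚ.* fromℕ N ℚ.* a     ≈⟨ ℚ.*-assoc (fromℕ c) (fromℕ N) a ⟩
  fromℕ c ℚ.* (fromℕ N ℚ.* a)   ≈⟨ ℚ.*-congˡ {fromℕ c} p ⟩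
  fromℕ c ℚ.* fromℕ k           ≈⟨ ℚ.≃-sym (fromℕ-* c k) ⟩
  fromℕ (c * k)                 ∎)
  where open ℚ.≃-Reasoning

scaled-sum : ∀ {N n} (a : Fin n → ℚᵘ) (k : Fin n → ℕ) → (∀ i → Scaled N (a i) (k i)) → Scaled N (sum a) (∑ k)
scaled-sum {n = zero}  a k h = scaled-0
scaled-sum {n = suc n} a k h = scaled-+ (h zero) (scaled-sum (a ∘ suc) (k ∘ suc) (h ∘ suc))

scaled-if : ∀ {N a k} b → Scaled N a k → Scaled N (if b then a else 0ℚᵘ) (if₀ b k)
scaled-if true  p = p
scaled-if false p = scaled-0

scaled-sumOver : ∀ {N m} (F : Subset m) (a : Fin m → ℚᵘ) (k : Fin m → ℕ) → (∀ i → Scaled N (a i) (k i)) →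
                 Scaled N (sumOver F a) (∑ λ i → if₀ (Vec.lookup F i) (k i))
scaled-sumOver F a k h = scaled-sum _ _ λ i → scaled-if (Vec.lookup F i) (h i)

scaled-mono : ∀ {N a b k l} → Scaled N a k → Scaled N b l → a ℚ.≤ b → k ≤ l
scaled-mono {N} (scaled p) (scaled q) a≤b =
  fromℕ-cancel (ℚ.≤-respˡ-≃ p (ℚ.≤-respʳ-≃ q (ℚ.*-monoʳ-≤-nonNeg (fromℕ N) a≤b)))

scaled-reflect : ∀ {N a b k l} → 0 < N → Scaled N a k → Scaled N b l → k ≤ l → a ℚ.≤ b
scaled-reflect {suc N} _ (scaled p) (scaled q) k≤l =
  ℚ.*-cancelˡ-≤-pos (fromℕ (suc N))
    (ℚ.≤-respˡ-≃ (ℚ.≃-sym p) (ℚ.≤-respʳ-≃ (ℚ.≃-sym q) (fromℕ-mono k≤l)))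

scaled-≡ : ∀ {N a b k l} → Scaled N a k → Scaled N b l → a ≃ b → k ≡ l
scaled-≡ p q a≃b = ≤-antisym (scaled-mono p q (ℚ.≤-reflexive a≃b)) (scaled-mono q p (ℚ.≤-reflexive (ℚ.≃-sym a≃b)))

scaled-≃ : ∀ {N a b k} → 0 < N → Scaled N a k → Scaled N b k → a ≃ b
scaled-≃ N>0 p q = ℚ.≤-antisym (scaled-reflect N>0 p q ≤-refl) (scaled-reflect N>0 q p ≤-refl)

scaled-nonNeg : ∀ {N a k} → 0 < N → Scaled N a k → 0ℚᵘ ℚ.≤ a
scaled-nonNeg N>0 p = scaled-reflect N>0 scaled-0 p z≤n

scaled-pos : ∀ {N a k} → 0 < N → 0ℚᵘ ℚ.< a → Scaled N a k → k ≢ 0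
scaled-pos N>0 0<a p refl = ℚ.<-irrefl ℚ.≃-refl (ℚ.<-≤-trans 0<a (scaled-reflect N>0 p scaled-0 z≤n))

scaled-≮ : ∀ {N a k} → ¬ 0ℚᵘ ℚ.< a → Scaled N a k → k ≡ 0
scaled-≮ ¬0<a p = n≤0⇒n≡0 (scaled-mono p scaled-0 (ℚ.≮⇒≥ ¬0<a))

scaled-1 : ∀ {a k} → Scaled 1 a k → a ≃ fromℕ k
scaled-1 {a} (scaled p) = ℚ.≃-trans (ℚ.≃-sym (ℚ.*-identityˡ a)) p

scaled-mkℚᵘ : ∀ k q → Scaled (suc q) (mkℚᵘ (+ k) q) k
scaled-mkℚᵘ k q = scaled (*≡* (begin
  + suc q ℤ.* + k ℤ.* + 1     ≡⟨ ℤ.*-identityʳ (+ suc q ℤ.* + k) ⟩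
  + suc q ℤ.* + k             ≡⟨ ℤ.*-comm (+ suc q) (+ k) ⟩
  + k ℤ.* + suc q             ≡⟨ cong (λ q → + k ℤ.* + suc q) (sym (+-identityʳ q)) ⟩
  + k ℤ.* + suc (q + 0)       ∎))
  where open Relation.Binary.PropositionalEquality.≡-Reasoning

scaled-numerator : ∀ {a} → 0ℚᵘ ℚ.≤ a → ∃ λ k → Scaled (↧ₙ a) a k
scaled-numerator {mkℚᵘ (+ k) q} _ = k , scaled-mkℚᵘ k q
scaled-numerator {mkℚᵘ -[1+ k ] q} (*≤* ())

commonDenominator : ∀ {n} (x : Fin n → ℚᵘ) → (∀ j → 0ℚᵘ ℚ.≤ x j) →
                    ∃ λ N-1 → Σ (Fin n → ℕ) λ k → ∀ j → Scaled (suc N-1) (x j) (k j)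
commonDenominator {zero}  x p = 0 , (λ ()) , λ ()
commonDenominator {suc n} x p with scaled-numerator (p zero) | commonDenominator (x ∘ suc) (p ∘ suc)
... | k₀ , s₀ | N-1 , k , s =
  _ , (λ { zero → suc N-1 * k₀ ; (suc j) → ↧ₙ (x zero) * k j }) ,
  λ { zero → subst (λ M → Scaled M (x zero) (suc N-1 * k₀)) (*-comm (suc N-1) (↧ₙ (x zero))) (scaled-refine (suc N-1) s₀)
    ; (suc j) → scaled-refine (↧ₙ (x zero)) (s j) }

commonDenominator₂ : ∀ {m n} (x : Fin m → Fin n → ℚᵘ) → (∀ i j → 0ℚᵘ ℚ.≤ x i j) →
                     ∃ λ N-1 → Σ (Fin m → Fin n → ℕ) λ k → ∀ i j → Scaled (suc N-1) (x i j) (k i j)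
commonDenominator₂ {zero}  x p = 0 , (λ ()) , λ ()
commonDenominator₂ {suc m} x p with commonDenominator (x zero) (p zero) | commonDenominator₂ (x ∘ suc) (p ∘ suc)
... | M-1 , k₀ , s₀ | N-1 , k , s =
  _ , (λ { zero j → suc N-1 * k₀ j ; (suc i) j → suc M-1 * k i j }) ,
  λ { zero j → subst (λ M → Scaled M (x zero j) (suc N-1 * k₀ j)) (*-comm (suc N-1) (suc M-1)) (scaled-refine (suc N-1) (s₀ j))
    ; (suc i) j → scaled-refine (suc M-1) (s i j) }

-- Feasible solutions as plans, and assignments as feasible solutions

signed : ℤ → ℕ × ℕ
signed (+ k)    = 0 , k
signed -[1+ k ] = 1 , suc k

facility : ∀ {m n} → Instance m n → Fin m → El FacTy
facility I i = openingCost i , signed (capacity i)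
  where open Instance I

∑-mono : ∀ {n} {x y : Fin n → ℕ} → (∀ j → x j ≤ y j) → ∑ x ≤ ∑ y
∑-mono {zero}  h = z≤n
∑-mono {suc n} h = +-mono-≤ (h zero) (∑-mono (h ∘ suc))

≤-∑ : ∀ {n} (x : Fin n → ℕ) j → x j ≤ ∑ x
≤-∑ x zero    = m≤m+n _ _
≤-∑ x (suc j) = ≤-trans (≤-∑ (x ∘ suc) j) (m≤n+m _ (x zero))

if₀-≤ : ∀ b k → if₀ b k ≤ k
if₀-≤ true  k = ≤-refl
if₀-≤ false k = z≤n

if₀-* : ∀ b N k → if₀ b (N * k) ≡ N * if₀ b k
if₀-* true  N k = refl
if₀-* false N k = sym (*-zeroʳ N)

if₀-id : ∀ b k → (b ≡ false → k ≡ 0) → if₀ b k ≡ k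
if₀-id true  k h = refl
if₀-id false k h = sym (h refl)

module _ {m n} (I : Instance m n) where

  open Instance I

  fac : Fin m → El FacTy
  fac = facility I

  scaled-transport : ∀ {N x k} u d → Scaled N x k → Scaled N (transport u d x) (value u * (d * k))
  scaled-transport {x = x} [ c ] d p = scaled-resp (ℚ.≃-sym (ℚ.*-assoc (fromℕ c) (fromℕ d) x)) (scaled-*ˡ c (scaled-*ˡ d p))
  scaled-transport ⊤⁺    d p = scaled-0

  nonNeg-capacity : ∀ z {N a k} → 0 < N → Scaled N a k → a ℚ.≤ fromℤ z → proj₁ (signed z) ≡ 0 × k ≤ N * proj₂ (signed z)
  nonNeg-capacity (+ u)    {N} N>0 p le = refl , scaled-mono p (scaled-fromℕ N u) le
  nonNeg-capacity -[1+ u ] N>0 p le with ℚ.≤-trans (scaled-nonNeg N>0 p) le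
  ... | *≤* ()

  -- Computable from the input: all facilities open and every pair charged for the whole demand.
  -- `code` is at least the finite cost, so codes can be summed without decoding.
  costBound : ℕ
  costBound = ∑ openingCost + ∑ demand * ∑ λ i → ∑ λ j → code (unitCost i j)

  feasible⇒plan : Monge I → ∀ S → Feasible I S →
    ∃ λ y → ∃ λ g → Plan demand fac unitCost y g × ∑ y ≡ ∑ demand ×
      fromℕ (∑ g) ℚ.≤ cost I S × ∑ g ≤ costBound
  feasible⇒plan monge S feasible with commonDenominator₂ (Solution.fraction S) (Feasible.fraction≥0 feasible)
  ... | N-1 , k , s =
    let (y , g , plan , ∑y , bound) = Sampling.plan-exists N-1 demand fac unitCost o W monge served′ infinite′ open′ shut′
    in y , g , plan , ∑y ,
       scaled-reflect (s≤s z≤n) (scaled-fromℕ N (∑ g)) scaled-cost bound ,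
       *-cancelˡ-≤ N (≤-trans bound N*costBound)
    where
    open Solution S
    open Feasible feasible
    N : ℕ
    N = suc N-1
    o : Fin m → Bool
    o = Vec.lookup opened
    W : Fin m → Fin n → ℕ
    -- The number of parts, N to a unit, of the demand of j that i serves: N times d x, where x = k
    -- / N.
    W i j = demand j * k i j
    shut : ∀ i j → o i ≡ false → k i j ≡ 0
    shut i j eq = scaled-≮ (λ lt → true≢false (trans (sym ([]=⇒lookup (onlyOpened i j lt))) eq)) (s i j)
      where
      true≢false : true ≢ false
      true≢false ()
    served-k : ∀ j → ∑ (λ i → k i j) ≡ N
    served-k j = trans (∑-cong λ i → sym (if₀-id (o i) (k i j) (shut i j)))
      (trans (scaled-≡ (scaled-sumOver opened (λ i → fraction i j) (λ i → k i j) (λ i → s i j)) (scaled-fromℕ N 1) (served j))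
             (*-identityʳ N))
    served′ : ∀ j → ∑ (λ i → W i j) ≡ N * demand j
    served′ j = trans (sym (*-distribˡ-sum (demand j) (λ i → k i j))) (trans (cong (demand j *_) (served-k j)) (*-comm (demand j) N))
    infinite′ : ∀ i j → unitCost i j ≡ ⊤⁺ → W i j ≡ 0
    infinite′ i j eq = trans (cong (demand j *_) (scaled-≮ (λ lt → onlyFinite i j lt eq) (s i j))) (*-zeroʳ (demand j))
    open′ : ∀ i → o i ≡ true → proj₁ (proj₂ (fac i)) ≡ 0 × ∑ (W i) ≤ N * proj₂ (proj₂ (fac i))
    open′ i eq = nonNeg-capacity (capacity i) (s≤s z≤n) (scaled-sum _ (W i) λ j → scaled-*ʳ (demand j) (s i j))
                   (capacities i (lookup⇒[]= i opened eq))
    shut′ : ∀ i → o i ≡ false → ∑ (W i) ≡ 0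
    shut′ i eq = ∑-zero⁺ (W i) λ j → trans (cong (demand j *_) (shut i j eq)) (*-zeroʳ (demand j))
    row : Fin m → ℕ
    row i = ∑ λ j → value (unitCost i j) * W i j
    row-shut : ∀ i → o i ≡ false → row i ≡ 0
    row-shut i eq = ∑-zero⁺ _ λ j → trans (cong (value (unitCost i j) *_) (∑-zero⁻ (W i) (shut′ i eq) j)) (*-zeroʳ (value (unitCost i j)))
    scaled-cost : Scaled N (cost I S) (N * ∑ (λ i → if₀ (o i) (openingCost i)) + ∑ row)
    scaled-cost = subst (Scaled N (cost I S))
      (cong₂ _+_ (trans (∑-cong λ i → if₀-* (o i) N (openingCost i)) (sym (*-distribˡ-sum N (λ i → if₀ (o i) (openingCost i)))))
                 (∑-cong λ i → if₀-id (o i) (row i) (row-shut i)))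
      (scaled-+ (scaled-sumOver opened (λ i → fromℕ (openingCost i)) (λ i → N * openingCost i) (λ i → scaled-fromℕ N (openingCost i)))
                (scaled-sumOver opened _ row λ i → scaled-sum _ _ λ j → scaled-transport (unitCost i j) (demand j) (s i j)))
    value≤code : ∀ u → value u ≤ code u
    value≤code [ c ] = n≤1+n c
    value≤code ⊤⁺    = z≤n
    W≤ : ∀ i j → W i j ≤ N * ∑ demand
    W≤ i j = ≤-trans (≤-∑ (λ i → W i j) i) (≤-trans (≤-reflexive (served′ j)) (*-monoʳ-≤ N (≤-∑ demand j)))
    C : ℕ
    C = ∑ λ i → ∑ λ j → code (unitCost i j)
    ∑row≤ : ∑ row ≤ N * (∑ demand * C)
    ∑row≤ = begin
      ∑ row                                                   ≤⟨ ∑-mono (λ i → ∑-mono λ j → *-mono-≤ (value≤code (unitCost i j)) (W≤ i j)) ⟩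
      ∑ (λ i → ∑ λ j → code (unitCost i j) * (N * ∑ demand))  ≡⟨ ∑-cong (λ i → sym (*-distribʳ-sum (N * ∑ demand) (λ j → code (unitCost i j)))) ⟩
      ∑ (λ i → ∑ (λ j → code (unitCost i j)) * (N * ∑ demand)) ≡⟨ sym (*-distribʳ-sum (N * ∑ demand) (λ i → ∑ λ j → code (unitCost i j))) ⟩
      C * (N * ∑ demand)                                      ≡⟨ arrange C N (∑ demand) ⟩
      N * (∑ demand * C)                                      ∎
      where
      open ≤-Reasoning
      arrange : ∀ a b c → a * (b * c) ≡ b * (c * a)
      arrange = solve-∀
    N*costBound : N * ∑ (λ i → if₀ (o i) (openingCost i)) + ∑ row ≤ N * costBound
    N*costBound = ≤-trans (+-mono-≤ (*-monoʳ-≤ N (∑-mono λ i → if₀-≤ (o i) (openingCost i))) ∑row≤)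
      (≤-reflexive (sym (*-distribˡ-+ N (∑ openingCost) (∑ demand * C))))

  module _ {t out} (∑d≤t : ∑ demand ≤ t) (A : Assignment demand fac unitCost t out) where

    open Assignment A

    solution : Solution m n
    solution = record { opened = Vec.tabulate o ; fraction = λ i j → mkℚᵘ (+ x i j) (ℕ.pred (demand j)) }

    open Solution solution

    scaled-fraction : ∀ i j → Scaled (demand j) (fraction i j) (x i j)
    scaled-fraction i j with demand j | demand>0 j
    ... | suc d | _ = scaled-mkℚᵘ (x i j) d

    served-x : ∀ j → ∑ (λ i → x i j) ≡ demand j
    served-x j = trans (filled j) (fill-full demand j ∑d≤t)

    opened-o : ∀ i → Vec.lookup opened i ≡ o i
    opened-o i = lookup∘tabulate o i

    shipped⇒open : ∀ i j → x i j ≢ 0 → o i ≡ true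
    shipped⇒open i j nz with o i in eq
    ... | true  = refl
    ... | false = ⊥-elim (nz (closed i j eq))

    capacity-≤ : ∀ z {k a} → proj₁ (signed z) ≡ 0 → k ≤ proj₂ (signed z) → a ≃ fromℕ k → a ℚ.≤ fromℤ z
    capacity-≤ (+ u) _ k≤ a≃ = ℚ.≤-respˡ-≃ (ℚ.≃-sym a≃) (fromℕ-mono k≤)

    solution-feasible : Feasible I solution
    solution-feasible = record
      { fraction≥0 = λ i j → scaled-nonNeg (demand>0 j) (scaled-fraction i j)
      ; fraction≤1 = λ i j → scaled-reflect (demand>0 j) (scaled-fraction i j) (scaled-fromℕ (demand j) 1)
          (≤-trans (≤-∑ (λ i → x i j) i) (≤-reflexive (trans (served-x j) (sym (*-identityʳ (demand j))))))
      ; onlyOpened = λ i j lt → lookup⇒[]= i opened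
          (trans (opened-o i) (shipped⇒open i j (scaled-pos (demand>0 j) lt (scaled-fraction i j))))
      ; onlyFinite = λ i j lt eq → scaled-pos (demand>0 j) lt (scaled-fraction i j) (infinite i j eq)
      -- The fractions have different denominators, but d times x / d is the integer x, so the load
      -- is compared at scale 1.
      ; capacities = λ i i∈ → capacity-≤ (capacity i) (signs i (open-i i i∈)) (caps i (open-i i i∈))
          (scaled-1 (scaled-sum _ (x i) λ j → scaled (ℚ.≃-trans (ℚ.*-identityˡ _)
            (ℚ.≃-trans (ℚ.*-comm (fraction i j) (fromℕ (demand j))) (Scaled.eq (scaled-fraction i j))))))
      ; served = λ j → scaled-≃ (demand>0 j)
          (scaled-sumOver opened (λ i → fraction i j) (λ i → x i j) (λ i → scaled-fraction i j))
          (subst (Scaled (demand j) 1ℚᵘ)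
            (trans (*-identityʳ (demand j)) (trans (sym (served-x j))
              (∑-cong λ i → sym (if₀-id (Vec.lookup opened i) (x i j) λ eq → closed i j (trans (sym (opened-o i)) eq)))))
            (scaled-fromℕ (demand j) 1))
      }
      where
      open-i : ∀ i → i ∈ˢ opened → o i ≡ true
      open-i i i∈ = trans (sym (opened-o i)) ([]=⇒lookup i∈)

    solution-cost : cost I solution ≃ fromℕ totalCost
    solution-cost = ℚ.≃-trans (scaled-1 (scaled-+
        (scaled-sumOver opened (λ i → fromℕ (openingCost i)) openingCost (λ i → scaled (ℚ.*-identityˡ (fromℕ (openingCost i)))))
        (scaled-sumOver opened _ row λ i → scaled-sum _ _ λ j → scaled-transport₁ (unitCost i j) i j)))
      (ℚ.≃-reflexive (cong fromℕ (trans (cong₂ _+_ (∑-cong λ i → cong (λ b → if₀ b (openingCost i)) (opened-o i)) (∑-cong rows≡))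
        (sym (∑-distrib-+ (λ i → if₀ (o i) (openingCost i)) row)))))
      where
      row : Fin m → ℕ
      row i = ∑ λ j → value (unitCost i j) * x i j
      rows≡ : ∀ i → if₀ (Vec.lookup opened i) (row i) ≡ row i
      rows≡ i = if₀-id (Vec.lookup opened i) (row i) λ eq → ∑-zero⁺ _ λ j →
        trans (cong (value (unitCost i j) *_) (closed i j (trans (sym (opened-o i)) eq))) (*-zeroʳ (value (unitCost i j)))
      scaled-transport₁ : ∀ u i j → Scaled 1 (transport u (demand j) (fraction i j)) (value u * x i j)
      scaled-transport₁ ⊤⁺    i j = scaled-0
      scaled-transport₁ [ c ] i j = scaled-resp (ℚ.≃-sym (ℚ.*-assoc (fromℕ c) (fromℕ (demand j)) (fraction i j)))
        (scaled-*ˡ c (scaled (ℚ.≃-trans (ℚ.*-identityˡ _) (Scaled.eq (scaled-fraction i j)))))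

-- Encodings and the final assembly

n≤2^⌈log₂n⌉ : ∀ n → n ≤ 2 ^ ⌈log₂ n ⌉
n≤2^⌈log₂n⌉ = <-rec (λ n → n ≤ 2 ^ ⌈log₂ n ⌉) bound
  where
  bound : ∀ n → (∀ {k} → k < n → k ≤ 2 ^ ⌈log₂ k ⌉) → n ≤ 2 ^ ⌈log₂ n ⌉
  bound zero          ih = z≤n
  bound (suc zero)    ih = m^n>0 2 ⌈log₂ 1 ⌉
  bound n@(suc (suc k)) ih = begin
    n                                        ≡⟨ sym (⌊n/2⌋+⌈n/2⌉≡n n) ⟩
    ℕ.⌊ n /2⌋ + ℕ.⌈ n /2⌉                    ≤⟨ +-monoˡ-≤ ℕ.⌈ n /2⌉ (⌊n/2⌋≤⌈n/2⌉ n) ⟩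
    ℕ.⌈ n /2⌉ + ℕ.⌈ n /2⌉                    ≤⟨ +-mono-≤ half half ⟩
    2 ^ (⌈log₂ n ⌉ ∸ 1) + 2 ^ (⌈log₂ n ⌉ ∸ 1) ≡⟨ cong (λ k → 2 ^ (⌈log₂ n ⌉ ∸ 1) + k) (sym (+-identityʳ _)) ⟩
    2 ^ suc (⌈log₂ n ⌉ ∸ 1)                  ≡⟨ cong (2 ^_) (m+[n∸m]≡n {1} (⌈log₂⌉-mono-≤ {2} {n} (s≤s (s≤s z≤n)))) ⟩
    2 ^ ⌈log₂ n ⌉                            ∎
    where
    open ≤-Reasoning
    half : ℕ.⌈ n /2⌉ ≤ 2 ^ (⌈log₂ n ⌉ ∸ 1)
    half = ≤-trans (ih (⌈n/2⌉<n k)) (≤-reflexive (cong (2 ^_) (⌈log₂⌈n/2⌉⌉≡⌈log₂n⌉∸1 n)))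

-- This makes the input size the bound from which `growth` starts.
enc-small : ∀ τ v → Small (size (enc τ v)) τ v
enc-small num      k       = ≤-trans (n≤2^⌈log₂n⌉ (suc k)) (^-monoʳ-≤ 2 (n≤1+n ⌈log₂ suc k ⌉))
enc-small (σ ⊗ τ)  (v , w) =
  small-mono σ (≤-trans (m≤m+n _ _) (n≤1+n _)) (enc-small σ v) ,
  small-mono τ (≤-trans (m≤n+m _ (size (enc σ v))) (n≤1+n _)) (enc-small τ w)
enc-small (list τ) []       = z≤n , []
enc-small (list τ) (x ∷ xs) with enc-small (list τ) xs
... | len , all =
  s≤s (≤-trans len (m≤n+m _ (size (enc τ x)))) ,
  small-mono τ (≤-trans (m≤m+n _ _) (n≤1+n _)) (enc-small τ x) ∷
  All.map (small-mono τ (≤-trans (m≤n+m _ (size (enc τ x))) (n≤1+n _))) all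

encodeVector-tabulate : ∀ {n} τ {f : Fin n → Val} (g : Fin n → El τ) → (∀ i → f i ≡ enc τ (g i)) →
                        encodeVector f ≡ enc (list τ) (tabulate g)
encodeVector-tabulate {zero}  τ g h = refl
encodeVector-tabulate {suc n} τ g h = cong₂ pair (h zero) (encodeVector-tabulate τ (g ∘ suc) (h ∘ suc))

foldl-∑ : ∀ {A : Set} {n} (w : A → ℕ) (g : Fin n → A) a → foldl (λ s x → w x + s) a (tabulate g) ≡ a + ∑ (w ∘ g)
foldl-∑ {n = zero}  w g a = sym (+-identityʳ a)
foldl-∑ {n = suc n} w g a = trans (foldl-∑ w (g ∘ suc) (w (g zero) + a)) (rearrange (w (g zero)) a _)
  where
  rearrange : ∀ x y z → x + y + z ≡ y + (x + z)
  rearrange = solve-∀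

foldl-suc : ∀ {A : Set} {n} (g : Fin n → A) a → foldl (λ s _ → 1 + s) a (tabulate g) ≡ n + a
foldl-suc {n = zero}  g a = refl
foldl-suc {n = suc n} g a = trans (foldl-suc (g ∘ suc) (suc a)) (+-suc n a)

zip-reverse : ∀ {A B C : Set} {n} (k : A → B → C) (f : Fin n → A) (g : Fin n → B) acc →
  proj₂ (foldl (λ s b → uncons (proj₁ s) s λ a as → as , k a b ∷ proj₂ s) (tabulate f , acc) (tabulate g)) ≡
  tabulate (λ i → k (f i) (g i)) ʳ++ acc
zip-reverse {n = zero}  k f g acc = refl
zip-reverse {n = suc n} k f g acc = zip-reverse k (f ∘ suc) (g ∘ suc) (k (f zero) (g zero) ∷ acc)

iterates-⊇ : ∀ f N k acc {j} → j ∈ acc → j ∈ iterates f N k acc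
iterates-⊇ f zero    k       acc i = i
iterates-⊇ f (suc N) zero    acc i = i
iterates-⊇ f (suc N) (suc k) acc i = iterates-⊇ f N (f (suc k)) (suc k ∷ acc) (there i)

iterates-complete : ∀ N k acc → k ≤ N → ∀ j → 0 < j → j ≤ k → j ∈ iterates (_∸ 1) N k acc
iterates-complete zero    zero    acc le j j>0 j≤k = ⊥-elim (<⇒≱ j>0 j≤k)
iterates-complete (suc N) zero    acc le j j>0 j≤k = ⊥-elim (<⇒≱ j>0 j≤k)
iterates-complete (suc N) (suc k) acc (s≤s le) j j>0 j≤k with j ℕ.≟ suc k
... | yes refl = iterates-⊇ (_∸ 1) N k (suc k ∷ acc) (here refl)
... | no j≢    = iterates-complete N k (suc k ∷ acc) le j j>0 (≤-pred (≤∧≢⇒< j≤k j≢))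

-- Halving loses at most the parity bit, so in reversed order each guess is at most twice its
-- predecessor plus 1. As `k < 2 ^ N`, the descent reaches 0 within `N` steps, and the smallest
-- guess has predecessor 0.
iterates-doubling : ∀ U N k acc → k < 2 ^ N → Doubling U k acc → Doubling U 0 (iterates (ℕ._/ 2) N k acc)
iterates-doubling U zero    zero    acc lt       p = p
iterates-doubling U zero    (suc k) acc (s≤s ()) p
iterates-doubling U (suc N) zero    acc lt       p = p
iterates-doubling U (suc N) (suc k) acc lt       p =
  iterates-doubling U N (suc k ℕ./ 2) (suc k ∷ acc)
    (m<n*o⇒m/o<n (<-≤-trans lt (≤-reflexive (*-comm 2 (2 ^ N)))))
    (s≤s z≤n , half , p)
  where
  half : suc k ≤ 2 * (suc k ℕ./ 2) + 1
  half = ≤-trans (≤-reflexive (m≡m%n+[m/n]*n (suc k) 2))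
    (≤-trans (+-mono-≤ (≤-pred (m%n<n (suc k) 2)) (≤-reflexive (*-comm (suc k ℕ./ 2) 2))) (≤-reflexive (+-comm 1 _)))

-- `⌈1/_⌉` is minus a floor of a negative quotient, which is rounded away from 0 when there is a
-- remainder.
∣/ℕ∣≥ : ∀ q p → suc q ℕ./ suc p ≤ ℤ.∣ -[1+ q ] ℤ./ℕ suc p ∣
∣/ℕ∣≥ q p with suc q ℕ.% suc p
... | zero  = ≤-reflexive (sym (ℤ.∣-i∣≡∣i∣ (+ (suc q ℕ./ suc p))))
... | suc _ = n≤1+n _

⌈1/⌉≥ : ∀ q p → suc q ℕ./ suc p ≤ ⌈1/ mkℚᵘ (+ suc p) q ⌉
⌈1/⌉≥ q p = ≤-trans (∣/ℕ∣≥ q p)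
  (≤-reflexive (sym (trans (ℤ.∣-i∣≡∣i∣ (+ 1 ℤ.* w)) (cong ℤ.∣_∣ (ℤ.*-identityˡ w)))))
  where
  w : ℤ
  w = -[1+ q ] ℤ./ℕ suc p

module Correctness {m n} (I : Instance m n) (monge : Monge I) (p q : ℕ) where

  open Instance I

  ε : ℚᵘ
  ε = mkℚᵘ (+ suc p) q

  input : El InTy
  input = (tabulate (facility I) , tabulate demand , tabulate λ i → tabulate λ j → code (unitCost i j)) ,
          (0 , suc p) , suc q

  input-enc : encodeInput I ε ≡ enc InTy input
  input-enc = cong₂ pair
    (cong₂ pair (encodeVector-tabulate FacTy (facility I) λ i → cong (pair (nat (openingCost i))) (signed-enc (capacity i)))
      (cong₂ pair (encodeVector-tabulate num demand λ _ → refl)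
        (encodeVector-tabulate (list num) _ λ i → encodeVector-tabulate num _ λ j → code-enc (unitCost i j))))
    refl
    where
    signed-enc : ∀ z → encodeℤ z ≡ enc (num ⊗ num) (signed z)
    signed-enc (+ _)    = refl
    signed-enc -[1+ _ ] = refl
    code-enc : ∀ u → encodeℕ∞ u ≡ nat (code u)
    code-enc [ _ ] = refl
    code-enc ⊤⁺    = refl

  sizes : Vec.Vec ℕ 2
  sizes = size (encodeInput I ε) ∷ ⌈1/ ε ⌉ ∷ []

  open Growth sizes using (⟪_⟫)

  input-small : Small (size (encodeInput I ε)) InTy input
  input-small = subst (λ v → Small (size v) InTy input) (sym input-enc) (enc-small InTy input)

  opaque

    pre : Parameters
    pre = parameters input

  U B E : ℕ
  U = proj₁ pre
  B = proj₁ (proj₂ pre)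
  E = 1 + quot (suc q) (suc p)

  opaque
    unfolding pre

    count-eq : foldl (λ s _ → 1 + s) 1 (tabulate λ i → tabulate λ j → code (unitCost i j)) ≡ suc m
    count-eq = trans (foldl-suc (λ i → tabulate λ j → code (unitCost i j)) 1) (+-comm m 1)

    R-eq : proj₁ (proj₂ (proj₂ pre)) ≡ 2 * suc m * E
    R-eq = cong (λ k → 2 * k * E) count-eq

    B-eq : B ≡ 2 * suc m * E + suc m
    B-eq = cong₂ _+_ R-eq count-eq

    D-eq : proj₁ (proj₂ (proj₂ (proj₂ pre))) ≡ ∑ demand
    D-eq = foldl-∑ id demand 0

    U-eq : U ≡ 1 + costBound I
    U-eq = cong suc (cong₂ _+_ (foldl-∑ proj₁ (facility I) 0) (cong₂ _*_ D-eq codes))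
      where
      foldl-rows : ∀ {k} (g : Fin k → List ℕ) (w : Fin k → ℕ) → (∀ i a → foldl (λ s c → c + s) a (g i) ≡ a + w i) →
                   ∀ a → foldl (λ s row → foldl (λ s c → c + s) s row) a (tabulate g) ≡ a + ∑ w
      foldl-rows {zero}  g w h a = sym (+-identityʳ a)
      foldl-rows {suc k} g w h a = trans (foldl-rows (g ∘ suc) (w ∘ suc) (h ∘ suc) _)
        (trans (cong (_+ ∑ (w ∘ suc)) (h zero a)) (+-assoc a (w zero) _))
      codes : foldl (λ s row → foldl (λ s c → c + s) s row) 0 (tabulate λ i → tabulate λ j → code (unitCost i j)) ≡
              ∑ λ i → ∑ λ j → code (unitCost i j)
      codes = foldl-rows _ _ (λ i a → foldl-∑ id (λ j → code (unitCost i j)) a) 0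

    sites-eq : proj₂ (proj₂ (proj₂ (proj₂ pre))) ≡ reverse (tabulate λ i → site demand (facility I i) (unitCost i))
    sites-eq = trans (zip-reverse (λ f row → f , zipRow (tabulate demand) row) (facility I) (λ i → tabulate λ j → code (unitCost i j)) [])
      (cong reverse (tabulate-cong λ i → cong (facility I i ,_) (zip-reverse _,_ demand (λ j → code (unitCost i j)) [])))

    pre-small : Small ⟪ valueBound ⟫ PreTy pre
    pre-small = parameters-small sizes input input-small

    program-runs : B ≤ ⟪ keyBound ⟫ → Exec (enc InTy input ∷ []) program
      (enc OutTy (result (guesses (scales sizes pre) (keys sizes pre) pre))) ⟪ programTime ⟫
    program-runs = program-correct sizes input input-small

  B≤ : B ≤ ⟪ keyBound ⟫
  B≤ = begin
    B                                   ≡⟨ B-eq ⟩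
    2 * suc m * E + suc m               ≤⟨ +-mono-≤ (*-mono-≤ (*-monoʳ-≤ 2 m≤) E≤) m≤ ⟩
    2 * (size (encodeInput I ε) + 1) * (⌈1/ ε ⌉ + 1) + (size (encodeInput I ε) + 1) ≡⟨ sym (keyBound-eval _ _) ⟩
    ⟪ keyBound ⟫                        ∎
    where
    open ≤-Reasoning
    m≤ : suc m ≤ size (encodeInput I ε) + 1
    m≤ = ≤-trans (s≤s (≤-trans (≤-reflexive (sym (length-tabulate λ i → tabulate λ j → code (unitCost i j))))
                   (proj₁ (proj₂ (proj₂ (proj₁ input-small)))))) (≤-reflexive (+-comm 1 _))
    E≤ : E ≤ ⌈1/ ε ⌉ + 1
    E≤ = ≤-trans (s≤s (⌈1/⌉≥ q p)) (≤-reflexive (+-comm 1 _))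

  opaque

    keys-bounded : All (_≤ B) (keys sizes pre)
    keys-bounded = iterates-bounded (λ k → m∸n≤m k 1) B ⟪ keyBound ⟫ B [] ≤-refl []

    keys-complete : ∀ k → 0 < k → k ≤ B → k ∈ keys sizes pre
    keys-complete = iterates-complete ⟪ keyBound ⟫ B [] B≤

    doubling : Doubling U 0 (scales sizes pre)
    doubling = iterates-doubling U ⟪ valueBound ⟫ U [] (proj₁ pre-small) ≤-refl

  open Guessing demand (facility I) unitCost (keys sizes pre) B keys-bounded keys-complete
    pre E (s≤s z≤n) R-eq B-eq D-eq sites-eq

  planOf : ∀ S → Feasible I S → ∃ λ z → PlanOf z × fromℕ z ℚ.≤ cost I S × z ≤ costBound I
  planOf S feasible =
    let (y , g , plan , ∑y , cost≤ , bound) = feasible⇒plan I monge S feasible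
    in ∑ g , (y , g , plan , ∑y , refl) , cost≤ , bound

  output : El OutTy
  output = result (guesses (scales sizes pre) (keys sizes pre) pre)

  -- Feasibility enters only here: it supplies the plan of cost at most `U` that forces some guess
  -- to succeed.
  output-good : ∃ (Feasible I) → Good output
  output-good (S , feasible) =
    let (z , plan , _ , z≤) = planOf S feasible
        (e , eq , good) = guesses-good U (≤-trans (s≤s z≤n) (≤-reflexive (sym U-eq)))
          (z , ≤-trans z≤ (≤-trans (n≤1+n _) (≤-reflexive (sym U-eq))) , plan)
          0 (scales sizes pre) doubling (λ _ _ → inj₁ refl)
    in subst Good (sym (cong result eq)) good

  solution-enc : ∀ {t} (D≤ : ∑ demand ≤ t) (A : Assignment demand (facility I) unitCost t output) →
                 enc OutTy output ≡ encodeSolution (solution I D≤ A)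
  solution-enc D≤ A = trans (cong (enc OutTy) A.out-eq) (sym (cong₂ pair
      (encodeVector-tabulate num _ λ i → trans (cong fromBool (lookup∘tabulate A.o i)) (fromBool-bit (A.o i)))
      (encodeVector-tabulate (list FracTy) _ λ i → encodeVector-tabulate FracTy _ λ j →
        cong (λ d → pair (pair (nat 0) (nat (A.x i j))) (nat d)) (suc-pred (demand j) ⦃ ℕ.>-nonZero (demand>0 j) ⦄))))
    where
    module A = Assignment A
    fromBool-bit : ∀ b → fromBool b ≡ nat (bit b)
    fromBool-bit true  = refl
    fromBool-bit false = refl

  -- The excess z / E is at most ε z because 1 / E ≤ ε, used in the form that the denominator of ε
  -- is at most `E` times its numerator.
  ratio : ∀ κ z → κ * E ≤ z * (1 + E) → fromℕ κ ℚ.≤ (1ℚᵘ ℚ.+ ε) ℚ.* fromℕ z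
  ratio κ z le = scaled-reflect (s≤s z≤n) (scaled-fromℕ (suc q) κ)
    (scaled-*ʳ z (scaled-+ (scaled-fromℕ (suc q) 1) (scaled-mkℚᵘ (suc p) q)))
    (*-cancelˡ-≤ E (begin
      E * (suc q * κ)                             ≡⟨ eq₁ E (suc q) κ ⟩
      suc q * (κ * E)                             ≤⟨ *-monoʳ-≤ (suc q) le ⟩
      suc q * (z * (1 + E))                       ≡⟨ eq₂ (suc q) z E ⟩
      z * suc q + E * (z * suc q)                 ≤⟨ +-monoˡ-≤ _ (*-monoʳ-≤ z (suc-quot-* (suc q) (suc p) (s≤s z≤n))) ⟩
      z * (E * suc p) + E * (z * suc q)           ≡⟨ eq₃ z E (suc p) (suc q) ⟩
      E * (z * (suc q * 1 + suc p))               ∎))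
    where
    open ≤-Reasoning
    eq₁ : ∀ e a k → e * (a * k) ≡ a * (k * e)
    eq₁ = solve-∀
    eq₂ : ∀ a z e → a * (z * (1 + e)) ≡ z * a + e * (z * a)
    eq₂ = solve-∀
    eq₃ : ∀ z e b a → z * (e * b) + e * (z * a) ≡ e * (z * (a * 1 + b))
    eq₃ = solve-∀

  correct : ∃[ v ] ∃[ t ]
    ((encodeInput I ε ∷ []) ⊢ program ⇓ v at t)
    × t ≤ ⟦ programTime ⟧ sizes
    × (∃ (Feasible I) →
       ∃[ S ] (v ≡ encodeSolution S × Feasible I S
              × (∀ S* → Optimal I S* → cost I S ℚ.≤ (1ℚᵘ ℚ.+ ε) ℚ.* cost I S*)))
  correct =
    let (t , run , t≤) = program-runs B≤ in
    enc OutTy output , t , subst (λ v → (v ∷ []) ⊢ program ⇓ enc OutTy output at t) (sym input-enc) run , t≤ ,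
    λ feasible → let (t , D≤ , A , approx) = output-good feasible in
      solution I D≤ A , solution-enc D≤ A , solution-feasible I D≤ A ,
      λ S* optimal → let (z , plan , z≤ , _) = planOf S* (proj₁ optimal) in
        ℚ.≤-respˡ-≃ (ℚ.≃-sym (solution-cost I D≤ A))
          (ℚ.≤-trans (ratio (Assignment.totalCost A) z (approx z plan))
            (ℚ.*-monoʳ-≤-nonNeg (1ℚᵘ ℚ.+ ε) ⦃ ℚ.nonNegative 1+ε≥0 ⦄ z≤))
    where
    1+ε≥0 : 0ℚᵘ ℚ.≤ 1ℚᵘ ℚ.+ ε
    1+ε≥0 = scaled-nonNeg (s≤s z≤n) (scaled-+ (scaled-fromℕ (suc q) 1) (scaled-mkℚᵘ (suc p) q))

correct-ε : ∀ {m n} (I : Instance m n) → Monge I → (ε : ℚᵘ) .{{_ : Positive ε}} →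
  ∃[ v ] ∃[ t ]
    ((encodeInput I ε ∷ []) ⊢ program ⇓ v at t)
    × t ≤ ⟦ programTime ⟧ (size (encodeInput I ε) ∷ ⌈1/ ε ⌉ ∷ [])
    × (∃ (Feasible I) →
       ∃[ S ] (v ≡ encodeSolution S × Feasible I S
              × (∀ S* → Optimal I S* → cost I S ℚ.≤ (1ℚᵘ ℚ.+ ε) ℚ.* cost I S*)))
correct-ε I monge (mkℚᵘ (+ suc p) q)              = Correctness.correct I monge p q
correct-ε I monge (mkℚᵘ (+ zero)  q) {{positive}} = ⊥-elim-irr (ℤ.Positive.pos positive)
correct-ε I monge (mkℚᵘ -[1+ p ]  q) {{positive}} = ⊥-elim-irr (ℤ.Positive.pos positive)

theorem4 : Σ Program λ A → Σ (Polynomial 2) λ p →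
    ∀ {m n : ℕ} (I : Instance m n) → Monge I →
    (ε : ℚᵘ) .{{_ : Positive ε}} →
    ∃[ v ] ∃[ t ]
    ((encodeInput I ε ∷ []) ⊢ A ⇓ v at t)
    × t ≤ ⟦ p ⟧ (size (encodeInput I ε) ∷ ⌈1/ ε ⌉ ∷ [])
    × (∃ (Feasible I) →
    ∃[ S ] (v ≡ encodeSolution S
    × Feasible I S
    × (∀ S* → Optimal I S* → cost I S ℚ.≤ (1ℚᵘ ℚ.+ ε) ℚ.* cost I S*)))
theorem4 = program , programTime , correct-ε
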